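{- There is a fixed constant $c>0$ such that the following holds. Let $p\in(0,1)$, $q=1-p$, and let $D\sim\mathcal D_p$ be the scaled Bernoulli demand vector. For any bipartite graph $G$ with $n$ nodes in each partition and average degree $d$ (an integer with $0\le d<n$), the expected loss satisfies $$L(G)\ \ge\ \mathbb P\{\mathrm{Bin}(n-d,p)\ge np\}\cdot nq^{d}\ \ge\ \left(\frac12-\frac{dp}{\sqrt{2\pi(n-d)pq}}-\frac{c(1-2pq)}{\sqrt{(n-d)pq}}\right)nq^{d}.$$
   Context: A bipartite graph $G=([n],[n],E)$ has $n$ supply nodes (left) and $n$ demand nodes (right), $E\subseteq[n]\times[n]$; its average degree is $d=|E|/n$. For a demand vector $D\in\mathbb R_{\ge0}^n$ define the maximum fulfilled demand $$z(G,D)=\max_{x_{ij}\ge 0}\ \sum_{(i,j)\in E}x_{ij}\quad\text{s.t.}\quad \sum_{j:(i,j)\in E}x_{ij}\le 1\ \ (i\in[n]),\qquad \sum_{i:(i,j)\in E}x_{ij}\le D_j\ \ (j\in[n]).$$ Let $K_{n,n}$ be the complete bipartite graph, $L(G,D)=z(K_{n,n},D)-z(G,D)$, and $L(G)=\mathbb E_{D\sim\mathcal D_p}[L(G,D)]$. Under $\mathcal D_p$, the coordinates $D_j$ are independent, each equal to $1/p$ with probability $p$ and $0$ with probability $q=1-p$. $\mathrm{Bin}(m,p)$ denotes a binomial random variable. -}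

module Defs where

open import Algebra.Bundles using (CommutativeRing)
open import Data.Bool.Base using (Bool; true; false; if_then_else_)
open import Data.Fin.Base using (Fin; toℕ)
open import Data.Nat.Base as ℕ using (ℕ; zero; suc; _∸_)
open import Data.Nat.Combinatorics using (_C_)
import Data.Nat.Properties as ℕ
import Algebra.Properties.CommutativeMonoid.Sum ℕ.+-0-commutativeMonoid as ℕSum
open import Data.Product.Base using (∃; _×_; _,_)
open import Data.Vec.Base using (Vec; []; _∷_; lookup; map; foldr′)
open import Data.Vec.Functional using (Vector)
open import Level using (0ℓ)
open import Relation.Nullary.Decidable.Core using (does)
open import Relation.Binary.Core using (Rel)
open import Relation.Binary.Structures using (IsDecTotalOrder)
import Algebra.Properties.Semiring.Exp as Exp
import Algebra.Properties.Semiring.Mult as Mult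
import Algebra.Properties.Semiring.Sum as Sum
import Relation.Binary.Construct.NonStrictToStrict as ToStrict

-- The classical real numbers, characterised up to unique isomorphism as the
-- Dedekind-complete ordered field.  Inverse and supremum are total operations:
-- `0# ⁻¹` and suprema of empty or unbounded predicates are left unspecified.
record CompleteOrderedField : Set₁ where
  infix 4 _≤_
  infix 9 _⁻¹
  infixl 7 _/_

  field
    commutativeRing : CommutativeRing 0ℓ 0ℓ

  open CommutativeRing commutativeRing public

  field
    _≤_             : Rel Carrier 0ℓ
    isDecTotalOrder : IsDecTotalOrder _≈_ _≤_
    0≉1             : 0# ≉ 1#
    +-monoˡ-≤       : ∀ z {x y} → x ≤ y → x + z ≤ y + z
    *-nonNeg        : ∀ {x y} → 0# ≤ x → 0# ≤ y → 0# ≤ x * y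
    _⁻¹             : Carrier → Carrier
    ⁻¹-cong         : ∀ {x y} → x ≈ y → x ⁻¹ ≈ y ⁻¹
    ⁻¹-inverseʳ     : ∀ {x} → x ≉ 0# → x * x ⁻¹ ≈ 1#

  UpperBound : (Carrier → Set) → Carrier → Set
  UpperBound P b = ∀ x → P x → x ≤ b

  LeastUpperBound : (Carrier → Set) → Carrier → Set
  LeastUpperBound P s = UpperBound P s × (∀ b → UpperBound P b → s ≤ b)

  field
    sup     : (Carrier → Set) → Carrier
    sup-lub : ∀ P → ∃ P → ∃ (UpperBound P) → LeastUpperBound P (sup P)

  open IsDecTotalOrder isDecTotalOrder public using (_≤?_)
  open ToStrict _≈_ _≤_ public using (_<_)
  open Exp semiring public using (_^_)
  open Sum semiring public using (sum; sum-syntax; sum⁺-syntax)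

  _/_ : Carrier → Carrier → Carrier
  x / y = x * y ⁻¹

  fromℕ : ℕ → Carrier
  fromℕ n = n Mult× 1#
    where open Mult semiring using () renaming (_×_ to _Mult×_)

-- A bipartite graph ([n],[n],E): `G i j` tells whether the supply node i is
-- joined to the demand node j.
BipartiteGraph : ℕ → Set
BipartiteGraph n = Fin n → Fin n → Bool

complete : ∀ n → BipartiteGraph n
complete n _ _ = true

edgeCount : ∀ {n} → BipartiteGraph n → ℕ
edgeCount {n} G = ∑[ i < n ] ∑[ j < n ] (if G i j then 1 else 0)
  where open ℕSum using (sum-syntax)

-- Number of unit cells [i,i+1]×[j,j+1] of [0,N]² contained in the disc of radius
-- N about the origin; such a cell is contained in it iff its outer corner is.
quarterDiscCells : ℕ → ℕ
quarterDiscCells N = ∑[ i < N ] ∑[ j < N ]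
  (if does (suc (toℕ i) ℕ.^ 2 ℕ.+ suc (toℕ j) ℕ.^ 2 ℕ.≤? N ℕ.^ 2) then 1 else 0)
  where open ℕSum using (sum-syntax)

module Reals (ℝ : CompleteOrderedField) where
  open CompleteOrderedField ℝ

  -- The nonnegative square root of x ≥ 0; the disjunct y ≤ 0# keeps the set
  -- inhabited for x < 0, where the value is 0.
  √_ : Carrier → Carrier
  √ x = sup (λ y → y ≤ 0# ⊎ y * y ≤ x)
    where open import Data.Sum.Base using (_⊎_)

  infix 9 √_

  -- The area of the unit disc: four times the inner area of its quarter,
  -- approximated from inside by square grids of mesh 1/N, N ≥ 1.
  π : Carrier
  π = fromℕ 4 * sup (λ a → ∃ λ k →
        a ≈ fromℕ (quarterDiscCells (suc k)) / fromℕ (suc k ℕ.^ 2))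

module Loss (ℝ : CompleteOrderedField) where
  open CompleteOrderedField ℝ

  onEdge : ∀ {n} → BipartiteGraph n → (Fin n → Fin n → Carrier) →
           Fin n → Fin n → Carrier
  onEdge G x i j = if G i j then x i j else 0#

  record Feasible {n} (G : BipartiteGraph n) (D : Vector Carrier n)
                  (x : Fin n → Fin n → Carrier) : Set where
    field
      nonNeg : ∀ i j → 0# ≤ x i j
      supply : ∀ i → ∑[ j < n ] onEdge G x i j ≤ 1#
      demand : ∀ j → ∑[ i < n ] onEdge G x i j ≤ D j

  fulfilled : ∀ {n} → BipartiteGraph n → (Fin n → Fin n → Carrier) → Carrier
  fulfilled {n} G x = ∑[ i < n ] ∑[ j < n ] onEdge G x i j

  -- For D ≥ 0 the feasible values form a nonempty compact set (bounded by n),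
  -- so that this supremum is the maximum of the linear program.
  z : ∀ {n} → BipartiteGraph n → Vector Carrier n → Carrier
  z G D = sup (λ v → ∃ λ x → Feasible G D x × v ≈ fulfilled G x)

  lossAt : ∀ {n} → BipartiteGraph n → Vector Carrier n → Carrier
  lossAt {n} G D = z (complete n) D - z G D

  -- An outcome ω : Vec Bool n records which of n independent p-coins succeed.
  ∑Outcomes : ∀ n → (Vec Bool n → Carrier) → Carrier
  ∑Outcomes zero    f = f []
  ∑Outcomes (suc n) f = ∑Outcomes n (λ ω → f (true ∷ ω)) + ∑Outcomes n (λ ω → f (false ∷ ω))

  prob : Carrier → ∀ {n} → Vec Bool n → Carrier
  prob p ω = foldr′ _*_ 1# (map (λ b → if b then p else (1# - p)) ω)

  𝔼 : Carrier → ∀ {n} → (Vec Bool n → Carrier) → Carrier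
  𝔼 p {n} f = ∑Outcomes n (λ ω → prob p ω * f ω)

  bernoulliDemand : Carrier → ∀ {n} → Vec Bool n → Vector Carrier n
  bernoulliDemand p ω j = if lookup ω j then 1# / p else 0#

  expectedLoss : Carrier → ∀ {n} → BipartiteGraph n → Carrier
  expectedLoss p G = 𝔼 p (λ ω → lossAt G (bernoulliDemand p ω))

  -- ℙ{Bin(m,p) ≥ t}
  ℙ[Bin_,_≥_] : ℕ → Carrier → Carrier → Carrier
  ℙ[Bin m , p ≥ t ] = ∑[ k ≤ m ]
    (if does (t ≤? fromℕ (toℕ k))
     then fromℕ (m C toℕ k) * p ^ toℕ k * (1# - p) ^ (m ∸ toℕ k)
     else 0#)

{-# OPTIONS --safe #-}
module Submission where

-- Loss.  Let S be the random set of demand nodes with positive demand.  If |S| ≥ np, then K_{n,n}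
-- fulfils n units, while in G a supply node without neighbours in S is idle; the loss is therefore at
-- least the number of such nodes.  A node of degree x is one of them, jointly with |S| ≥ np, with
-- probability φ(x) = qˣ ℙ{Bin(n−x,p) ≥ np}, and φ is convex, so the average of φ over the degrees is
-- at least φ(d).
--
-- Tail.  The error term absorbs everything of order 1/σ, σ² = mpq, m = n − d, so no central limit
-- theorem is needed.  Let k + 1 = ⌊mp⌋ and b be the density of X ~ Bin(m,p).  The differences
-- b(k+i) − b(k−i) change sign at most once, from + to −, and have a nonnegative first moment, so
-- ℙ{X > k} ≥ ℙ{X < k}.  At most dp + 2 integers lie between k and np, whence
-- ℙ{X ≥ np} ≥ 1/2 − (dp + 5/2) max b, and it remains to see that b ≤ (1 + 2/σ)/√(2πσ²) near the mean.
-- For fixed j the maximum of b(j) over p is at p = j/m, and Stirling's formula, in the form that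
-- ((j+1)/j)^(2j+1) is decreasing, compares it with a central binomial coefficient.  The latter is
-- compared with π by Wästlund's proof of the Wallis product: a staircase of rectangles with sides
-- C(2i,i)/4ⁱ has the area n by the convolution identity for central binomial coefficients, and it
-- covers a quarter disc of nearly the same area.

-- The obstacle is π, which is available only as a supremum of areas of grid polygons inside the
-- disc. An upper bound for the density asks only for an upper bound for π, and that is a bound for
-- every cell count separately. Hence the Wallis and Stirling estimates are inequalities between
-- natural numbers, with fractions cross-multiplied, and the limit in Stirling's formula is replaced
-- by monotonicity of the likelihood ratio in each of its two arguments.
--
-- The constant c = 10 keeps the rest elementary. If the claimed lower bound for the tail is not
-- positive, nothing has to be shown. Otherwise 1 - 2pq ≥ 1/2 makes the last error term at least
-- 5/σ, so that σ ≥ 10, and the first error term yields dp ≤ 2σ. All relevant integers a then lie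
-- within 2σ of the mean, where a(m - a) is close to mσ² and polynomial inequalities in σ with
-- explicit slack suffice.
--
-- Convexity of φ is probabilistic: its decrements are expectations over outcomes with one
-- prescribed success, and the decrements of these prescribe two successes.

open import Defs
open import Data.Nat.Base as ℕ using (ℕ; _∸_)
open import Data.Product.Base using (∃; _×_; _,_)
open import Relation.Binary.PropositionalEquality.Core using (_≡_)
open import Algebra.Bundles using (CommutativeMonoid)
open import Level using (Level)

-- Finite sums over initial segments of the naturals.

module RangeSum {c ℓ : Level} (M : CommutativeMonoid c ℓ) where
  open import Data.Nat.Base as ℕ using (ℕ; zero; suc; _∸_)
  open import Data.Fin.Base using (toℕ)
  open import Data.Fin.Properties using (toℕ<n)
  open import Function.Base using (_∘_)
  open import Relation.Binary.PropositionalEquality as ≡ using (_≡_)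
  open CommutativeMonoid M
  open import Algebra.Properties.CommutativeMonoid.Sum M
  open import Relation.Binary.Reasoning.Setoid setoid

  -- Opaque, so that the summand can be inferred from a sum.
  opaque
    Σ< : ℕ → (ℕ → Carrier) → Carrier
    Σ< n f = sum {n} (λ i → f (toℕ i))

    Σ<-sum : ∀ n f → Σ< n f ≡ sum {n} (λ i → f (toℕ i))
    Σ<-sum n f = ≡.refl

    Σ<-empty : ∀ f → Σ< 0 f ≡ ε
    Σ<-empty f = ≡.refl

    Σ<-first : ∀ n f → Σ< (suc n) f ≡ f 0 ∙ Σ< n (f ∘ suc)
    Σ<-first n f = ≡.refl

    Σ<-cong : ∀ n {f g} → (∀ i → i ℕ.< n → f i ≈ g i) → Σ< n f ≈ Σ< n g
    Σ<-cong n f≈g = sum-cong-≋ (λ i → f≈g (toℕ i) (toℕ<n i))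

    Σ<-zero : ∀ n {f} → (∀ i → i ℕ.< n → f i ≈ ε) → Σ< n f ≈ ε
    Σ<-zero n f≈ε = trans (Σ<-cong n f≈ε) (sum-replicate-zero n)

    Σ<-∙ : ∀ n f g → Σ< n (λ i → f i ∙ g i) ≈ Σ< n f ∙ Σ< n g
    Σ<-∙ n f g = ∑-distrib-+ {n} (λ i → f (toℕ i)) (λ i → g (toℕ i))

    Σ<-split : ∀ m n f → Σ< (m ℕ.+ n) f ≈ Σ< m f ∙ Σ< n (λ i → f (m ℕ.+ i))
    Σ<-split zero    n f = sym (identityˡ _)
    Σ<-split (suc m) n f = trans (∙-congˡ (Σ<-split m n (f ∘ suc))) (sym (assoc _ _ _))

    Σ<-last : ∀ n f → Σ< (suc n) f ≈ Σ< n f ∙ f n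
    Σ<-last zero    f = comm _ _
    Σ<-last (suc n) f = trans (∙-congˡ (Σ<-last n (f ∘ suc))) (sym (assoc _ _ _))

    Σ<-reverse : ∀ n f → Σ< n f ≈ Σ< n (λ i → f (n ∸ suc i))
    Σ<-reverse zero    f = refl
    Σ<-reverse (suc n) f = begin
      Σ< (suc n) f                       ≈⟨ Σ<-last n f ⟩
      Σ< n f ∙ f n                       ≈⟨ comm _ _ ⟩
      f n ∙ Σ< n f                       ≈⟨ ∙-congˡ (Σ<-reverse n f) ⟩
      f n ∙ Σ< n (λ i → f (n ∸ suc i))   ∎

-- The Wallis product: cells of the quarter disc and central binomial coefficients.

module Wallis where
  open import Data.Bool.Base using (if_then_else_)
  open import Data.Nat.Base
  open import Data.Nat.Properties
  open import Data.Nat.Tactic.RingSolver using (solve-∀)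
  open import Data.Nat.Combinatorics using (_C_; nCk≡n!/k![n-k]!; k![n∸k]!∣n!)
  open import Data.Nat.DivMod using (m/n*n≡m)
  open import Data.Fin.Base using (toℕ)
  open import Data.Sum.Base using (inj₁; inj₂)
  open import Function.Base using (_∘_)
  open import Relation.Nullary using (¬_; Dec; does; yes; no; contradiction)
  open import Relation.Binary.PropositionalEquality
  import Algebra.Properties.Semiring.Sum +-*-semiring as SSum
  open RangeSum +-0-commutativeMonoid

  opaque
    unfolding Σ<

    Σ<-mono-≤ : ∀ n {f g} → (∀ i → i < n → f i ≤ g i) → Σ< n f ≤ Σ< n g
    Σ<-mono-≤ zero    f≤g = z≤n
    Σ<-mono-≤ (suc n) f≤g = +-mono-≤ (f≤g 0 z<s) (Σ<-mono-≤ n (λ i i<n → f≤g (suc i) (s<s i<n)))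

    *-Σ< : ∀ n k f → k * Σ< n f ≡ Σ< n (λ i → k * f i)
    *-Σ< n k f = SSum.*-distribˡ-sum {n} k (λ i → f (toℕ i))

    Σ<-const : ∀ n k → Σ< n (λ _ → k) ≡ n * k
    Σ<-const zero    k = refl
    Σ<-const (suc n) k = cong (k +_) (Σ<-const n k)

    -- Blocks of lengths A 0, A 1, … starting at the partial sums of A.
    Σ<-blocks : ∀ n A f → Σ< (Σ< n A) f ≡ Σ< n (λ a → Σ< (A a) (λ i → f (Σ< a A + i)))
    Σ<-blocks zero    A f = refl
    Σ<-blocks (suc n) A f = trans (Σ<-split (A 0) (Σ< n (A ∘ suc)) f) (cong (Σ< (A 0) f +_)
      (trans (Σ<-blocks n (A ∘ suc) (λ i → f (A 0 + i)))
             (Σ<-cong n (λ a _ → Σ<-cong (A (suc a)) (λ i _ → cong f (sym (+-assoc (A 0) (Σ< a (A ∘ suc)) i)))))))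

    -- Only indices below B contribute, each at most 1. Used for a column of cells, with B the
    -- height of the staircase there.
    Σ<-truncate : ∀ n {f} B → (∀ j → f j ≤ 1) → (∀ j → B ≤ j → f j ≡ 0) → Σ< n f ≤ B
    Σ<-truncate zero        B       f≤1 f≡0 = z≤n
    Σ<-truncate (suc n) {f} zero    f≤1 f≡0 rewrite f≡0 0 z≤n =
      Σ<-truncate n zero (f≤1 ∘ suc) (λ j _ → f≡0 (suc j) z≤n)
    Σ<-truncate (suc n)     (suc B) f≤1 f≡0 =
      +-mono-≤ (f≤1 0) (Σ<-truncate n B (f≤1 ∘ suc) (λ j B≤j → f≡0 (suc j) (s≤s B≤j)))

  cell : ℕ → ℕ → ℕ → ℕ
  cell N i j = if does (suc i ^ 2 + suc j ^ 2 ≤? N ^ 2) then 1 else 0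

  -- Stated for an arbitrary decision, so that case analysis does not have to abstract the
  -- comparison inside `cell`.
  indicator : {P : Set} → Dec P → ℕ
  indicator P? = if does P? then 1 else 0

  indicator≤1 : {P : Set} (P? : Dec P) → indicator P? ≤ 1
  indicator≤1 (yes _) = ≤-refl
  indicator≤1 (no  _) = z≤n

  indicator-no : {P : Set} (P? : Dec P) → ¬ P → indicator P? ≡ 0
  indicator-no (yes p) ¬p = contradiction p ¬p
  indicator-no (no  _) _  = refl

  indicator-mono : {P Q : Set} (P? : Dec P) (Q? : Dec Q) → (P → Q) → indicator P? ≤ indicator Q?
  indicator-mono (no  _) _       _   = z≤n
  indicator-mono (yes _) (yes _) _   = ≤-refl
  indicator-mono (yes p) (no ¬q) imp = contradiction (imp p) ¬q

  cell≤1 : ∀ N i j → cell N i j ≤ 1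
  cell≤1 N i j = indicator≤1 (suc i ^ 2 + suc j ^ 2 ≤? N ^ 2)

  -- The outer corner decides about the cell, and it is strictly farther from the origin than the
  -- inner corner (i, j).
  cell-outside : ∀ N i j → N ^ 2 ≤ i ^ 2 + j ^ 2 → cell N i j ≡ 0
  cell-outside N i j out = indicator-no (suc i ^ 2 + suc j ^ 2 ≤? N ^ 2) λ in′ →
    <⇒≱ (+-mono-<-≤ (^-monoˡ-< 2 (n<1+n i)) (^-monoˡ-≤ 2 (n≤1+n j))) (≤-trans in′ out)

  cell-mono : ∀ M N i j i′ j′ → (suc i ^ 2 + suc j ^ 2 ≤ M ^ 2 → suc i′ ^ 2 + suc j′ ^ 2 ≤ N ^ 2) →
              cell M i j ≤ cell N i′ j′
  cell-mono M N i j i′ j′ =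
    indicator-mono (suc i ^ 2 + suc j ^ 2 ≤? M ^ 2) (suc i′ ^ 2 + suc j′ ^ 2 ≤? N ^ 2)

  opaque
    unfolding Σ<

    quarterDiscCells≡Σ< : ∀ N → quarterDiscCells N ≡ Σ< N (λ i → Σ< N (cell N i))
    quarterDiscCells≡Σ< N = refl

  -- Each cell at scale k contains t² cells at scale k t.
  refine : ∀ k t → t * t * quarterDiscCells k ≤ quarterDiscCells (k * t)
  refine k t = begin
    t * t * quarterDiscCells k
      ≡⟨ cong (t * t *_) (quarterDiscCells≡Σ< k) ⟩
    t * t * Σ< k (λ a → Σ< k (cell k a))
      ≡⟨ trans (*-assoc t t _) (trans (cong (t *_) (*-Σ< k t _)) (*-Σ< k t _)) ⟩
    Σ< k (λ a → t * (t * Σ< k (cell k a)))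
      ≡⟨ Σ<-cong k (λ a _ → trans (cong (t *_) (*-Σ< k t _)) (sym (Σ<-const t _))) ⟩
    Σ< k (λ a → Σ< t (λ i → Σ< k (λ b → t * cell k a b)))
      ≡⟨ Σ<-cong k (λ a _ → Σ<-cong t (λ i _ → Σ<-cong k (λ b _ → sym (Σ<-const t _)))) ⟩
    Σ< k (λ a → Σ< t (λ i → Σ< k (λ b → Σ< t (λ j → cell k a b))))
      ≤⟨ Σ<-mono-≤ k (λ a _ → Σ<-mono-≤ t (λ i i<t → Σ<-mono-≤ k (λ b _ → Σ<-mono-≤ t (λ j j<t →
         cell-mono k (k * t) a b (origin a + i) (origin b + j) (scaled a b i<t j<t))))) ⟩
    Σ< k (λ a → Σ< t (λ i → Σ< k (λ b → Σ< t (λ j → cell (k * t) (origin a + i) (origin b + j)))))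
      ≡⟨ Σ<-cong k (λ a _ → Σ<-cong t (λ i _ → sym (Σ<-blocks k (λ _ → t) (cell (k * t) (origin a + i))))) ⟩
    Σ< k (λ a → Σ< t (λ i → Σ< (Σ< k (λ _ → t)) (cell (k * t) (origin a + i))))
      ≡⟨ sym (Σ<-blocks k (λ _ → t) (λ i → Σ< (Σ< k (λ _ → t)) (cell (k * t) i))) ⟩
    Σ< (Σ< k (λ _ → t)) (λ i → Σ< (Σ< k (λ _ → t)) (cell (k * t) i))
      ≡⟨ cong (λ K → Σ< K (λ i → Σ< K (cell (k * t) i))) (Σ<-const k t) ⟩
    Σ< (k * t) (λ i → Σ< (k * t) (cell (k * t) i))
      ≡⟨ sym (quarterDiscCells≡Σ< (k * t)) ⟩
    quarterDiscCells (k * t) ∎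
    where
    open ≤-Reasoning
    origin : ℕ → ℕ
    origin a = Σ< a (λ _ → t)
    next : ∀ a {i} → i < t → suc (origin a + i) ≤ suc a * t
    next a {i} i<t = begin
      suc (origin a + i) ≡⟨ cong (λ s → suc (s + i)) (Σ<-const a t) ⟩
      suc (a * t + i)   ≡⟨ sym (+-suc (a * t) i) ⟩
      a * t + suc i     ≤⟨ +-monoʳ-≤ (a * t) i<t ⟩
      a * t + t         ≡⟨ +-comm (a * t) t ⟩
      suc a * t         ∎
    -- Among the small cells in the block over (a, b), the outermost corner is the scaled outer
    -- corner of the large cell.
    scaled : ∀ a b {i j} → i < t → j < t → suc a ^ 2 + suc b ^ 2 ≤ k ^ 2 →
             suc (origin a + i) ^ 2 + suc (origin b + j) ^ 2 ≤ (k * t) ^ 2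
    scaled a b {i} {j} i<t j<t h = begin
      suc (origin a + i) ^ 2 + suc (origin b + j) ^ 2
        ≤⟨ +-mono-≤ (^-monoˡ-≤ 2 (next a i<t)) (^-monoˡ-≤ 2 (next b j<t)) ⟩
      (suc a * t) ^ 2 + (suc b * t) ^ 2   ≡⟨ eq (suc a) (suc b) t ⟩
      (suc a ^ 2 + suc b ^ 2) * t ^ 2     ≤⟨ *-monoˡ-≤ (t ^ 2) h ⟩
      k ^ 2 * t ^ 2                       ≡⟨ sym (eq₂ k t) ⟩
      (k * t) ^ 2                         ∎
      where
      eq : ∀ a b t → ((a * t) * ((a * t) * 1)) + ((b * t) * ((b * t) * 1)) ≡ ((a * (a * 1)) + (b * (b * 1))) * (t * (t * 1))
      eq = solve-∀
      eq₂ : ∀ a t → ((a * t) * ((a * t) * 1)) ≡ (a * (a * 1)) * (t * (t * 1))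
      eq₂ = solve-∀

  -- Wästlund's staircase: A i is proportional to the central binomial probability
  -- C(2i,i)/4ⁱ, whose recurrence is the hypothesis `rec`.
  module Staircase (A : ℕ → ℕ) (N : ℕ)
                   (rec : ∀ i → i < N → (2 * i + 2) * A (suc i) ≡ (2 * i + 1) * A i) where

    S : ℕ → ℕ
    S n = Σ< n A

    -- By `rec` the quantity 2i · A i grows by exactly A i at each step. This turns radii into
    -- single terms of the sequence.
    S≡2iA : ∀ i → i ≤ N → S i ≡ 2 * i * A i
    S≡2iA zero    _   = Σ<-empty A
    S≡2iA (suc i) i<N = begin
      S (suc i)               ≡⟨ Σ<-last i A ⟩
      S i + A i               ≡⟨ cong (_+ A i) (S≡2iA i (<⇒≤ i<N)) ⟩
      2 * i * A i + A i       ≡⟨ eq i (A i) ⟩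
      (2 * i + 1) * A i       ≡⟨ sym (rec i i<N) ⟩
      (2 * i + 2) * A (suc i) ≡⟨ cong (_* A (suc i)) (eq₂ i) ⟩
      2 * suc i * A (suc i)   ∎
      where
      open ≡-Reasoning
      eq : ∀ i a → 2 * i * a + a ≡ (2 * i + 1) * a
      eq = solve-∀
      eq₂ : ∀ i → 2 * i + 2 ≡ 2 * suc i
      eq₂ = solve-∀

    -- For the sequence C(2i,i)/4ⁱ the generating function is (1 - x)^(-1/2), and these are the
    -- coefficients of its square 1/(1 - x).
    convolution : ℕ → ℕ
    convolution n = Σ< (suc n) (λ a → A a * A (n ∸ a))

    -- By `S≡2iA` the second factor is S (n ∸ a), so this is also the area of a staircase with
    -- columns of width A a and height S (n ∸ a).
    moment : ℕ → ℕ
    moment n = Σ< (suc n) (λ a → A a * (2 * (n ∸ a) * A (n ∸ a)))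

    -- Averaging the sum with its reversal replaces the weight 2(n - a) by n.
    moment-symmetric : ∀ n → moment n ≡ n * convolution n
    moment-symmetric n = *-cancelˡ-≡ _ _ 2 (begin
      2 * moment n                            ≡⟨ cong (moment n +_) (+-identityʳ _) ⟩
      moment n + moment n                     ≡⟨ cong (moment n +_) (Σ<-reverse (suc n) _) ⟩
      moment n + Σ< (suc n) (λ a → A (n ∸ a) * (2 * (n ∸ (n ∸ a)) * A (n ∸ (n ∸ a))))
        ≡⟨ sym (Σ<-∙ (suc n) _ _) ⟩
      Σ< (suc n) (λ a → A a * (2 * (n ∸ a) * A (n ∸ a))
                      + A (n ∸ a) * (2 * (n ∸ (n ∸ a)) * A (n ∸ (n ∸ a))))
        ≡⟨ Σ<-cong (suc n) (λ a a≤n → step a (≤-pred a≤n)) ⟩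
      Σ< (suc n) (λ a → 2 * n * (A a * A (n ∸ a)))
        ≡⟨ sym (*-Σ< (suc n) (2 * n) _) ⟩
      2 * n * convolution n                   ≡⟨ *-assoc 2 n _ ⟩
      2 * (n * convolution n)                 ∎)
      where
      open ≡-Reasoning
      eq : ∀ a b x y → x * (2 * b * y) + y * (2 * a * x) ≡ 2 * (a + b) * (x * y)
      eq = solve-∀
      step : ∀ a → a ≤ n → A a * (2 * (n ∸ a) * A (n ∸ a))
                         + A (n ∸ a) * (2 * (n ∸ (n ∸ a)) * A (n ∸ (n ∸ a))) ≡ 2 * n * (A a * A (n ∸ a))
      step a a≤n rewrite m∸[m∸n]≡n a≤n =
        trans (eq a (n ∸ a) (A a) (A (n ∸ a))) (cong (λ m → 2 * m * (A a * A (n ∸ a))) (m+[n∸m]≡n a≤n))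

    -- The recurrence lowers the second factor from index n + 1 - a to n - a; the surplus terms add
    -- up to the convolution, and the summand a = n + 1 is zero.
    moment-suc : ∀ n → n < N → moment (suc n) ≡ moment n + convolution n
    moment-suc n n<N = begin
      moment (suc n)
        ≡⟨ Σ<-last (suc n) (λ a → A a * (2 * (suc n ∸ a) * A (suc n ∸ a))) ⟩
      Σ< (suc n) (λ a → A a * (2 * (suc n ∸ a) * A (suc n ∸ a))) + A (suc n) * (2 * (n ∸ n) * A (n ∸ n))
        ≡⟨ cong (λ d → Σ< (suc n) (λ a → A a * (2 * (suc n ∸ a) * A (suc n ∸ a))) + A (suc n) * (2 * d * A d)) (n∸n≡0 n) ⟩
      Σ< (suc n) (λ a → A a * (2 * (suc n ∸ a) * A (suc n ∸ a))) + A (suc n) * 0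
        ≡⟨ cong₂ _+_ (Σ<-cong (suc n) (λ a a≤n → step a (≤-pred a≤n))) (*-zeroʳ (A (suc n))) ⟩
      Σ< (suc n) (λ a → A a * (2 * (n ∸ a) * A (n ∸ a)) + A a * A (n ∸ a)) + 0
        ≡⟨ +-identityʳ _ ⟩
      Σ< (suc n) (λ a → A a * (2 * (n ∸ a) * A (n ∸ a)) + A a * A (n ∸ a))
        ≡⟨ Σ<-∙ (suc n) _ _ ⟩
      moment n + convolution n ∎
      where
      open ≡-Reasoning
      eq : ∀ b x → 2 * suc b * x ≡ (2 * b + 2) * x
      eq = solve-∀
      eq₂ : ∀ b x y → x * ((2 * b + 1) * y) ≡ x * (2 * b * y) + x * y
      eq₂ = solve-∀
      step : ∀ a → a ≤ n → A a * (2 * (suc n ∸ a) * A (suc n ∸ a))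
                         ≡ A a * (2 * (n ∸ a) * A (n ∸ a)) + A a * A (n ∸ a)
      step a a≤n rewrite +-∸-assoc 1 a≤n =
        trans (cong (A a *_) (trans (eq (n ∸ a) _) (rec (n ∸ a) (≤-<-trans (m∸n≤m n a) n<N)))) (eq₂ (n ∸ a) (A a) _)

    convolution-constant : ∀ n → n ≤ N → convolution n ≡ A 0 * A 0
    convolution-constant zero    _   = trans (Σ<-last 0 _) (cong (_+ A 0 * A 0) (Σ<-empty _))
    convolution-constant (suc n) n<N = *-cancelˡ-≡ _ _ (suc n) (begin
      suc n * convolution (suc n)       ≡⟨ sym (moment-symmetric (suc n)) ⟩
      moment (suc n)                    ≡⟨ moment-suc n n<N ⟩
      moment n + convolution n          ≡⟨ cong (_+ convolution n) (moment-symmetric n) ⟩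
      n * convolution n + convolution n ≡⟨ +-comm _ (convolution n) ⟩
      suc n * convolution n             ≡⟨ cong (suc n *_) (convolution-constant n (<⇒≤ n<N)) ⟩
      suc n * (A 0 * A 0)               ∎)
      where open ≡-Reasoning

    -- One step multiplies the quantity by (2j+1)(2j+3)/(2j+2)², which is below 1.
    upper-decreasing : ∀ {i j} → i ≤ j → j ≤ N → (2 * j + 1) * A j ^ 2 ≤ (2 * i + 1) * A i ^ 2
    upper-decreasing {i} {zero}  z≤n _ = ≤-refl
    upper-decreasing {i} {suc j} i≤j j<N with m≤n⇒m<n∨m≡n i≤j
    ... | inj₂ refl = ≤-refl
    ... | inj₁ i<j  = ≤-trans (*-cancelˡ-≤ ((2 * j + 2) ^ 2) {{m^n≢0 (2 * j + 2) 2 {{>-nonZero (m≤n⇒m≤o+n (2 * j) z<s)}}}} (begin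
      (2 * j + 2) ^ 2 * ((2 * suc j + 1) * A (suc j) ^ 2) ≡⟨ eq₁ j (A (suc j)) ⟩
      (2 * j + 3) * ((2 * j + 2) * A (suc j)) ^ 2         ≡⟨ cong (λ x → (2 * j + 3) * x ^ 2) (rec j j<N) ⟩
      (2 * j + 3) * ((2 * j + 1) * A j) ^ 2               ≤⟨ m≤m+n _ _ ⟩
      (2 * j + 3) * ((2 * j + 1) * A j) ^ 2 + (2 * j + 1) * A j ^ 2 ≡⟨ eq₂ j (A j) ⟩
      (2 * j + 2) ^ 2 * ((2 * j + 1) * A j ^ 2)           ∎)) (upper-decreasing (≤-pred i<j) (<⇒≤ j<N))
      where
      open ≤-Reasoning
      eq₁ : ∀ j x → ((2 * j + 2) * ((2 * j + 2) * 1)) * ((2 * suc j + 1) * (x * (x * 1))) ≡ (2 * j + 3) * (((2 * j + 2) * x) * (((2 * j + 2) * x) * 1))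
      eq₁ = solve-∀
      eq₂ : ∀ j x → (2 * j + 3) * (((2 * j + 1) * x) * (((2 * j + 1) * x) * 1)) + (2 * j + 1) * (x * (x * 1)) ≡ ((2 * j + 2) * ((2 * j + 2) * 1)) * ((2 * j + 1) * (x * (x * 1)))
      eq₂ = solve-∀

    -- For j > 0 one step multiplies the quantity by (2j+1)²/(4j(j+1)), which exceeds 1.
    lower-increasing : ∀ {i j} → i ≤ j → j ≤ N → i * A i ^ 2 ≤ j * A j ^ 2
    lower-increasing {i} {zero}  z≤n _ = ≤-refl
    lower-increasing {i} {suc j} i≤j j<N with m≤n⇒m<n∨m≡n i≤j
    ... | inj₂ refl = ≤-refl
    ... | inj₁ i<j  = ≤-trans (lower-increasing (≤-pred i<j) (<⇒≤ j<N))
      (*-cancelˡ-≤ ((2 * j + 2) ^ 2) {{m^n≢0 (2 * j + 2) 2 {{>-nonZero (m≤n⇒m≤o+n (2 * j) z<s)}}}} (begin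
      (2 * j + 2) ^ 2 * (j * A j ^ 2)                     ≤⟨ m≤m+n _ _ ⟩
      (2 * j + 2) ^ 2 * (j * A j ^ 2) + suc j * A j ^ 2   ≡⟨ eq₁ j (A j) ⟩
      suc j * ((2 * j + 1) * A j) ^ 2                     ≡⟨ cong (λ x → suc j * x ^ 2) (sym (rec j j<N)) ⟩
      suc j * ((2 * j + 2) * A (suc j)) ^ 2               ≡⟨ eq₂ j (A (suc j)) ⟩
      (2 * j + 2) ^ 2 * (suc j * A (suc j) ^ 2)           ∎))
      where
      open ≤-Reasoning
      eq₁ : ∀ j x → ((2 * j + 2) * ((2 * j + 2) * 1)) * (j * (x * (x * 1))) + suc j * (x * (x * 1)) ≡ suc j * (((2 * j + 1) * x) * (((2 * j + 1) * x) * 1))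
      eq₁ = solve-∀
      eq₂ : ∀ j x → suc j * (((2 * j + 2) * x) * (((2 * j + 2) * x) * 1)) ≡ ((2 * j + 2) * ((2 * j + 2) * 1)) * (suc j * (x * (x * 1)))
      eq₂ = solve-∀

    corner-axis : ∀ b n → b ≡ suc n → S n ^ 2 ≤ S 0 ^ 2 + S b ^ 2
    corner-axis b n refl = ≤-trans (^-monoˡ-≤ 2 (begin
      S n       ≤⟨ m≤m+n (S n) (A n) ⟩
      S n + A n ≡⟨ sym (Σ<-last n A) ⟩
      S (suc n) ∎)) (m≤n+m _ _)
      where open ≤-Reasoning

    -- (S a , S b) is an inner corner of the staircase made of the rectangles A i × A j with i + j ≤ n,
    -- so that the staircase covers the quarter disc of radius S n.
    corner : ∀ a b n → suc n ≤ N → a + b ≡ suc n → S n ^ 2 ≤ S a ^ 2 + S b ^ 2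
    corner zero    b    n _ eq = corner-axis b n eq
    corner (suc a) zero n _ eq = subst (S n ^ 2 ≤_) (+-comm (S 0 ^ 2) (S (suc a) ^ 2))
      (corner-axis (suc a) n (trans (sym (+-identityʳ (suc a))) eq))
    corner (suc a) (suc b) n n<N eq = begin
      S n ^ 2                               ≡⟨ cong (_^ 2) (S≡2iA n (<⇒≤ n<N)) ⟩
      (2 * n * A n) ^ 2                     ≡⟨ e₁ n (A n) ⟩
      4 * n * (n * A n ^ 2)                 ≤⟨ *-monoʳ-≤ (4 * n) (lower-increasing (n≤1+n n) n<N) ⟩
      4 * n * (suc n * A (suc n) ^ 2)       ≤⟨ m≤m+n _ _ ⟩
      4 * n * (suc n * A (suc n) ^ 2) + 2 * n * A (suc n) ^ 2 ≡⟨ e₂ n (A (suc n)) ⟩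
      2 * n * h                             ≡⟨ cong (λ m → 2 * m * h) (sym (suc-injective (trans (cong suc (sym (+-suc a b))) eq))) ⟩
      2 * suc (a + b) * h                   ≡⟨ e₃ a b h ⟩
      (2 * a + 1) * h + (2 * b + 1) * h     ≤⟨ +-mono-≤ (side a a<n) (side b b<n) ⟩
      S (suc a) ^ 2 + S (suc b) ^ 2         ∎
      where
      open ≤-Reasoning
      -- The common unit of both sides: S n ² is at most 2n h, and S (suc i) ² is at least (2i+1) h
      -- because 4(i+1)² exceeds (2i+1)(2i+3). Here 2n = (2a+1) + (2b+1).
      h = (2 * suc n + 1) * A (suc n) ^ 2
      a<n : suc a ≤ suc n
      a<n = subst (suc a ≤_) eq (m≤m+n (suc a) (suc b))
      b<n : suc b ≤ suc n
      b<n = subst (suc b ≤_) eq (m≤n+m (suc b) (suc a))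
      e₁ : ∀ n x → ((2 * n * x) * ((2 * n * x) * 1)) ≡ 4 * n * (n * (x * (x * 1)))
      e₁ = solve-∀
      e₂ : ∀ n x → 4 * n * (suc n * (x * (x * 1))) + 2 * n * (x * (x * 1)) ≡ 2 * n * ((2 * suc n + 1) * (x * (x * 1)))
      e₂ = solve-∀
      e₃ : ∀ a b h → 2 * suc (a + b) * h ≡ (2 * a + 1) * h + (2 * b + 1) * h
      e₃ = solve-∀
      e₄ : ∀ i x → (2 * i + 1) * ((2 * suc i + 1) * (x * (x * 1))) + (x * (x * 1)) ≡ ((2 * suc i * x) * ((2 * suc i * x) * 1))
      e₄ = solve-∀
      side : ∀ i → suc i ≤ suc n → (2 * i + 1) * h ≤ S (suc i) ^ 2
      side i i<n = begin
        (2 * i + 1) * h                                       ≤⟨ *-monoʳ-≤ (2 * i + 1) (upper-decreasing i<n n<N) ⟩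
        (2 * i + 1) * ((2 * suc i + 1) * A (suc i) ^ 2)       ≤⟨ m≤m+n _ _ ⟩
        (2 * i + 1) * ((2 * suc i + 1) * A (suc i) ^ 2) + A (suc i) ^ 2 ≡⟨ e₄ i (A (suc i)) ⟩
        (2 * suc i * A (suc i)) ^ 2                           ≡⟨ cong (_^ 2) (sym (S≡2iA (suc i) (≤-trans i<n n<N))) ⟩
        S (suc i) ^ 2                                         ∎

    -- By `corner`, a column in block a leaves the disc of radius S n no higher than S (suc n ∸ a).
    -- Widths times heights add up to a staircase area, which the constancy of the convolution
    -- evaluates.
    cells≤ : ∀ n → suc n ≤ N → quarterDiscCells (S n) ≤ suc n * (A 0 * A 0)
    cells≤ n n<N = begin
      quarterDiscCells (S n)
        ≡⟨ quarterDiscCells≡Σ< (S n) ⟩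
      Σ< (S n) (λ i → Σ< (S n) (cell (S n) i))
        ≡⟨ Σ<-blocks n A (λ i → Σ< (S n) (cell (S n) i)) ⟩
      Σ< n (λ a → Σ< (A a) (λ i → Σ< (S n) (cell (S n) (S a + i))))
        ≤⟨ Σ<-mono-≤ n (λ a a<n → Σ<-mono-≤ (A a) (λ i _ → Σ<-truncate (S n) (S (suc n ∸ a))
             (cell≤1 (S n) (S a + i)) (λ j j≥ → cell-outside (S n) (S a + i) j (begin
               S n ^ 2                         ≤⟨ corner a (suc n ∸ a) n n<N (m+[n∸m]≡n (m≤n⇒m≤1+n (<⇒≤ a<n))) ⟩
               S a ^ 2 + S (suc n ∸ a) ^ 2     ≤⟨ +-mono-≤ (^-monoˡ-≤ 2 (m≤m+n (S a) i)) (^-monoˡ-≤ 2 j≥) ⟩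
               (S a + i) ^ 2 + j ^ 2           ∎)))) ⟩
      Σ< n (λ a → Σ< (A a) (λ i → S (suc n ∸ a)))
        ≡⟨ Σ<-cong n (λ a _ → Σ<-const (A a) _) ⟩
      Σ< n (λ a → A a * S (suc n ∸ a))
        -- The summands a = n and a = n + 1 are added to complete `moment (suc n)`.
        ≤⟨ m≤m+n _ _ ⟩
      Σ< n (λ a → A a * S (suc n ∸ a)) + A n * S (suc n ∸ n)
        ≡⟨ sym (Σ<-last n (λ a → A a * S (suc n ∸ a))) ⟩
      Σ< (suc n) (λ a → A a * S (suc n ∸ a))
        ≤⟨ m≤m+n _ _ ⟩
      Σ< (suc n) (λ a → A a * S (suc n ∸ a)) + A (suc n) * S (suc n ∸ suc n)
        ≡⟨ sym (Σ<-last (suc n) (λ a → A a * S (suc n ∸ a))) ⟩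
      Σ< (suc (suc n)) (λ a → A a * S (suc n ∸ a))
        ≡⟨ Σ<-cong (suc (suc n)) (λ a _ → cong (A a *_) (S≡2iA (suc n ∸ a) (≤-trans (m∸n≤m (suc n) a) n<N))) ⟩
      moment (suc n)
        ≡⟨ moment-symmetric (suc n) ⟩
      suc n * convolution (suc n)
        ≡⟨ cong (suc n *_) (convolution-constant (suc n) n<N) ⟩
      suc n * (A 0 * A 0) ∎
      where open ≤-Reasoning

  -- Writing the upper index as a + b keeps truncated subtraction out of the recurrences that
  -- follow.
  choose-factorial : ∀ a b → ((a + b) C a) * (a ! * b !) ≡ (a + b) !
  choose-factorial a b = begin
    ((a + b) C a) * (a ! * b !)
      ≡⟨ cong₂ (λ c x → c * (a ! * x !)) (nCk≡n!/k![n-k]! (m≤m+n a b)) (sym (m+n∸m≡n a b)) ⟩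
    ((a + b) ! / (a ! * (a + b ∸ a) !)) * (a ! * (a + b ∸ a) !)
      ≡⟨ m/n*n≡m (k![n∸k]!∣n! (m≤m+n a b)) ⟩
    (a + b) ! ∎
    where
    open ≡-Reasoning
    instance _ = a !* (a + b ∸ a) !≢0

  choose≢0 : ∀ a b → NonZero ((a + b) C a)
  choose≢0 a b = ≢-nonZero λ C≡0 → ≢-nonZero⁻¹ ((a + b) !) {{(a + b) !≢0}} (trans (sym (choose-factorial a b)) (cong (_* (a ! * b !)) C≡0))

  choose-suc : ∀ a b → suc b * ((a + suc b) C a) ≡ suc (a + b) * ((a + b) C a)
  choose-suc a b = *-cancelʳ-≡ _ _ (a ! * b !) (begin
    suc b * ((a + suc b) C a) * (a ! * b !)       ≡⟨ eq (suc b) ((a + suc b) C a) (a !) (b !) ⟩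
    ((a + suc b) C a) * (a ! * suc b !)           ≡⟨ choose-factorial a (suc b) ⟩
    (a + suc b) !                                 ≡⟨ cong _! (+-suc a b) ⟩
    suc (a + b) * (a + b) !                       ≡⟨ cong (suc (a + b) *_) (sym (choose-factorial a b)) ⟩
    suc (a + b) * (((a + b) C a) * (a ! * b !))   ≡⟨ sym (*-assoc (suc (a + b)) ((a + b) C a) (a ! * b !)) ⟩
    suc (a + b) * ((a + b) C a) * (a ! * b !)     ∎)
    where
    open ≡-Reasoning
    instance _ = a !* b !≢0
    eq : ∀ x c m n → x * c * (m * n) ≡ c * (m * (x * n))
    eq = solve-∀

  choose-sym : ∀ a b → (a + b) C a ≡ (b + a) C b
  choose-sym a b = *-cancelʳ-≡ _ _ (a ! * b !) (begin
    ((a + b) C a) * (a ! * b !) ≡⟨ choose-factorial a b ⟩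
    (a + b) !                   ≡⟨ cong _! (+-comm a b) ⟩
    (b + a) !                   ≡⟨ sym (choose-factorial b a) ⟩
    ((b + a) C b) * (b ! * a !) ≡⟨ cong (((b + a) C b) *_) (*-comm (b !) (a !)) ⟩
    ((b + a) C b) * (a ! * b !) ∎)
    where
    open ≡-Reasoning
    instance _ = a !* b !≢0

  choose-shift : ∀ a b → suc a * ((a + suc b) C suc a) ≡ suc b * ((a + suc b) C a)
  choose-shift a b = begin
    suc a * ((a + suc b) C suc a) ≡⟨ cong (λ n → suc a * (n C suc a)) (+-suc a b) ⟩
    suc a * ((suc a + b) C suc a) ≡⟨ cong (suc a *_) (choose-sym (suc a) b) ⟩
    suc a * ((b + suc a) C b)     ≡⟨ choose-suc b a ⟩
    suc (b + a) * ((b + a) C b)   ≡⟨ cong₂ (λ n c → suc n * c) (+-comm b a) (choose-sym b a) ⟩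
    suc (a + b) * ((a + b) C a)   ≡⟨ sym (choose-suc a b) ⟩
    suc b * ((a + suc b) C a)     ∎
    where open ≡-Reasoning

  ^-distribʳ-* : ∀ n x y → (x * y) ^ n ≡ x ^ n * y ^ n
  ^-distribʳ-* zero    x y = refl
  ^-distribʳ-* (suc n) x y = trans (cong (x * y *_) (^-distribʳ-* n x y)) (eq x y (x ^ n) (y ^ n))
    where
    eq : ∀ x y a b → x * y * (a * b) ≡ x * a * (y * b)
    eq = solve-∀

  centralBinomial : ℕ → ℕ
  centralBinomial n = (n + n) C n

  -- Divided by 4^(n+1) and doubled, this is the recurrence `rec` of the staircase.
  centralBinomial-suc : ∀ n → suc n * centralBinomial (suc n) ≡ 2 * (2 * n + 1) * centralBinomial n
  centralBinomial-suc n = *-cancelˡ-≡ _ _ (suc n) (begin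
    suc n * (suc n * ((suc n + suc n) C suc n))       ≡⟨ cong (suc n *_) (choose-suc (suc n) n) ⟩
    suc n * (suc (suc n + n) * ((suc n + n) C suc n)) ≡⟨ cong (λ c → suc n * (suc (suc n + n) * c)) (choose-sym (suc n) n) ⟩
    suc n * (suc (suc n + n) * ((n + suc n) C n))     ≡⟨ eq₁ n _ ⟩
    2 * suc n * (suc n * ((n + suc n) C n))           ≡⟨ cong (2 * suc n *_) (choose-suc n n) ⟩
    2 * suc n * (suc (n + n) * ((n + n) C n))         ≡⟨ eq₂ n _ ⟩
    suc n * (2 * (2 * n + 1) * ((n + n) C n))         ∎)
    where
    open ≡-Reasoning
    eq₁ : ∀ n c → suc n * (suc (suc n + n) * c) ≡ 2 * suc n * (suc n * c)
    eq₁ = solve-∀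
    eq₂ : ∀ n c → 2 * suc n * (suc (n + n) * c) ≡ suc n * (2 * (2 * n + 1) * c)
    eq₂ = solve-∀

  -- If x ≥ y + 1, the hypothesis gives n(y + 1) ≤ (n + 1)y, so n ≤ y, and n = n₀ + y + 1 refutes
  -- this. It removes the factor (n + 1)/n that the staircase leaves over.
  ≤-from-all-large : ∀ x y n₀ → (∀ n → n₀ ≤ n → n * x ≤ suc n * y) → x ≤ y
  ≤-from-all-large x y n₀ h with x ≤? y
  ... | yes x≤y = x≤y
  ... | no  x≰y = contradiction (+-cancelˡ-≤ (n * y) (suc y) y (begin
      n * y + suc y     ≤⟨ +-monoʳ-≤ (n * y) (m≤n+m (suc y) n₀) ⟩
      n * y + n         ≡⟨ trans (+-comm (n * y) n) (sym (*-suc n y)) ⟩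
      n * suc y         ≤⟨ *-monoʳ-≤ n (≰⇒> x≰y) ⟩
      n * x             ≤⟨ h n (m≤m+n n₀ (suc y)) ⟩
      suc n * y         ≡⟨ +-comm y (n * y) ⟩
      n * y + y         ∎)) (<⇒≱ (n<1+n y))
    where
    open ≤-Reasoning
    n = n₀ + suc y

  -- 16ᴺ / (N C(2N,N)²) decreases to π, so it bounds the area of every polygon of cells inside the disc.
  wallis : ∀ k N → 4 * N * centralBinomial N ^ 2 * quarterDiscCells k ≤ k ^ 2 * 16 ^ N
  wallis k N = ≤-from-all-large _ _ N (λ n N≤n → *-cancelˡ-≤ (scale n) {{scale≢0 n}} (begin
    scale n * (n * (4 * N * centralBinomial N ^ 2 * quarterDiscCells k))
      ≡⟨ eq₁ (4 ^ (suc n ∸ N)) n N (centralBinomial N) (quarterDiscCells k) ⟩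
    4 * n * (N * A n N ^ 2) * quarterDiscCells k
      ≤⟨ *-monoˡ-≤ (quarterDiscCells k) (*-monoʳ-≤ (4 * n)
           (Staircase.lower-increasing (A n) (suc n) (recurrence n) N≤n (n≤1+n n))) ⟩
    4 * n * (n * A n n ^ 2) * quarterDiscCells k
      ≡⟨ eq₂ n (A n n) (quarterDiscCells k) ⟩
    -- Refining by 2n · A n n makes the radius of the grid exactly the radius S n of the staircase
    -- built from k · A, so no rounding occurs.
    2 * n * A n n * (2 * n * A n n) * quarterDiscCells k
      ≤⟨ refine k (2 * n * A n n) ⟩
    quarterDiscCells (k * (2 * n * A n n))
      ≡⟨ cong quarterDiscCells (trans (eq₃ k n (A n n)) (sym (S≡2iA n n (n≤1+n n)))) ⟩
    quarterDiscCells (S n n)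
      ≤⟨ cells≤ n n ≤-refl ⟩
    suc n * (k * A n 0 * (k * A n 0))
      ≡⟨ cong (λ x → suc n * (k * x * (k * x))) (trans (*-identityˡ _)
           (trans (cong (4 ^_) (sym (m+[n∸m]≡n (m≤n⇒m≤1+n N≤n)))) (^-distribˡ-+-* 4 N _))) ⟩
    suc n * (k * (4 ^ N * 4 ^ (suc n ∸ N)) * (k * (4 ^ N * 4 ^ (suc n ∸ N))))
      ≡⟨ eq₄ n k (4 ^ N) (4 ^ (suc n ∸ N)) ⟩
    scale n * (suc n * (k ^ 2 * (4 ^ N * 4 ^ N)))
      ≡⟨ cong (λ x → scale n * (suc n * (k ^ 2 * x))) (sym (^-distribʳ-* N 4 4)) ⟩
    scale n * (suc n * (k ^ 2 * 16 ^ N)) ∎))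
    where
    open ≤-Reasoning
    -- The square of the power of 4 carried by `A n N`; it also divides the square of `A n 0`.
    scale : ℕ → ℕ
    scale n = (4 ^ (suc n ∸ N)) ^ 2
    scale≢0 : ∀ n → NonZero (scale n)
    scale≢0 n = m^n≢0 (4 ^ (suc n ∸ N)) 2 {{m^n≢0 4 (suc n ∸ N)}}
    A : ℕ → ℕ → ℕ
    -- This is 4^(n+1) times C(2i,i)/4ⁱ, which clears the denominators up to i = n + 1.
    A n i = centralBinomial i * 4 ^ (suc n ∸ i)
    recurrence : ∀ n i → i < suc n → (2 * i + 2) * A n (suc i) ≡ (2 * i + 1) * A n i
    recurrence n i i≤n = begin-equality
      (2 * i + 2) * (centralBinomial (suc i) * 4 ^ (n ∸ i))       ≡⟨ e₁ i (centralBinomial (suc i)) (4 ^ (n ∸ i)) ⟩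
      2 * (suc i * centralBinomial (suc i)) * 4 ^ (n ∸ i)
        ≡⟨ cong (λ x → 2 * x * 4 ^ (n ∸ i)) (centralBinomial-suc i) ⟩
      2 * (2 * (2 * i + 1) * centralBinomial i) * 4 ^ (n ∸ i)     ≡⟨ e₂ i _ _ ⟩
      (2 * i + 1) * (centralBinomial i * 4 ^ suc (n ∸ i))
        ≡⟨ cong (λ m → (2 * i + 1) * (centralBinomial i * 4 ^ m)) (sym (+-∸-assoc 1 (≤-pred i≤n))) ⟩
      (2 * i + 1) * A n i ∎
      where
      e₁ : ∀ i c x → (2 * i + 2) * (c * x) ≡ 2 * (suc i * c) * x
      e₁ = solve-∀
      e₂ : ∀ i c x → 2 * (2 * (2 * i + 1) * c) * x ≡ (2 * i + 1) * (c * (4 * x))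
      e₂ = solve-∀
    recurrenceᵏ : ∀ n i → i < suc n → (2 * i + 2) * (k * A n (suc i)) ≡ (2 * i + 1) * (k * A n i)
    recurrenceᵏ n i i≤n = trans (eq (2 * i + 2) k _) (trans (cong (k *_) (recurrence n i i≤n)) (sym (eq (2 * i + 1) k _)))
      where
      eq : ∀ x y z → x * (y * z) ≡ y * (x * z)
      eq = solve-∀
    open module Scaled n = Staircase (λ i → k * A n i) (suc n) (recurrenceᵏ n) using (S; S≡2iA; cells≤)
    eq₁ : ∀ x n N c d → (x * (x * 1)) * (n * (4 * N * (c * (c * 1)) * d)) ≡ 4 * n * (N * ((c * x) * ((c * x) * 1))) * d
    eq₁ = solve-∀
    eq₂ : ∀ n a d → 4 * n * (n * (a * (a * 1))) * d ≡ 2 * n * a * (2 * n * a) * d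
    eq₂ = solve-∀
    eq₃ : ∀ k n a → k * (2 * n * a) ≡ 2 * n * (k * a)
    eq₃ = solve-∀
    eq₄ : ∀ n k x y → suc n * (k * (x * y) * (k * (x * y))) ≡ (y * (y * 1)) * (suc n * ((k * (k * 1)) * (x * x)))
    eq₄ = solve-∀

-- Stirling's formula as monotonicity of cross-multiplied ratios.

module Stirling where
  open import Data.Nat.Base
  open import Data.Nat.Properties
  open import Data.Nat.Combinatorics using (_C_)
  open import Data.Nat.Tactic.RingSolver using (solve-∀)
  open import Data.Sum.Base using (inj₁; inj₂)
  open import Relation.Binary.PropositionalEquality
  open Wallis

  -- Monotonicity of the fraction P / Q without division; extending the chain by one step cancels Q
  -- j.
  ratio-mono : (P Q : ℕ → ℕ) → (∀ i → NonZero (Q i)) → (∀ i → P i * Q (suc i) ≤ P (suc i) * Q i) →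
               ∀ {i j} → i ≤ j → P i * Q j ≤ P j * Q i
  ratio-mono P Q Q≢0 step {i} {zero}  z≤n = ≤-refl
  ratio-mono P Q Q≢0 step {i} {suc j} i≤j with m≤n⇒m<n∨m≡n i≤j
  ... | inj₂ refl = ≤-refl
  ... | inj₁ i<j  = *-cancelˡ-≤ (Q j) {{Q≢0 j}} (begin
    Q j * (P i * Q (suc j))   ≡⟨ eq (Q j) (P i) _ ⟩
    P i * Q j * Q (suc j)     ≤⟨ *-monoˡ-≤ (Q (suc j)) (ratio-mono P Q Q≢0 step (≤-pred i<j)) ⟩
    P j * Q i * Q (suc j)     ≡⟨ eq₂ (P j) (Q i) _ ⟩
    Q i * (P j * Q (suc j))   ≤⟨ *-monoʳ-≤ (Q i) (step j) ⟩
    Q i * (P (suc j) * Q j)   ≡⟨ eq₃ (Q i) (P (suc j)) (Q j) ⟩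
    Q j * (P (suc j) * Q i)   ∎)
    where
    open ≤-Reasoning
    eq : ∀ x y z → x * (y * z) ≡ y * x * z
    eq = solve-∀
    eq₂ : ∀ x y z → x * y * z ≡ y * (x * z)
    eq₂ = solve-∀
    eq₃ : ∀ x y z → x * (y * z) ≡ z * (y * x)
    eq₃ = solve-∀

  -- (1 + 1/h)^(m+2) is at least the sum of the first four terms of its binomial expansion.
  bernoulli₃ : ∀ h m → h ^ (2 + m) * (6 * h * h * h + 6 * (2 + m) * h * h + 3 * (2 + m) * (1 + m) * h + (2 + m) * (1 + m) * m)
               ≤ 6 * h * h * h * (1 + h) ^ (2 + m)
  bernoulli₃ h zero = ≤-reflexive (eq h)
    where
    eq : ∀ h → h * (h * 1) * (6 * h * h * h + 6 * 2 * h * h + 3 * 2 * 1 * h + 0) ≡ 6 * h * h * h * ((1 + h) * ((1 + h) * 1))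
    eq = solve-∀
  bernoulli₃ h (suc m) = begin
    h * h ^ (2 + m) * (6 * h * h * h + 6 * (3 + m) * h * h + 3 * (3 + m) * (2 + m) * h + (3 + m) * (2 + m) * (1 + m))
      ≤⟨ m≤m+n _ _ ⟩
    h * h ^ (2 + m) * (6 * h * h * h + 6 * (3 + m) * h * h + 3 * (3 + m) * (2 + m) * h + (3 + m) * (2 + m) * (1 + m))
      + h ^ (2 + m) * ((2 + m) * (1 + m) * m)
      ≡⟨ eq h m (h ^ (2 + m)) ⟩
    h ^ (2 + m) * (6 * h * h * h + 6 * (2 + m) * h * h + 3 * (2 + m) * (1 + m) * h + (2 + m) * (1 + m) * m) * (1 + h)
      ≤⟨ *-monoˡ-≤ (1 + h) (bernoulli₃ h m) ⟩
    6 * h * h * h * (1 + h) ^ (2 + m) * (1 + h)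
      ≡⟨ trans (*-assoc (6 * h * h * h) _ _) (cong (6 * h * h * h *_) (*-comm ((1 + h) ^ (2 + m)) (1 + h))) ⟩
    6 * h * h * h * (1 + h) ^ (3 + m) ∎
    where
    open ≤-Reasoning
    eq : ∀ h m x → h * x * (6 * h * h * h + 6 * (3 + m) * h * h + 3 * (3 + m) * (2 + m) * h + (3 + m) * (2 + m) * (1 + m))
      + x * ((2 + m) * (1 + m) * m)
      ≡ x * (6 * h * h * h + 6 * (2 + m) * h * h + 3 * (2 + m) * (1 + m) * h + (2 + m) * (1 + m) * m) * (1 + h)
    eq = solve-∀

  -- x^(2j+1), written so that the ring solver meets only the atom x ^ j.
  odd-power : ℕ → ℕ → ℕ
  odd-power x j = x * (x ^ j * x ^ j)

  odd-power≢0 : ∀ x j → .{{NonZero x}} → NonZero (odd-power x j)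
  odd-power≢0 x j {{x≢0}} = m*n≢0 x _ {{x≢0}} {{m*n≢0 _ _ {{m^n≢0 x j}} {{m^n≢0 x j}}}}

  odd-power-* : ∀ x y j → odd-power (x * y) j ≡ odd-power x j * odd-power y j
  odd-power-* x y j rewrite ^-distribʳ-* j x y = eq x y (x ^ j) (y ^ j)
    where
    eq : ∀ x y a b → x * y * (a * b * (a * b)) ≡ x * (a * a) * (y * (b * b))
    eq = solve-∀

  odd-power-suc : ∀ x j → odd-power x (suc j) ≡ x * x * odd-power x j
  odd-power-suc x j = eq x (x ^ j)
    where
    eq : ∀ x a → x * (x * a * (x * a)) ≡ x * x * (x * (a * a))
    eq = solve-∀

  odd-power≡^ : ∀ x i → odd-power x (suc i) ≡ x ^ (3 + (i + i))
  odd-power≡^ x i rewrite ^-distribˡ-+-* x i i = eq x (x ^ i)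
    where
    eq : ∀ x a → x * (x * a * (x * a)) ≡ x * (x * (x * (a * a)))
    eq = solve-∀

  -- ((j+1)/j)^(2j+1) decreases to e².
  euler-step : ∀ j → odd-power j j * odd-power (2 + j) (suc j) ≤ odd-power (suc j) (suc j) * odd-power (suc j) j
  euler-step zero    = z≤n
  -- With h = j(j+2), so that h + 1 = (j+1)², the claim is (1 + 1/h)^(2j+1) ≥ ((j+2)/(j+1))². Four
  -- terms of the binomial expansion are taken because three fall short at order 1/j³.
  euler-step (suc i) = *-cancelˡ-≤ (6 * h * h * h) {{6h³≢0}} (begin
    6 * h * h * h * (odd-power j j * odd-power (2 + j) (suc j))
      ≡⟨ cong (λ x → 6 * h * h * h * (odd-power j j * x)) (odd-power-suc (2 + j) j) ⟩
    6 * h * h * h * (odd-power j j * ((2 + j) * (2 + j) * odd-power (2 + j) j))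
      ≡⟨ eq₁ (6 * h * h * h) (odd-power j j) ((2 + j) * (2 + j)) (odd-power (2 + j) j) ⟩
    (odd-power j j * odd-power (2 + j) j) * (6 * h * h * h * ((2 + j) * (2 + j)))
      ≤⟨ *-mono-≤ (≤-reflexive (trans (sym (odd-power-* j (2 + j) j)) (odd-power≡^ h i)))
                  (≤-trans (m≤m+n _ _) (≤-reflexive (eq₂ i))) ⟩
    h ^ (2 + m) * ((6 * h * h * h + 6 * (2 + m) * h * h + 3 * (2 + m) * (1 + m) * h + (2 + m) * (1 + m) * m) * (suc j * suc j))
      ≡⟨ sym (*-assoc (h ^ (2 + m)) _ _) ⟩
    h ^ (2 + m) * (6 * h * h * h + 6 * (2 + m) * h * h + 3 * (2 + m) * (1 + m) * h + (2 + m) * (1 + m) * m) * (suc j * suc j)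
      ≤⟨ *-monoˡ-≤ (suc j * suc j) (bernoulli₃ h m) ⟩
    6 * h * h * h * (1 + h) ^ (2 + m) * (suc j * suc j)
      ≡⟨ cong (λ x → 6 * h * h * h * x * (suc j * suc j))
           (trans (sym (odd-power≡^ (1 + h) i)) (trans (cong (λ x → odd-power x j) (eq₃ i)) (odd-power-* (suc j) (suc j) j))) ⟩
    6 * h * h * h * (odd-power (suc j) j * odd-power (suc j) j) * (suc j * suc j)
      ≡⟨ eq₄ (6 * h * h * h) (odd-power (suc j) j) (suc j * suc j) ⟩
    6 * h * h * h * (suc j * suc j * odd-power (suc j) j * odd-power (suc j) j)
      ≡⟨ cong (λ x → 6 * h * h * h * (x * odd-power (suc j) j)) (sym (odd-power-suc (suc j) j)) ⟩
    6 * h * h * h * (odd-power (suc j) (suc j) * odd-power (suc j) j) ∎)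
    where
    open ≤-Reasoning
    j = suc i
    h = j * (2 + j)
    m = suc (i + i)
    6h³≢0 : NonZero (6 * h * h * h)
    6h³≢0 = _
    eq₁ : ∀ c x y z → c * (x * (y * z)) ≡ (x * z) * (c * y)
    eq₁ = solve-∀
    -- In i = j - 1 the difference of the two sides has only nonnegative coefficients.
    eq₂ : ∀ i → 6 * (suc i * (2 + suc i)) * (suc i * (2 + suc i)) * (suc i * (2 + suc i)) * ((2 + suc i) * (2 + suc i)) + (78 + i * (220 + i * (220 + i * (96 + i * (20 + i * 2)))))
           ≡ (6 * (suc i * (2 + suc i)) * (suc i * (2 + suc i)) * (suc i * (2 + suc i)) + 6 * (2 + suc (i + i)) * (suc i * (2 + suc i)) * (suc i * (2 + suc i)) + 3 * (2 + suc (i + i)) * (1 + suc (i + i)) * (suc i * (2 + suc i)) + (2 + suc (i + i)) * (1 + suc (i + i)) * suc (i + i)) * ((2 + i) * (2 + i))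
    eq₂ = solve-∀
    eq₃ : ∀ i → 1 + suc i * (3 + i) ≡ (2 + i) * (2 + i)
    eq₃ = solve-∀
    eq₄ : ∀ c x y → c * (x * x) * y ≡ c * (y * x * x)
    eq₄ = solve-∀

  odd-power-ratio : ∀ {i j} → i ≤ j → odd-power i i * odd-power (suc j) j ≤ odd-power j j * odd-power (suc i) i
  odd-power-ratio = ratio-mono (λ j → odd-power j j) (λ j → odd-power (suc j) j) (λ j → odd-power≢0 (suc j) j) euler-step

  -- likelihood a b / odd-power (a + b) (a + b) is the square of the binomial probability
  -- of a successes in a + b trials with success probability a / (a + b), times ab / (a + b).
  likelihood : ℕ → ℕ → ℕ
  likelihood a b = ((a + b) C a) * ((a + b) C a) * (odd-power a a * odd-power b b)

  likelihood-sym : ∀ a b → likelihood a b ≡ likelihood b a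
  likelihood-sym a b rewrite choose-sym a b = cong (((b + a) C b) * ((b + a) C b) *_) (*-comm (odd-power a a) (odd-power b b))

  -- One more failure multiplies the ratio of `likelihood` to its odd power by e(b)/e(a+b), where
  -- e(j) = ((j+1)/j)^(2j+1) is decreasing.
  likelihood-step : ∀ a b → likelihood a b * odd-power (a + suc b) (a + suc b) ≤ likelihood a (suc b) * odd-power (a + b) (a + b)
  likelihood-step a b rewrite +-suc a b = begin
    c * c * (x * odd-power b b) * odd-power (suc (a + b)) (suc (a + b))
      ≡⟨ cong (c * c * (x * odd-power b b) *_) (odd-power-suc (suc (a + b)) (a + b)) ⟩
    c * c * (x * odd-power b b) * (suc (a + b) * suc (a + b) * odd-power (suc (a + b)) (a + b))
      ≡⟨ eq₁ (suc (a + b)) c x (odd-power b b) (odd-power (suc (a + b)) (a + b)) ⟩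
    (suc (a + b) * c) * (suc (a + b) * c) * x * (odd-power b b * odd-power (suc (a + b)) (a + b))
      ≤⟨ *-monoʳ-≤ ((suc (a + b) * c) * (suc (a + b) * c) * x) (odd-power-ratio (m≤n+m b a)) ⟩
    (suc (a + b) * c) * (suc (a + b) * c) * x * (odd-power (a + b) (a + b) * odd-power (suc b) b)
      ≡⟨ cong (λ y → y * y * x * (odd-power (a + b) (a + b) * odd-power (suc b) b)) (sym absorb) ⟩
    (suc b * c′) * (suc b * c′) * x * (odd-power (a + b) (a + b) * odd-power (suc b) b)
      ≡⟨ eq₂ (suc b) c′ x (odd-power (a + b) (a + b)) (odd-power (suc b) b) ⟩
    c′ * c′ * (x * (suc b * suc b * odd-power (suc b) b)) * odd-power (a + b) (a + b)
      ≡⟨ cong (λ y → c′ * c′ * (x * y) * odd-power (a + b) (a + b)) (sym (odd-power-suc (suc b) b)) ⟩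
    c′ * c′ * (x * odd-power (suc b) (suc b)) * odd-power (a + b) (a + b) ∎
    where
    open ≤-Reasoning
    c  = (a + b) C a
    c′ = suc (a + b) C a
    x  = odd-power a a
    absorb : suc b * c′ ≡ suc (a + b) * c
    absorb = subst (λ n → suc b * (n C a) ≡ suc (a + b) * c) (+-suc a b) (choose-suc a b)
    eq₁ : ∀ s c x y z → c * c * (x * y) * (s * s * z) ≡ (s * c) * (s * c) * x * (y * z)
    eq₁ = solve-∀
    eq₂ : ∀ s c x y z → (s * c) * (s * c) * x * (y * z) ≡ c * c * (x * (s * s * z)) * y
    eq₂ = solve-∀

  likelihood-mono : ∀ a .{{_ : NonZero a}} {b n} → b ≤ n →
                    likelihood a b * odd-power (a + n) (a + n) ≤ likelihood a n * odd-power (a + b) (a + b)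
  likelihood-mono (suc a) = ratio-mono (likelihood (suc a)) (λ b → odd-power (suc a + b) (suc a + b))
    (λ b → odd-power≢0 (suc a + b) (suc a + b)) (likelihood-step (suc a))

  -- For a = b = n the success probability is 1/2, the squared probability is C(2n,n)²/16ⁿ, and
  -- ab/(a+b) = n/2.
  likelihood-diagonal : ∀ n → 2 * likelihood n n * 16 ^ n ≡ n * (centralBinomial n * centralBinomial n) * odd-power (n + n) (n + n)
  likelihood-diagonal n = begin
    2 * (c * c * (n * (x * x) * (n * (x * x)))) * 16 ^ n
      ≡⟨ cong (2 * (c * c * (n * (x * x) * (n * (x * x)))) *_)
           (trans (^-distribʳ-* n 4 4) (cong (λ y → y * y) (^-distribʳ-* n 2 2))) ⟩
    2 * (c * c * (n * (x * x) * (n * (x * x)))) * (2 ^ n * 2 ^ n * (2 ^ n * 2 ^ n))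
      ≡⟨ eq n c x (2 ^ n) ⟩
    n * (c * c) * ((n + n) * ((2 ^ n * x) * (2 ^ n * x) * ((2 ^ n * x) * (2 ^ n * x))))
      ≡⟨ cong (λ y → n * (c * c) * ((n + n) * (y * y * (y * y)))) (sym (^-distribʳ-* n 2 n)) ⟩
    n * (c * c) * ((n + n) * ((2 * n) ^ n * (2 * n) ^ n * ((2 * n) ^ n * (2 * n) ^ n)))
      ≡⟨ cong (λ y → n * (c * c) * ((n + n) * (y * y))) (sym (^-distribˡ-+-* (2 * n) n n)) ⟩
    n * (c * c) * ((n + n) * ((2 * n) ^ (n + n) * (2 * n) ^ (n + n)))
      ≡⟨ cong (λ y → n * (c * c) * ((n + n) * (y ^ (n + n) * y ^ (n + n)))) (cong (n +_) (+-identityʳ n)) ⟩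
    n * (c * c) * odd-power (n + n) (n + n) ∎
    where
    open ≡-Reasoning
    c = centralBinomial n
    x = n ^ n
    eq : ∀ n c x t → 2 * (c * c * (n * (x * x) * (n * (x * x)))) * (t * t * (t * t))
         ≡ n * (c * c) * ((n + n) * ((t * x) * (t * x) * ((t * x) * (t * x))))
    eq = solve-∀

  -- The ratio grows in each argument, hence along (a, b), (a, n), (n, n); n = a + b dominates both
  -- arguments.
  likelihood≤diagonal : ∀ a b .{{_ : NonZero a}} → let n = a + b in
                        likelihood a b * odd-power (n + n) (n + n) ≤ likelihood n n * odd-power n n
  likelihood≤diagonal a@(suc _) b = *-cancelˡ-≤ (odd-power (a + n) (a + n)) {{odd-power≢0 (a + n) (a + n)}} (begin
    odd-power (a + n) (a + n) * (likelihood a b * odd-power (n + n) (n + n))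
      ≡⟨ eq₁ (odd-power (a + n) (a + n)) (likelihood a b) _ ⟩
    likelihood a b * odd-power (a + n) (a + n) * odd-power (n + n) (n + n)
      ≤⟨ *-monoˡ-≤ _ (likelihood-mono a (m≤n+m b a)) ⟩
    likelihood a n * odd-power n n * odd-power (n + n) (n + n)
      ≡⟨ cong (λ x → x * odd-power n n * odd-power (n + n) (n + n)) (likelihood-sym a n) ⟩
    likelihood n a * odd-power n n * odd-power (n + n) (n + n)
      ≡⟨ eq₂ (likelihood n a) (odd-power n n) _ ⟩
    odd-power n n * (likelihood n a * odd-power (n + n) (n + n))
      ≤⟨ *-monoʳ-≤ (odd-power n n) (likelihood-mono n (m≤m+n a b)) ⟩
    odd-power n n * (likelihood n n * odd-power (n + a) (n + a))
      ≡⟨ cong (λ x → odd-power n n * (likelihood n n * odd-power x x)) (+-comm n a) ⟩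
    odd-power n n * (likelihood n n * odd-power (a + n) (a + n))
      ≡⟨ eq₃ (odd-power n n) (likelihood n n) _ ⟩
    odd-power (a + n) (a + n) * (likelihood n n * odd-power n n) ∎)
    where
    open ≤-Reasoning
    n = a + b
    eq₁ : ∀ x y z → x * (y * z) ≡ y * x * z
    eq₁ = solve-∀
    eq₂ : ∀ x y z → x * y * z ≡ y * (x * z)
    eq₂ = solve-∀
    eq₃ : ∀ x y z → x * (y * z) ≡ z * (y * x)
    eq₃ = solve-∀

  -- Wallis's bound is carried from the diagonal down to (a, b). The ratio is at most 1/(2π), with π
  -- replaced by 4 · cells / k².
  likelihood-bound : ∀ k a b .{{_ : NonZero a}} →
                     4 * quarterDiscCells k * (2 * likelihood a b) ≤ k ^ 2 * odd-power (a + b) (a + b)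
  likelihood-bound k a@(suc _) b = *-cancelʳ-≤ _ _ (16 ^ n * o₂)
    {{m*n≢0 (16 ^ n) o₂ {{m^n≢0 16 n}} {{odd-power≢0 (n + n) (n + n)}}}} (begin
    4 * q * (2 * likelihood a b) * (16 ^ n * o₂)
      ≡⟨ eq₁ q (likelihood a b) (16 ^ n) o₂ ⟩
    8 * q * 16 ^ n * (likelihood a b * o₂)
      ≤⟨ *-monoʳ-≤ (8 * q * 16 ^ n) (likelihood≤diagonal a b) ⟩
    8 * q * 16 ^ n * (likelihood n n * o)
      ≡⟨ eq₂ q (16 ^ n) (likelihood n n) o ⟩
    4 * q * o * (2 * likelihood n n * 16 ^ n)
      ≡⟨ cong (4 * q * o *_) (likelihood-diagonal n) ⟩
    4 * q * o * (n * (centralBinomial n * centralBinomial n) * o₂)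
      ≡⟨ eq₃ q o n (centralBinomial n) o₂ ⟩
    4 * n * centralBinomial n ^ 2 * q * (o * o₂)
      ≤⟨ *-monoˡ-≤ (o * o₂) (wallis k n) ⟩
    k ^ 2 * 16 ^ n * (o * o₂)
      ≡⟨ eq₄ (k ^ 2) (16 ^ n) o o₂ ⟩
    k ^ 2 * o * (16 ^ n * o₂) ∎)
    where
    open ≤-Reasoning
    n = a + b
    q = quarterDiscCells k
    o = odd-power n n
    o₂ = odd-power (n + n) (n + n)
    eq₁ : ∀ q l s o → 4 * q * (2 * l) * (s * o) ≡ 8 * q * s * (l * o)
    eq₁ = solve-∀
    eq₂ : ∀ q s l o → 8 * q * s * (l * o) ≡ 4 * q * o * (2 * l * s)
    eq₂ = solve-∀
    eq₃ : ∀ q o n c p → 4 * q * o * (n * (c * c) * p) ≡ 4 * n * (c * (c * 1)) * q * (o * p)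
    eq₃ = solve-∀
    eq₄ : ∀ k s o p → k * s * (o * p) ≡ k * o * (s * p)
    eq₄ = solve-∀

-- Ordered-field arithmetic and a ring solver with integer coefficients.

module Field (ℝ : CompleteOrderedField) where
  open CompleteOrderedField ℝ
  open import Algebra.Bundles using (CommutativeRing)
  open import Data.Integer.Base as ℤ using (ℤ; +_; -[1+_]; _⊖_)
  import Data.Integer.Properties as ℤ
  open import Data.Maybe.Base using (Maybe; just; nothing)
  open import Data.Nat.Base as ℕ using (ℕ; zero; suc; z≤n; s≤s; NonZero)
  import Data.Nat.Properties as ℕ
  open import Data.Product.Base using (_,_; proj₁)
  open import Data.Sum.Base using (inj₁; inj₂)
  open import Function.Base using (_∘_)
  open import Relation.Nullary using (¬_; yes; no; contradiction)
  open import Relation.Binary.PropositionalEquality.Core as ≡ using (_≡_)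
  open import Relation.Binary.Bundles using (Poset)
  open import Relation.Binary.Structures using (IsDecTotalOrder)
  open import Algebra.Properties.Ring ring
  open import Algebra.Properties.AbelianGroup +-abelianGroup using (⁻¹-∙-comm)
  open import Algebra.Properties.CommutativeSemiring.Exp commutativeSemiring using (^-congˡ; ^-homo-*; ^-distrib-*) public
  open import Algebra.Properties.Semiring.Mult semiring using (×-homo-+; ×1-homo-*)
  open import Algebra.Solver.Ring.AlmostCommutativeRing using (fromCommutativeRing; _-Raw-AlmostCommutative⟶_)
  import Algebra.Solver.Ring

  module ≤ = IsDecTotalOrder isDecTotalOrder

  poset : Poset _ _ _
  poset = record { isPartialOrder = ≤.isPartialOrder }

  open import Relation.Binary.Reasoning.PartialOrder poset public
  open import Relation.Binary.Construct.NonStrictToStrict _≈_ _≤_ as Strict using ()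

  fromℕ-+ : ∀ m n → fromℕ (m ℕ.+ n) ≈ fromℕ m + fromℕ n
  fromℕ-+ = ×-homo-+ 1#

  fromℕ-* : ∀ m n → fromℕ (m ℕ.* n) ≈ fromℕ m * fromℕ n
  fromℕ-* = ×1-homo-*

  fromℕ-^ : ∀ m k → fromℕ (m ℕ.^ k) ≈ fromℕ m ^ k
  fromℕ-^ m zero    = +-identityʳ 1#
  fromℕ-^ m (suc k) = trans (fromℕ-* m (m ℕ.^ k)) (*-congˡ (fromℕ-^ m k))

  fromℕ-cong : ∀ {m n} → m ≡ n → fromℕ m ≈ fromℕ n
  fromℕ-cong ≡.refl = refl

  -- 0 and 1 are interpreted by 0# and 1# themselves, so that these can occur in solved goals.
  fromℤ : ℤ → Carrier
  fromℤ (+ 0)           = 0#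
  fromℤ (+ 1)           = 1#
  fromℤ (+ suc (suc n)) = fromℕ (suc (suc n))
  fromℤ -[1+ n ]        = - fromℕ (suc n)

  fromℤ-+ₙ : ∀ n → fromℤ (+ n) ≈ fromℕ n
  fromℤ-+ₙ 0             = refl
  fromℤ-+ₙ 1             = sym (+-identityʳ 1#)
  fromℤ-+ₙ (suc (suc n)) = refl

  fromℤ-neg : ∀ i → fromℤ (ℤ.- i) ≈ - fromℤ i
  fromℤ-neg (+ zero)  = sym -0#≈0#
  fromℤ-neg (+ suc n) = -‿cong (sym (fromℤ-+ₙ (suc n)))
  fromℤ-neg -[1+ n ]  = trans (fromℤ-+ₙ (suc n)) (sym (-‿involutive _))

  fromℤ-⊖ : ∀ m n → fromℤ (m ⊖ n) ≈ fromℕ m - fromℕ n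
  fromℤ-⊖ m zero = trans (fromℤ-+ₙ m) (sym (trans (+-congˡ -0#≈0#) (+-identityʳ _)))
  fromℤ-⊖ zero (suc n) = sym (+-identityˡ _)
  fromℤ-⊖ (suc m) (suc n) rewrite ℤ.[1+m]⊖[1+n]≡m⊖n m n = begin-equality
    fromℤ (m ⊖ n)                             ≈⟨ fromℤ-⊖ m n ⟩
    fromℕ m - fromℕ n                         ≈⟨ +-identityˡ _ ⟨
    0# + (fromℕ m - fromℕ n)                  ≈⟨ +-congʳ (-‿inverseʳ 1#) ⟨
    (1# - 1#) + (fromℕ m - fromℕ n)           ≈⟨ +-assoc _ _ _ ⟩
    1# + (- 1# + (fromℕ m - fromℕ n))         ≈⟨ +-congˡ (trans (sym (+-assoc _ _ _)) (trans (+-congʳ (+-comm _ _)) (+-assoc _ _ _))) ⟩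
    1# + (fromℕ m + (- 1# - fromℕ n))         ≈⟨ +-assoc _ _ _ ⟨
    (1# + fromℕ m) + (- 1# - fromℕ n)         ≈⟨ +-congˡ (⁻¹-∙-comm 1# (fromℕ n)) ⟩
    fromℕ (suc m) - fromℕ (suc n)             ∎

  fromℤ-+ : ∀ i j → fromℤ (i ℤ.+ j) ≈ fromℤ i + fromℤ j
  fromℤ-+ (+ m) (+ n) = trans (fromℤ-+ₙ (m ℕ.+ n)) (trans (fromℕ-+ m n) (sym (+-cong (fromℤ-+ₙ m) (fromℤ-+ₙ n))))
  fromℤ-+ (+ m) -[1+ n ] = trans (fromℤ-⊖ m (suc n)) (+-congʳ (sym (fromℤ-+ₙ m)))
  fromℤ-+ -[1+ m ] (+ n) = trans (fromℤ-⊖ n (suc m)) (trans (+-comm _ _) (+-congˡ (sym (fromℤ-+ₙ n))))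
  fromℤ-+ -[1+ m ] -[1+ n ] = trans (-‿cong (trans (fromℕ-cong (≡.cong suc (≡.sym (ℕ.+-suc m n)))) (fromℕ-+ (suc m) (suc n))))
    (sym (⁻¹-∙-comm _ _))

  fromℤ-*ₙ : ∀ m n → fromℤ (+ m ℤ.* + n) ≈ fromℤ (+ m) * fromℤ (+ n)
  fromℤ-*ₙ m n rewrite ≡.sym (ℤ.pos-* m n) =
    trans (fromℤ-+ₙ (m ℕ.* n)) (trans (fromℕ-* m n) (sym (*-cong (fromℤ-+ₙ m) (fromℤ-+ₙ n))))

  -- Together with its mirror image this reduces the sign cases of `fromℤ-*` to products of
  -- naturals.
  fromℤ-*-negˡ : ∀ i j → fromℤ (i ℤ.* j) ≈ fromℤ i * fromℤ j → fromℤ (ℤ.- i ℤ.* j) ≈ fromℤ (ℤ.- i) * fromℤ j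
  fromℤ-*-negˡ i j eq rewrite ≡.sym (ℤ.neg-distribˡ-* i j) =
    trans (fromℤ-neg (i ℤ.* j)) (trans (-‿cong eq) (trans (-‿distribˡ-* _ _) (*-congʳ (sym (fromℤ-neg i)))))

  fromℤ-*-negʳ : ∀ i j → fromℤ (i ℤ.* j) ≈ fromℤ i * fromℤ j → fromℤ (i ℤ.* ℤ.- j) ≈ fromℤ i * fromℤ (ℤ.- j)
  fromℤ-*-negʳ i j eq rewrite ≡.sym (ℤ.neg-distribʳ-* i j) =
    trans (fromℤ-neg (i ℤ.* j)) (trans (-‿cong eq) (trans (-‿distribʳ-* _ _) (*-congˡ (sym (fromℤ-neg j)))))

  fromℤ-* : ∀ i j → fromℤ (i ℤ.* j) ≈ fromℤ i * fromℤ j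
  fromℤ-* (+ m)    (+ n)    = fromℤ-*ₙ m n
  fromℤ-* (+ m)    -[1+ n ] = fromℤ-*-negʳ (+ m) (+ suc n) (fromℤ-*ₙ m (suc n))
  fromℤ-* -[1+ m ] (+ n)    = fromℤ-*-negˡ (+ suc m) (+ n) (fromℤ-*ₙ (suc m) n)
  fromℤ-* -[1+ m ] -[1+ n ] = fromℤ-*-negˡ (+ suc m) -[1+ n ] (fromℤ-*-negʳ (+ suc m) (+ suc n) (fromℤ-*ₙ (suc m) (suc n)))

  ℤ⟶ℝ : CommutativeRing.rawRing ℤ.+-*-commutativeRing -Raw-AlmostCommutative⟶ fromCommutativeRing commutativeRing
  ℤ⟶ℝ = record
    { ⟦_⟧    = fromℤ
    ; +-homo = fromℤ-+
    ; *-homo = fromℤ-*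
    ; -‿homo = fromℤ-neg
    ; 0-homo = refl
    ; 1-homo = refl
    }

  fromℤ-≟ : ∀ i j → Maybe (fromℤ i ≈ fromℤ j)
  fromℤ-≟ i j with i ℤ.≟ j
  ... | yes ≡.refl = just refl
  ... | no  _      = nothing

  open Algebra.Solver.Ring (CommutativeRing.rawRing ℤ.+-*-commutativeRing)
    (fromCommutativeRing commutativeRing) ℤ⟶ℝ fromℤ-≟ public using (solve; _:=_; _:+_; _:*_; _:-_; :-_; con)

  -- The form in which polynomial inequalities are proved: the difference d is an explicit
  -- nonnegative certificate, and the identity is usually left to the ring solver.
  ≤-by : ∀ {x y} d → 0# ≤ d → y ≈ x + d → x ≤ y
  ≤-by {x} {y} d 0≤d y≈x+d = begin
    x       ≈⟨ +-identityˡ x ⟨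
    0# + x  ≤⟨ +-monoˡ-≤ x 0≤d ⟩
    d + x   ≈⟨ +-comm d x ⟩
    x + d   ≈⟨ y≈x+d ⟨
    y       ∎

  ≤⇒0≤- : ∀ {x y} → x ≤ y → 0# ≤ y - x
  ≤⇒0≤- {x} {y} x≤y = begin
    0#    ≈⟨ -‿inverseʳ x ⟨
    x - x ≤⟨ +-monoˡ-≤ (- x) x≤y ⟩
    y - x ∎

  <⇒0<- : ∀ {x y} → x < y → 0# < y - x
  <⇒0<- {x} {y} (x≤y , x≉y) = ≤⇒0≤- x≤y , λ 0≈y-x → x≉y (begin-equality
    x           ≈⟨ +-identityˡ x ⟨
    0# + x      ≈⟨ +-congʳ 0≈y-x ⟩
    y - x + x   ≈⟨ solve 2 (λ x y → y :- x :+ x := y) refl x y ⟩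
    y           ∎)

  +-monoʳ-≤ : ∀ z {x y} → x ≤ y → z + x ≤ z + y
  +-monoʳ-≤ z {x} {y} x≤y = ≤.trans (≤.reflexive (+-comm z x)) (≤.trans (+-monoˡ-≤ z x≤y) (≤.reflexive (+-comm y z)))

  +-mono-≤ : ∀ {x y u v} → x ≤ y → u ≤ v → x + u ≤ y + v
  +-mono-≤ {y = y} {u = u} x≤y u≤v = ≤.trans (+-monoˡ-≤ u x≤y) (+-monoʳ-≤ y u≤v)

  +-nonNeg : ∀ {x y} → 0# ≤ x → 0# ≤ y → 0# ≤ x + y
  +-nonNeg 0≤x 0≤y = ≤.trans (≤.reflexive (sym (+-identityˡ 0#))) (+-mono-≤ 0≤x 0≤y)

  neg-mono-≤ : ∀ {x y} → x ≤ y → - y ≤ - x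
  neg-mono-≤ {x} {y} x≤y = ≤-by (y - x) (≤⇒0≤- x≤y) (solve 2 (λ x y → :- x := :- y :+ (y :- x)) refl x y)

  *-monoˡ-≤ : ∀ {z x y} → 0# ≤ z → x ≤ y → x * z ≤ y * z
  *-monoˡ-≤ {z} {x} {y} 0≤z x≤y = ≤-by ((y - x) * z) (*-nonNeg (≤⇒0≤- x≤y) 0≤z)
    (solve 3 (λ x y z → y :* z := x :* z :+ (y :- x) :* z) refl x y z)

  *-monoʳ-≤ : ∀ {z x y} → 0# ≤ z → x ≤ y → z * x ≤ z * y
  *-monoʳ-≤ {z} {x} {y} 0≤z x≤y = ≤.trans (≤.reflexive (*-comm z x)) (≤.trans (*-monoˡ-≤ 0≤z x≤y) (≤.reflexive (*-comm y z)))

  *-mono-≤ : ∀ {x y u v} → 0# ≤ x → 0# ≤ v → x ≤ y → u ≤ v → x * u ≤ y * v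
  *-mono-≤ 0≤x 0≤v x≤y u≤v = ≤.trans (*-monoʳ-≤ 0≤x u≤v) (*-monoˡ-≤ 0≤v x≤y)

  <⇒≤ : ∀ {x y} → x < y → x ≤ y
  <⇒≤ = proj₁

  <⇒≱ : ∀ {x y} → x < y → ¬ y ≤ x
  <⇒≱ (x≤y , x≉y) y≤x = x≉y (≤.antisym x≤y y≤x)

  ≰⇒> : ∀ {x y} → ¬ x ≤ y → y < x
  ≰⇒> {x} {y} x≰y with ≤.total x y
  ... | inj₁ x≤y = contradiction x≤y x≰y
  ... | inj₂ y≤x = y≤x , λ y≈x → x≰y (≤.reflexive (sym y≈x))

  ≰⇒≥ : ∀ {x y} → ¬ x ≤ y → y ≤ x
  ≰⇒≥ = <⇒≤ ∘ ≰⇒>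

  square-nonNeg : ∀ x → 0# ≤ x * x
  square-nonNeg x with ≤.total 0# x
  ... | inj₁ 0≤x = *-nonNeg 0≤x 0≤x
  ... | inj₂ x≤0 = ≤.trans (*-nonNeg 0≤-x 0≤-x) (≤.reflexive (solve 1 (λ x → :- x :* :- x := x :* x) refl x))
    where
    0≤-x : 0# ≤ - x
    0≤-x = ≤.trans (≤.reflexive (sym -0#≈0#)) (neg-mono-≤ x≤0)

  0≤1 : 0# ≤ 1#
  0≤1 = ≤.trans (square-nonNeg 1#) (≤.reflexive (*-identityʳ 1#))

  0<1 : 0# < 1#
  0<1 = 0≤1 , 0≉1

  fromℕ-nonNeg : ∀ n → 0# ≤ fromℕ n
  fromℕ-nonNeg zero    = ≤.refl
  fromℕ-nonNeg (suc n) = +-nonNeg 0≤1 (fromℕ-nonNeg n)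

  fromℕ-mono-≤ : ∀ {m n} → m ℕ.≤ n → fromℕ m ≤ fromℕ n
  fromℕ-mono-≤ {n = n} z≤n = fromℕ-nonNeg n
  fromℕ-mono-≤ (s≤s m≤n)   = +-monoʳ-≤ 1# (fromℕ-mono-≤ m≤n)

  fromℕ-pos : ∀ n .{{_ : NonZero n}} → 0# < fromℕ n
  fromℕ-pos n@(suc _) = begin-strict
    0#        <⟨ 0<1 ⟩
    1#        ≈⟨ +-identityʳ 1# ⟨
    fromℕ 1   ≤⟨ fromℕ-mono-≤ {1} {n} (s≤s z≤n) ⟩
    fromℕ n   ∎

  >⇒≉0 : ∀ {x} → 0# < x → x ≉ 0#
  >⇒≉0 (_ , 0≉x) x≈0 = 0≉x (sym x≈0)

  ⁻¹-nonNeg : ∀ {x} → 0# < x → 0# ≤ x ⁻¹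
  ⁻¹-nonNeg {x} 0<x with ≤.total 0# (x ⁻¹)
  ... | inj₁ 0≤x⁻¹ = 0≤x⁻¹
  ... | inj₂ x⁻¹≤0 = contradiction (begin
      1#        ≈⟨ ⁻¹-inverseʳ (>⇒≉0 0<x) ⟨
      x * x ⁻¹  ≤⟨ *-monoʳ-≤ (<⇒≤ 0<x) x⁻¹≤0 ⟩
      x * 0#    ≈⟨ zeroʳ x ⟩
      0#        ∎) (<⇒≱ 0<1)

  *-cancelˡ-≤ : ∀ {z x y} → 0# < z → z * x ≤ z * y → x ≤ y
  *-cancelˡ-≤ {z} {x} {y} 0<z zx≤zy = begin
    x                 ≈⟨ undo x ⟩
    z ⁻¹ * (z * x)    ≤⟨ *-monoʳ-≤ (⁻¹-nonNeg 0<z) zx≤zy ⟩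
    z ⁻¹ * (z * y)    ≈⟨ undo y ⟨
    y                 ∎
    where
    undo : ∀ w → w ≈ z ⁻¹ * (z * w)
    undo w = begin-equality
      w               ≈⟨ *-identityˡ w ⟨
      1# * w          ≈⟨ *-congʳ (⁻¹-inverseʳ (>⇒≉0 0<z)) ⟨
      z * z ⁻¹ * w    ≈⟨ solve 3 (λ z i w → z :* i :* w := i :* (z :* w)) refl z (z ⁻¹) w ⟩
      z ⁻¹ * (z * w)  ∎

  *-cancelʳ-≤ : ∀ {z x y} → 0# < z → x * z ≤ y * z → x ≤ y
  *-cancelʳ-≤ {z} {x} {y} 0<z xz≤yz = *-cancelˡ-≤ 0<z (≤.trans (≤.reflexive (*-comm z x)) (≤.trans xz≤yz (≤.reflexive (*-comm y z))))

  *-pos : ∀ {x y} → 0# < x → 0# < y → 0# < x * y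
  *-pos {x} {y} 0<x 0<y = *-nonNeg (<⇒≤ 0<x) (<⇒≤ 0<y) , λ 0≈xy →
    <⇒≱ 0<y (*-cancelˡ-≤ 0<x (≤.reflexive (trans (sym 0≈xy) (sym (zeroʳ x)))))

  square-cancel-≤ : ∀ {x y} → 0# ≤ y → x * x ≤ y * y → x ≤ y
  square-cancel-≤ {x} {y} 0≤y xx≤yy with x ≤? y
  ... | yes x≤y = x≤y
  ... | no  x≰y = *-cancelʳ-≤ (Strict.≤-<-trans ≤.trans ≤.antisym ≤.≤-respˡ-≈ 0≤y (≰⇒> x≰y)) (≤.trans xx≤yy (*-monoʳ-≤ 0≤y (≰⇒≥ x≰y)))

  square-mono-≤ : ∀ {x y} → 0# ≤ x → x ≤ y → x * x ≤ y * y
  square-mono-≤ 0≤x x≤y = *-mono-≤ 0≤x (≤.trans 0≤x x≤y) x≤y x≤y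

  /-*-cancel : ∀ {x y} → 0# < y → x / y * y ≈ x
  /-*-cancel {x} {y} 0<y = begin-equality
    x * y ⁻¹ * y    ≈⟨ solve 3 (λ x y i → x :* i :* y := x :* (y :* i)) refl x y (y ⁻¹) ⟩
    x * (y * y ⁻¹)  ≈⟨ *-congˡ (⁻¹-inverseʳ (>⇒≉0 0<y)) ⟩
    x * 1#          ≈⟨ *-identityʳ x ⟩
    x               ∎

  /-nonNeg : ∀ {x y} → 0# ≤ x → 0# < y → 0# ≤ x / y
  /-nonNeg 0≤x 0<y = *-nonNeg 0≤x (⁻¹-nonNeg 0<y)

  /-upper : ∀ {x y z} → 0# < y → x ≤ z * y → x / y ≤ z
  /-upper 0<y x≤zy = *-cancelʳ-≤ 0<y (≤.trans (≤.reflexive (/-*-cancel 0<y)) x≤zy)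

  /-lower : ∀ {x y z} → 0# < y → z * y ≤ x → z ≤ x / y
  /-lower 0<y zy≤x = *-cancelʳ-≤ 0<y (≤.trans zy≤x (≤.reflexive (sym (/-*-cancel 0<y))))

  ^-nonNeg : ∀ {x} n → 0# ≤ x → 0# ≤ x ^ n
  ^-nonNeg zero    0≤x = 0≤1
  ^-nonNeg (suc n) 0≤x = *-nonNeg 0≤x (^-nonNeg n 0≤x)

  ^-pos : ∀ {x} n → 0# < x → 0# < x ^ n
  ^-pos zero    0<x = 0<1
  ^-pos (suc n) 0<x = *-pos 0<x (^-pos n 0<x)

-- Square roots and bounds for π.

module Pi (ℝ : CompleteOrderedField) where
  open CompleteOrderedField ℝ
  open Reals ℝ
  open Field ℝ
  open Stirling
  open import Data.Integer.Base using (+_)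
  open import Data.Nat.Base as ℕ using (ℕ; zero; suc; NonZero)
  open import Data.Product.Base using (∃; _,_; proj₁; proj₂)
  open import Data.Sum.Base using (_⊎_; inj₁; inj₂)
  open import Relation.Nullary using (yes; no; contradiction)

  module _ {x} (0≤x : 0# ≤ x) where
    private
      s = √ x

      lub : LeastUpperBound (λ y → y ≤ 0# ⊎ y * y ≤ x) s
      -- The witness x + 1 bounds the set because (x + 1)² ≥ x.
      lub = sup-lub _ (0# , inj₁ ≤.refl) (x + 1# , λ where
        y (inj₁ y≤0)  → ≤.trans y≤0 (+-nonNeg 0≤x 0≤1)
        y (inj₂ yy≤x) → square-cancel-≤ (+-nonNeg 0≤x 0≤1) (≤.trans yy≤x
          (≤-by (x * x + x + 1#) (+-nonNeg (+-nonNeg (square-nonNeg x) 0≤x) 0≤1)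
            (solve 1 (λ x → (x :+ con (+ 1)) :* (x :+ con (+ 1)) := x :+ (x :* x :+ x :+ con (+ 1))) refl x))))

    √-nonNeg : 0# ≤ s
    √-nonNeg = proj₁ lub 0# (inj₁ ≤.refl)

    private
      -- If s² > x then the Newton iterate (s + x/s)/2 is a smaller upper bound.
      s²≤x : s * s ≤ x
      s²≤x with s * s ≤? x
      ... | yes h = h
      ... | no  h = contradiction (begin
          s * s   ≤⟨ *-monoʳ-≤ √-nonNeg s≤w ⟩
          s * w   ≈⟨ *-comm s w ⟩
          w * s   ≈⟨ /-*-cancel 0<s ⟩
          x       ∎) h
        where
        0<s : 0# < s
        0<s = √-nonNeg , λ 0≈s → h (≤.trans (≤.reflexive (trans (*-congˡ (sym 0≈s)) (zeroʳ s))) 0≤x)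
        w = x / s
        v = (s + w) / fromℕ 2
        0≤v : 0# ≤ v
        0≤v = /-nonNeg (+-nonNeg √-nonNeg (/-nonNeg 0≤x 0<s)) (fromℕ-pos 2)
        v2 : v * fromℕ 2 ≈ s + w
        v2 = /-*-cancel (fromℕ-pos 2)
        x≤vv : x ≤ v * v
        x≤vv = *-cancelʳ-≤ (fromℕ-pos 4) (≤-by ((s - w) * (s - w)) (square-nonNeg (s - w)) (begin-equality
          v * v * fromℕ 4                         ≈⟨ solve 1 (λ v → v :* v :* con (+ 4) := v :* con (+ 2) :* (v :* con (+ 2))) refl v ⟩
          v * fromℕ 2 * (v * fromℕ 2)             ≈⟨ *-cong v2 v2 ⟩
          (s + w) * (s + w)                       ≈⟨ solve 2 (λ s w → (s :+ w) :* (s :+ w) := w :* s :* con (+ 4) :+ (s :- w) :* (s :- w)) refl s w ⟩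
          w * s * fromℕ 4 + (s - w) * (s - w)     ≈⟨ +-congʳ (*-congʳ (/-*-cancel 0<s)) ⟩
          x * fromℕ 4 + (s - w) * (s - w)         ∎))
        s≤v : s ≤ v
        s≤v = proj₂ lub v λ where
          y (inj₁ y≤0)  → ≤.trans y≤0 0≤v
          y (inj₂ yy≤x) → square-cancel-≤ 0≤v (≤.trans yy≤x x≤vv)
        s≤w : s ≤ w
        s≤w = ≤-by-cancel (begin
          s + s         ≈⟨ solve 1 (λ s → s :+ s := s :* con (+ 2)) refl s ⟩
          s * fromℕ 2   ≤⟨ *-monoˡ-≤ (fromℕ-nonNeg 2) s≤v ⟩
          v * fromℕ 2   ≈⟨ v2 ⟩
          s + w         ∎)
          where
          ≤-by-cancel : s + s ≤ s + w → s ≤ w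
          ≤-by-cancel h = ≤-by (s + w - (s + s)) (≤⇒0≤- h) (solve 2 (λ s w → w := s :+ (s :+ w :- (s :+ s))) refl s w)

      -- If s² < x then s + e with e = δ/(2s + 1 + δ), δ = x - s², still has its square below x.
      x≤s² : x ≤ s * s
      x≤s² with x ≤? s * s
      ... | yes h = h
      ... | no  h = contradiction (begin
          x - s * s  ≈⟨ /-*-cancel 0<D ⟨
          e * D      ≤⟨ *-monoˡ-≤ (<⇒≤ 0<D) e≤0 ⟩
          0# * D     ≈⟨ zeroˡ D ⟩
          0#         ∎) (λ δ≤0 → h (≤-by (s * s - x) (≤.trans (≤.trans (≤.reflexive (solve 0 (con (+ 0) := :- con (+ 0)) refl)) (neg-mono-≤ δ≤0))
                  (≤.reflexive (solve 2 (λ a x → :- (x :- a) := a :- x) refl (s * s) x))) (solve 2 (λ a x → a := x :+ (a :- x)) refl (s * s) x)))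
        where
        δ = x - s * s
        0≤δ : 0# ≤ δ
        0≤δ = ≤⇒0≤- (≰⇒≥ h)
        D = s + s + 1# + δ
        0<D : 0# < D
        0<D = begin-strict
          0#               <⟨ 0<1 ⟩
          1#               ≤⟨ ≤-by (s + s + δ) (+-nonNeg (+-nonNeg √-nonNeg √-nonNeg) 0≤δ)
                                (solve 2 (λ s d → s :+ s :+ con (+ 1) :+ d := con (+ 1) :+ (s :+ s :+ d)) refl s δ) ⟩
          s + s + 1# + δ   ∎
        e = δ / D
        0≤e : 0# ≤ e
        0≤e = /-nonNeg 0≤δ 0<D
        e≤1 : e ≤ 1#
        e≤1 = /-upper 0<D (≤-by (s + s + 1#) (+-nonNeg (+-nonNeg √-nonNeg √-nonNeg) 0≤1)
          (solve 2 (λ s d → con (+ 1) :* (s :+ s :+ con (+ 1) :+ d) := d :+ (s :+ s :+ con (+ 1))) refl s δ))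
        e≤0 : e ≤ 0#
        e≤0 = ≤-by (s - (s + e)) (≤⇒0≤- (proj₁ lub (s + e) (inj₂ (≤-by (e * ((1# - e) + δ))
          (*-nonNeg 0≤e (+-nonNeg (≤⇒0≤- e≤1) 0≤δ)) (begin-equality
            x                                   ≈⟨ solve 2 (λ a x → x := a :+ (x :- a)) refl (s * s) x ⟩
            s * s + δ                           ≈⟨ +-congˡ (/-*-cancel 0<D) ⟨
            s * s + e * D                       ≈⟨ solve 3 (λ s e d → s :* s :+ e :* (s :+ s :+ con (+ 1) :+ d) := (s :+ e) :* (s :+ e) :+ e :* (con (+ 1) :- e :+ d)) refl s e δ ⟩
            (s + e) * (s + e) + e * ((1# - e) + δ) ∎)))))
          (solve 2 (λ s e → con (+ 0) := e :+ (s :- (s :+ e))) refl s e)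

    √-square : s * s ≈ x
    √-square = ≤.antisym s²≤x x≤s²

  √-pos : ∀ {x} → 0# < x → 0# < √ x
  √-pos {x} (0≤x , 0≉x) = √-nonNeg 0≤x , λ 0≈s → 0≉x (begin-equality
    0#          ≈⟨ zeroʳ 0# ⟨
    0# * 0#     ≈⟨ *-cong 0≈s 0≈s ⟩
    √ x * √ x   ≈⟨ √-square 0≤x ⟩
    x           ∎)

  -- Turns a bound on all cell counts, proved in ℕ, into an upper bound for the set of areas that
  -- defines π.
  disc-area≤ : ∀ x y .{{_ : NonZero x}} → (∀ k → 4 ℕ.* quarterDiscCells k ℕ.* x ℕ.≤ k ℕ.^ 2 ℕ.* y) →
               UpperBound (λ a → ∃ λ k → a ≈ fromℕ (quarterDiscCells (suc k)) / fromℕ (suc k ℕ.^ 2)) (fromℕ y / fromℕ (4 ℕ.* x))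
  disc-area≤ x@(suc _) y h a (k , a≈) = /-lower 0<4x (*-cancelʳ-≤ 0<k² (begin
    a * fromℕ (4 ℕ.* x) * k²      ≈⟨ *-congʳ (*-congʳ a≈) ⟩
    c / k² * fromℕ (4 ℕ.* x) * k² ≈⟨ solve 3 (λ a x k → a :* x :* k := a :* k :* x) refl (c / k²) (fromℕ (4 ℕ.* x)) k² ⟩
    c / k² * k² * fromℕ (4 ℕ.* x) ≈⟨ *-cong (/-*-cancel 0<k²) (fromℕ-* 4 x) ⟩
    c * (fromℕ 4 * fromℕ x)       ≈⟨ solve 2 (λ c x → c :* (con (+ 4) :* x) := con (+ 4) :* c :* x) refl c (fromℕ x) ⟩
    fromℕ 4 * c * fromℕ x         ≈⟨ trans (fromℕ-* (4 ℕ.* quarterDiscCells (suc k)) x) (*-congʳ (fromℕ-* 4 (quarterDiscCells (suc k)))) ⟨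
    fromℕ (4 ℕ.* quarterDiscCells (suc k) ℕ.* x) ≤⟨ fromℕ-mono-≤ (h (suc k)) ⟩
    fromℕ (suc k ℕ.^ 2 ℕ.* y)     ≈⟨ fromℕ-* (suc k ℕ.^ 2) y ⟩
    k² * fromℕ y                  ≈⟨ *-comm k² (fromℕ y) ⟩
    fromℕ y * k²                  ∎))
    where
    c  = fromℕ (quarterDiscCells (suc k))
    k² = fromℕ (suc k ℕ.^ 2)
    0<k² : 0# < k²
    0<k² = fromℕ-pos (suc k ℕ.^ 2)
    0<4x : 0# < fromℕ (4 ℕ.* x)
    0<4x = fromℕ-pos (4 ℕ.* x)

  disc-area-lub : LeastUpperBound (λ a → ∃ λ k → a ≈ fromℕ (quarterDiscCells (suc k)) / fromℕ (suc k ℕ.^ 2)) _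
  -- At a = b = 1 the likelihood bound reads 32 · cells ≤ 32 k², so the areas are at most 1.
  disc-area-lub = sup-lub _ (_ , 0 , refl) (_ , disc-area≤ _ _ (λ k → likelihood-bound k 1 1))

  π-upper : ∀ x y → (∀ k → 4 ℕ.* quarterDiscCells k ℕ.* x ℕ.≤ k ℕ.^ 2 ℕ.* y) → π * fromℕ x ≤ fromℕ y
  π-upper zero      y h = ≤.trans (≤.reflexive (zeroʳ π)) (fromℕ-nonNeg y)
  π-upper x@(suc _) y h = begin
    fromℕ 4 * A * fromℕ x               ≈⟨ solve 3 (λ f a x → f :* a :* x := a :* (f :* x)) refl (fromℕ 4) A (fromℕ x) ⟩
    A * (fromℕ 4 * fromℕ x)             ≈⟨ *-congˡ (fromℕ-* 4 x) ⟨
    A * fromℕ (4 ℕ.* x)                 ≤⟨ *-monoˡ-≤ (fromℕ-nonNeg (4 ℕ.* x)) (proj₂ disc-area-lub _ (disc-area≤ x y h)) ⟩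
    fromℕ y / fromℕ (4 ℕ.* x) * fromℕ (4 ℕ.* x) ≈⟨ /-*-cancel (fromℕ-pos (4 ℕ.* x)) ⟩
    fromℕ y                             ∎
    where
    A = sup (λ a → ∃ λ k → a ≈ fromℕ (quarterDiscCells (suc k)) / fromℕ (suc k ℕ.^ 2))

  1≤π : 1# ≤ π
  1≤π = begin
    1#                            ≈⟨ +-identityʳ 1# ⟨
    fromℕ 1                       ≈⟨ /-*-cancel (fromℕ-pos 4) ⟨
    fromℕ 1 / fromℕ 4 * fromℕ 4   ≈⟨ *-comm _ _ ⟩
    -- The grid of mesh 1/2 has a single cell inside the quarter disc, of area 1/4.
    fromℕ 4 * (fromℕ 1 / fromℕ 4) ≤⟨ *-monoʳ-≤ (fromℕ-nonNeg 4) (proj₁ disc-area-lub _ (1 , refl)) ⟩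
    π                             ∎

  π≤4 : π ≤ fromℕ 4
  π≤4 = *-cancelʳ-≤ (fromℕ-pos 8) (≤.trans (π-upper 8 32 (λ k → likelihood-bound k 1 1)) (≤.reflexive (fromℕ-* 4 8)))

  π-likelihood : ∀ a b .{{_ : NonZero a}} → π * fromℕ (2 ℕ.* likelihood a b) ≤ fromℕ (odd-power (a ℕ.+ b) (a ℕ.+ b))
  π-likelihood a b = π-upper _ _ (λ k → likelihood-bound k a b)

-- The binomial distribution: recurrences, total mass and mean.

module Binomial (ℝ : CompleteOrderedField) where
  open CompleteOrderedField ℝ
  open Field ℝ
  open RangeSum +-commutativeMonoid
  open Wallis using (choose-shift; choose-sym)
  open import Data.Fin.Base using (toℕ)
  open import Data.Integer.Base using (+_)
  open import Data.Nat.Base as ℕ using (ℕ; zero; suc; z≤n; s≤s; _∸_)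
  import Data.Nat.Properties as ℕ
  open import Data.Nat.Combinatorics using (_C_; k>n⇒nCk≡0; nCk+nC[k+1]≡[n+1]C[k+1])
  open import Function.Base using (_∘_)
  open import Relation.Binary.Definitions using (tri<; tri≈; tri>)
  open import Relation.Nullary using (yes; no)
  open import Relation.Binary.PropositionalEquality.Core as ≡ using (_≡_)
  import Algebra.Properties.Semiring.Sum semiring as Sum

  opaque
    unfolding Σ<

    Σ<-mono-≤ : ∀ n {f g} → (∀ i → i ℕ.< n → f i ≤ g i) → Σ< n f ≤ Σ< n g
    Σ<-mono-≤ zero    f≤g = ≤.refl
    Σ<-mono-≤ (suc n) f≤g = +-mono-≤ (f≤g 0 (s≤s z≤n)) (Σ<-mono-≤ n (λ i i<n → f≤g (suc i) (s≤s i<n)))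

    *-Σ< : ∀ n x f → x * Σ< n f ≈ Σ< n (λ i → x * f i)
    *-Σ< n x f = Sum.*-distribˡ-sum {n} x (λ i → f (toℕ i))

  Σ<-nonNeg : ∀ n {f} → (∀ i → i ℕ.< n → 0# ≤ f i) → 0# ≤ Σ< n f
  Σ<-nonNeg n 0≤f = ≤.trans (≤.reflexive (sym (Σ<-zero n (λ _ _ → refl)))) (Σ<-mono-≤ n 0≤f)

  Σ<-extend : ∀ n k {f} → (∀ i → n ℕ.≤ i → f i ≈ 0#) → Σ< (n ℕ.+ k) f ≈ Σ< n f
  Σ<-extend n k {f} f≈0 = begin-equality
    Σ< (n ℕ.+ k) f                      ≈⟨ Σ<-split n k f ⟩
    Σ< n f + Σ< k (λ i → f (n ℕ.+ i))   ≈⟨ +-congˡ (Σ<-zero k (λ i _ → f≈0 (n ℕ.+ i) (ℕ.m≤m+n n i))) ⟩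
    Σ< n f + 0#                         ≈⟨ +-identityʳ _ ⟩
    Σ< n f                              ∎

  -- The failure probability q is an argument of its own, so that the reflected distribution is
  -- `pmf q p`.
  pmf : Carrier → Carrier → ℕ → ℕ → Carrier
  pmf p q m k = fromℕ (m C k) * p ^ k * q ^ (m ∸ k)

  pmf-vanish : ∀ p q {m k} → m ℕ.< k → pmf p q m k ≈ 0#
  pmf-vanish p q {m} {k} m<k = begin-equality
    fromℕ (m C k) * p ^ k * q ^ (m ∸ k)   ≈⟨ *-congʳ (*-congʳ (fromℕ-cong (k>n⇒nCk≡0 m<k))) ⟩
    0# * p ^ k * q ^ (m ∸ k)              ≈⟨ solve 2 (λ x y → con (+ 0) :* x :* y := con (+ 0)) refl (p ^ k) (q ^ (m ∸ k)) ⟩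
    0#                                    ∎

  pmf-sym : ∀ p q a b → pmf p q (a ℕ.+ b) a ≈ pmf q p (a ℕ.+ b) b
  pmf-sym p q a b = begin-equality
    fromℕ ((a ℕ.+ b) C a) * p ^ a * q ^ (a ℕ.+ b ∸ a)
      ≈⟨ *-cong (*-congʳ (fromℕ-cong (≡.trans (choose-sym a b) (≡.cong (_C b) (ℕ.+-comm b a)))))
                (reflexive (≡.cong (q ^_) (ℕ.m+n∸m≡n a b))) ⟩
    fromℕ ((a ℕ.+ b) C b) * p ^ a * q ^ b
      ≈⟨ solve 3 (λ c x y → c :* x :* y := c :* y :* x) refl (fromℕ ((a ℕ.+ b) C b)) (p ^ a) (q ^ b) ⟩
    fromℕ ((a ℕ.+ b) C b) * q ^ b * p ^ a
      ≈⟨ *-congˡ (reflexive (≡.cong (p ^_) (ℕ.m+n∸n≡m a b))) ⟨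
    fromℕ ((a ℕ.+ b) C b) * q ^ b * p ^ (a ℕ.+ b ∸ b) ∎

  pmf-recurrence : ∀ p q m k → pmf p q m (suc k) * fromℕ (suc k) * q ≈ pmf p q m k * (fromℕ m - fromℕ k) * p
  pmf-recurrence p q m k with ℕ.<-cmp m k
  -- Beyond m the real factor m - k is negative instead of truncated, but there both densities
  -- vanish; at k = m the factor itself is zero.
  ... | tri< m<k _ _ = begin-equality
    pmf p q m (suc k) * fromℕ (suc k) * q   ≈⟨ *-congʳ (*-congʳ (pmf-vanish p q (ℕ.m<n⇒m<1+n m<k))) ⟩
    0# * fromℕ (suc k) * q                  ≈⟨ solve 4 (λ x y z w → con (+ 0) :* x :* y := con (+ 0) :* z :* w) refl (fromℕ (suc k)) q (fromℕ m - fromℕ k) p ⟩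
    0# * (fromℕ m - fromℕ k) * p            ≈⟨ *-congʳ (*-congʳ (pmf-vanish p q m<k)) ⟨
    pmf p q m k * (fromℕ m - fromℕ k) * p   ∎
  ... | tri≈ _ ≡.refl _ = begin-equality
    pmf p q m (suc k) * fromℕ (suc k) * q   ≈⟨ *-congʳ (*-congʳ (pmf-vanish p q (ℕ.n<1+n m))) ⟩
    0# * fromℕ (suc k) * q                  ≈⟨ solve 5 (λ x y z w p → con (+ 0) :* x :* y := w :* (z :- z) :* p) refl (fromℕ (suc k)) q (fromℕ m) (pmf p q m m) p ⟩
    pmf p q m k * (fromℕ m - fromℕ k) * p   ∎
  ... | tri> _ _ k<m = ≡.subst (λ m → pmf p q m (suc k) * fromℕ (suc k) * q ≈ pmf p q m k * (fromℕ m - fromℕ k) * p)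
          (≡.trans (ℕ.+-suc k (m ∸ suc k)) (ℕ.m+[n∸m]≡n k<m)) (interior (m ∸ suc k))
    where
    interior : ∀ b → pmf p q (k ℕ.+ suc b) (suc k) * fromℕ (suc k) * q ≈ pmf p q (k ℕ.+ suc b) k * (fromℕ (k ℕ.+ suc b) - fromℕ k) * p
    interior b = begin-equality
      fromℕ (n C suc k) * (p * p ^ k) * q ^ (n ∸ suc k) * fromℕ (suc k) * q
        ≈⟨ *-congʳ (*-congʳ (*-congˡ (reflexive (≡.cong (q ^_) (≡.trans (≡.cong (_∸ suc k) (ℕ.+-suc k b)) (ℕ.m+n∸m≡n k b)))))) ⟩
      fromℕ (n C suc k) * (p * p ^ k) * q ^ b * fromℕ (suc k) * q
        ≈⟨ solve 6 (λ c p x y s q → c :* (p :* x) :* y :* s :* q := s :* c :* x :* (q :* y) :* p) refl (fromℕ (n C suc k)) p (p ^ k) (q ^ b) (fromℕ (suc k)) q ⟩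
      fromℕ (suc k) * fromℕ (n C suc k) * p ^ k * (q * q ^ b) * p
        ≈⟨ *-congʳ (*-congʳ (*-congʳ (trans (sym (fromℕ-* (suc k) (n C suc k))) (trans (fromℕ-cong (choose-shift k b)) (fromℕ-* (suc b) (n C k)))))) ⟩
      fromℕ (suc b) * fromℕ (n C k) * p ^ k * q ^ suc b * p
        ≈⟨ solve 6 (λ s c x y p k → s :* c :* x :* y :* p := c :* x :* y :* (k :+ s :- k) :* p) refl (fromℕ (suc b)) (fromℕ (n C k)) (p ^ k) (q ^ suc b) p (fromℕ k) ⟩
      fromℕ (n C k) * p ^ k * q ^ suc b * (fromℕ k + fromℕ (suc b) - fromℕ k) * p
        ≈⟨ *-congʳ (*-cong (*-congˡ (reflexive (≡.cong (q ^_) (≡.sym (ℕ.m+n∸m≡n k (suc b)))))) (+-congʳ (sym (fromℕ-+ k (suc b))))) ⟩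
      fromℕ (n C k) * p ^ k * q ^ (n ∸ k) * (fromℕ n - fromℕ k) * p ∎
      where n = k ℕ.+ suc b

  module _ (p q : Carrier) where

    pmf-zero : ∀ m → pmf p q (suc m) 0 ≈ q * pmf p q m 0
    pmf-zero m = begin-equality
      fromℕ (suc m C 0) * 1# * (q * q ^ m)
        ≈⟨ *-congʳ (*-congʳ (fromℕ-cong (≡.trans (n0≡1 (suc m)) (≡.sym (n0≡1 m))))) ⟩
      fromℕ (m C 0) * 1# * (q * q ^ m)
        ≈⟨ solve 3 (λ c q x → c :* con (+ 1) :* (q :* x) := q :* (c :* con (+ 1) :* x)) refl (fromℕ (m C 0)) q (q ^ m) ⟩
      q * (fromℕ (m C 0) * 1# * q ^ m) ∎
      where
      n0≡1 : ∀ n → n C 0 ≡ 1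
      n0≡1 n = ≡.refl

    pmf-suc : ∀ m k → pmf p q (suc m) (suc k) ≈ p * pmf p q m k + q * pmf p q m (suc k)
    pmf-suc m k = begin-equality
      fromℕ (suc m C suc k) * (p * p ^ k) * q ^ (m ∸ k)
        ≈⟨ *-congʳ (*-congʳ (trans (fromℕ-cong (≡.sym (nCk+nC[k+1]≡[n+1]C[k+1] m k))) (fromℕ-+ (m C k) (m C suc k)))) ⟩
      (fromℕ (m C k) + fromℕ (m C suc k)) * (p * p ^ k) * q ^ (m ∸ k)
        ≈⟨ solve 5 (λ c d p x y → (c :+ d) :* (p :* x) :* y := p :* (c :* x :* y) :+ d :* (p :* x) :* y) refl (fromℕ (m C k)) (fromℕ (m C suc k)) p (p ^ k) (q ^ (m ∸ k)) ⟩
      p * pmf p q m k + fromℕ (m C suc k) * (p * p ^ k) * q ^ (m ∸ k)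
        ≈⟨ +-congˡ rest ⟩
      p * pmf p q m k + q * pmf p q m (suc k) ∎
      where
      rest : fromℕ (m C suc k) * (p * p ^ k) * q ^ (m ∸ k) ≈ q * pmf p q m (suc k)
      -- A factor q splits off from q ^ (m ∸ k) only if k < m; otherwise the binomial coefficient is
      -- zero.
      rest with k ℕ.<? m
      ... | yes k<m = begin-equality
        fromℕ (m C suc k) * (p * p ^ k) * q ^ (m ∸ k)
          ≈⟨ *-congˡ (reflexive (≡.cong (q ^_) (ℕ.+-∸-assoc 1 k<m))) ⟩
        fromℕ (m C suc k) * (p * p ^ k) * (q * q ^ (m ∸ suc k))
          ≈⟨ solve 4 (λ c x q y → c :* x :* (q :* y) := q :* (c :* x :* y)) refl (fromℕ (m C suc k)) (p * p ^ k) q (q ^ (m ∸ suc k)) ⟩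
        q * pmf p q m (suc k) ∎
      ... | no k≮m = begin-equality
        fromℕ (m C suc k) * (p * p ^ k) * q ^ (m ∸ k)
          ≈⟨ *-congʳ (*-congʳ (fromℕ-cong (k>n⇒nCk≡0 m<1+k))) ⟩
        0# * (p * p ^ k) * q ^ (m ∸ k)
          ≈⟨ solve 3 (λ x y q → con (+ 0) :* x :* y := q :* con (+ 0)) refl (p * p ^ k) (q ^ (m ∸ k)) q ⟩
        q * 0#
          ≈⟨ *-congˡ (pmf-vanish p q m<1+k) ⟨
        q * pmf p q m (suc k) ∎
        where
        m<1+k : m ℕ.< suc k
        m<1+k = s≤s (ℕ.≮⇒≥ k≮m)

    expectation : ℕ → (ℕ → Carrier) → Carrier
    expectation m f = Σ< (suc m) (λ k → pmf p q m k * f k)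

    expectation-+ : ∀ m f g → expectation m (λ k → f k + g k) ≈ expectation m f + expectation m g
    expectation-+ m f g = trans (Σ<-cong (suc m) (λ k _ → distribˡ _ _ _)) (Σ<-∙ (suc m) _ _)

    expectation-zero : ∀ f → expectation 0 f ≈ f 0
    expectation-zero f = begin-equality
      expectation 0 f                                     ≈⟨ Σ<-last 0 _ ⟩
      Σ< 0 (λ k → pmf p q 0 k * f k) + pmf p q 0 0 * f 0  ≈⟨ +-congʳ (Σ<-zero 0 (λ _ ())) ⟩
      0# + fromℕ 1 * 1# * 1# * f 0                        ≈⟨ +-congˡ (*-congʳ (*-congʳ (*-congʳ (+-identityʳ 1#)))) ⟩
      0# + 1# * 1# * 1# * f 0
        ≈⟨ solve 1 (λ x → con (+ 0) :+ con (+ 1) :* con (+ 1) :* con (+ 1) :* x := x) refl (f 0) ⟩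
      f 0 ∎

    -- Conditioning on one trial. Total mass, mean and the convexity of φ all rest on this identity.
    expectation-suc : ∀ m f → expectation (suc m) f ≈ p * expectation m (f ∘ suc) + q * expectation m f
    expectation-suc m f = begin-equality
      Σ< (2 ℕ.+ m) (λ k → pmf p q (suc m) k * f k)
        ≡⟨ Σ<-first (suc m) _ ⟩
      pmf p q (suc m) 0 * f 0 + Σ< (suc m) (λ k → pmf p q (suc m) (suc k) * f (suc k))
        ≈⟨ +-cong (*-congʳ (pmf-zero m)) (Σ<-cong (suc m) (λ k _ → begin-equality
             pmf p q (suc m) (suc k) * f (suc k)
               ≈⟨ *-congʳ (pmf-suc m k) ⟩
             (p * pmf p q m k + q * pmf p q m (suc k)) * f (suc k)
               ≈⟨ solve 5 (λ p x q y z → (p :* x :+ q :* y) :* z := p :* (x :* z) :+ q :* (y :* z)) refl p (pmf p q m k) q (pmf p q m (suc k)) (f (suc k)) ⟩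
             p * (pmf p q m k * f (suc k)) + q * (pmf p q m (suc k) * f (suc k)) ∎)) ⟩
      q * pmf p q m 0 * f 0 + Σ< (suc m) (λ k → p * (pmf p q m k * f (suc k)) + q * (pmf p q m (suc k) * f (suc k)))
        ≈⟨ +-cong (*-assoc _ _ _) (trans (Σ<-∙ (suc m) _ _) (+-cong (sym (*-Σ< (suc m) p _)) (sym (*-Σ< (suc m) q _)))) ⟩
      q * (pmf p q m 0 * f 0) + (p * expectation m (f ∘ suc) + q * Σ< (suc m) (λ k → pmf p q m (suc k) * f (suc k)))
        ≈⟨ solve 5 (λ q x p y z → q :* x :+ (p :* y :+ q :* z) := p :* y :+ q :* (x :+ z)) refl q (pmf p q m 0 * f 0) p (expectation m (f ∘ suc)) (Σ< (suc m) (λ k → pmf p q m (suc k) * f (suc k))) ⟩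
      p * expectation m (f ∘ suc) + q * (pmf p q m 0 * f 0 + Σ< (suc m) (λ k → pmf p q m (suc k) * f (suc k)))
        ≡⟨ ≡.cong (λ x → p * expectation m (f ∘ suc) + q * x) (Σ<-first (suc m) _) ⟨
      p * expectation m (f ∘ suc) + q * Σ< (2 ℕ.+ m) (λ k → pmf p q m k * f k)
        ≈⟨ +-congˡ (*-congˡ (trans (Σ<-last (suc m) _) (trans (+-congˡ (trans (*-congʳ (pmf-vanish p q (ℕ.n<1+n m))) (zeroˡ _))) (+-identityʳ _)))) ⟩
      p * expectation m (f ∘ suc) + q * expectation m f ∎

  module _ {p q : Carrier} (p+q≈1 : p + q ≈ 1#) where

    expectation-const : ∀ m x → expectation p q m (λ _ → x) ≈ x
    expectation-const zero    x = expectation-zero p q _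
    expectation-const (suc m) x = begin-equality
      expectation p q (suc m) (λ _ → x)  ≈⟨ expectation-suc p q m _ ⟩
      p * expectation p q m (λ _ → x) + q * expectation p q m (λ _ → x)
                                ≈⟨ +-cong (*-congˡ (expectation-const m x)) (*-congˡ (expectation-const m x)) ⟩
      p * x + q * x             ≈⟨ distribʳ x p q ⟨
      (p + q) * x               ≈⟨ *-congʳ p+q≈1 ⟩
      1# * x                    ≈⟨ *-identityˡ x ⟩
      x                         ∎

    expectation-mean : ∀ m → expectation p q m fromℕ ≈ fromℕ m * p
    expectation-mean zero    = trans (expectation-zero p q _) (sym (zeroˡ p))
    expectation-mean (suc m) = begin-equality
      expectation p q (suc m) fromℕ       ≈⟨ expectation-suc p q m fromℕ ⟩
      p * expectation p q m (λ k → 1# + fromℕ k) + q * expectation p q m fromℕ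
        ≈⟨ +-cong (*-congˡ (trans (expectation-+ p q m (λ _ → 1#) fromℕ) (+-cong (expectation-const m 1#) (expectation-mean m)))) (*-congˡ (expectation-mean m)) ⟩
      p * (1# + fromℕ m * p) + q * (fromℕ m * p)
        ≈⟨ solve 3 (λ p q m → p :* (con (+ 1) :+ m :* p) :+ q :* (m :* p) := p :+ (p :+ q) :* (m :* p)) refl p q (fromℕ m) ⟩
      p + (p + q) * (fromℕ m * p)
        ≈⟨ +-congˡ (*-congʳ p+q≈1) ⟩
      p + 1# * (fromℕ m * p)
        ≈⟨ solve 2 (λ p m → p :+ con (+ 1) :* (m :* p) := (con (+ 1) :+ m) :* p) refl p (fromℕ m) ⟩
      fromℕ (suc m) * p ∎

  pmf-nonNeg : ∀ {p q} → 0# ≤ p → 0# ≤ q → ∀ m k → 0# ≤ pmf p q m k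
  pmf-nonNeg 0≤p 0≤q m k = *-nonNeg (*-nonNeg (fromℕ-nonNeg (m C k)) (^-nonNeg k 0≤p)) (^-nonNeg (m ∸ k) 0≤q)

  expectation-nonNeg : ∀ {p q} → 0# ≤ p → 0# ≤ q → ∀ m {f} → (∀ k → 0# ≤ f k) → 0# ≤ expectation p q m f
  expectation-nonNeg 0≤p 0≤q m 0≤f = Σ<-nonNeg (suc m) (λ k _ → *-nonNeg (pmf-nonNeg 0≤p 0≤q m k) (0≤f k))

-- Comparison of the two tails around k.

module Median (ℝ : CompleteOrderedField) where
  open CompleteOrderedField ℝ
  open Field ℝ
  open RangeSum +-commutativeMonoid
  open Binomial ℝ
  open import Data.Integer.Base using (+_)
  open import Data.Nat.Base as ℕ using (ℕ; zero; suc; s≤s; _∸_)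
  import Data.Nat.Properties as ℕ
  open import Data.Nat.Combinatorics using (_C_)
  open Wallis using (choose≢0)
  open import Data.Product.Base using (∃; _×_; _,_)
  open import Data.Sum.Base using (_⊎_; inj₁; inj₂)
  open import Relation.Nullary using (¬_; yes; no; contradiction)
  open import Relation.Binary.PropositionalEquality.Core as ≡ using (_≡_)

  pmf-pos : ∀ {p q} → 0# < p → 0# < q → ∀ a b → 0# < pmf p q (a ℕ.+ b) a
  pmf-pos 0<p 0<q a b = *-pos (*-pos (fromℕ-pos ((a ℕ.+ b) C a) {{choose≢0 a b}}) (^-pos a 0<p)) (^-pos (a ℕ.+ b ∸ a) 0<q)

  fromℕ-∸ : ∀ {m n} → n ℕ.≤ m → fromℕ (m ∸ n) ≈ fromℕ m - fromℕ n
  fromℕ-∸ {m} {n} n≤m = begin-equality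
    fromℕ (m ∸ n)                       ≈⟨ solve 2 (λ x y → x := y :+ x :- y) refl (fromℕ (m ∸ n)) (fromℕ n) ⟩
    fromℕ n + fromℕ (m ∸ n) - fromℕ n   ≈⟨ +-congʳ (trans (sym (fromℕ-+ n (m ∸ n))) (fromℕ-cong (ℕ.m+[n∸m]≡n n≤m))) ⟩
    fromℕ m - fromℕ n                   ∎

  -- On either side of the crossing (i − c) w i ≤ 0, so c + 1 times the sum dominates the first moment.
  single-crossing : ∀ n c (w : ℕ → Carrier) →
    (∀ i → i ℕ.< n → i ℕ.< c → 0# ≤ w i) → (∀ i → i ℕ.< n → c ℕ.< i → w i ≤ 0#) →
    0# ≤ Σ< n (λ i → fromℕ (suc i) * w i) → 0# ≤ Σ< n w
  single-crossing n c w before after moment = *-cancelˡ-≤ (fromℕ-pos (suc c)) (begin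
    fromℕ (suc c) * 0#                      ≈⟨ zeroʳ _ ⟩
    0#                                      ≤⟨ moment ⟩
    Σ< n (λ i → fromℕ (suc i) * w i)        ≤⟨ Σ<-mono-≤ n termwise ⟩
    Σ< n (λ i → fromℕ (suc c) * w i)        ≈⟨ *-Σ< n (fromℕ (suc c)) w ⟨
    fromℕ (suc c) * Σ< n w                  ∎)
    where
    termwise : ∀ i → i ℕ.< n → fromℕ (suc i) * w i ≤ fromℕ (suc c) * w i
    termwise i i<n with i ℕ.≤? c
    ... | no i≰c = ≤-by ((fromℕ (suc i) - fromℕ (suc c)) * - w i)
      (*-nonNeg (≤⇒0≤- (fromℕ-mono-≤ {suc c} {suc i} (ℕ.<⇒≤ (s≤s (ℕ.≰⇒> i≰c))))) (≤.trans (≤.reflexive (solve 0 (con (+ 0) := :- con (+ 0)) refl)) (neg-mono-≤ (after i i<n (ℕ.≰⇒> i≰c)))))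
      (solve 3 (λ i c w → c :* w := i :* w :+ (i :- c) :* (:- w)) refl (fromℕ (suc i)) (fromℕ (suc c)) (w i))
    ... | yes i≤c with ℕ.m≤n⇒m<n∨m≡n i≤c
    ...   | inj₁ i<c    = *-monoˡ-≤ (before i i<n i<c) (fromℕ-mono-≤ {suc i} {suc c} (s≤s i≤c))
    ...   | inj₂ ≡.refl = ≤.refl

  first-failure : ∀ {P : ℕ → Set} → (∀ i → P i ⊎ ¬ P i) → ∀ n →
                  (∀ i → i ℕ.< n → P i) ⊎ ∃ λ c → c ℕ.< n × (∀ i → i ℕ.< c → P i) × ¬ P c
  first-failure P? zero    = inj₁ λ _ ()
  first-failure P? (suc n) with first-failure P? n
  ... | inj₂ (c , c<n , h) = inj₂ (c , ℕ.m<n⇒m<1+n c<n , h)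
  ... | inj₁ below with P? n
  ...   | inj₂ ¬Pn = inj₂ (n , ℕ.n<1+n n , below , ¬Pn)
  ...   | inj₁ Pn  = inj₁ λ i i<1+n → case-≤ i (ℕ.m≤n⇒m<n∨m≡n (ℕ.≤-pred i<1+n))
    where
    case-≤ : ∀ i → i ℕ.< n ⊎ i ≡ n → _
    case-≤ i (inj₁ i<n)    = below i i<n
    case-≤ i (inj₂ ≡.refl) = Pn

  module _ {p q} (0<p : 0# < p) (0<q : 0# < q) (p+q≈1 : p + q ≈ 1#)
           (k l : ℕ) (k+1≤mean : fromℕ (suc k) ≤ fromℕ (k ℕ.+ l) * p) where
    private
      m = k ℕ.+ l
      κ = fromℕ k
      ℓ = fromℕ l

      -- These are b(k+i) and b(k-i). Expressing the latter by the number l + i of failures avoids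
      -- truncated subtraction and makes it vanish for i > k.
      U V : ℕ → Carrier
      U i = pmf p q m (k ℕ.+ i)
      V i = pmf q p m (l ℕ.+ i)

      U-nonNeg : ∀ i → 0# ≤ U i
      U-nonNeg i = pmf-nonNeg (<⇒≤ 0<p) (<⇒≤ 0<q) m (k ℕ.+ i)

      V-nonNeg : ∀ i → 0# ≤ V i
      V-nonNeg i = pmf-nonNeg (<⇒≤ 0<q) (<⇒≤ 0<p) m (l ℕ.+ i)

      U-vanish : ∀ {i} → l ℕ.< i → U i ≈ 0#
      U-vanish l<i = pmf-vanish p q (ℕ.+-monoʳ-< k l<i)

      V-vanish : ∀ {i} → k ℕ.< i → V i ≈ 0#
      V-vanish {i} k<i = pmf-vanish q p (≡.subst (ℕ._< l ℕ.+ i) (ℕ.+-comm l k) (ℕ.+-monoʳ-< l k<i))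

      V-pos : ∀ {i} → i ℕ.≤ k → 0# < V i
      V-pos {i} i≤k = ≡.subst (λ n → 0# < pmf q p n (l ℕ.+ i))
        (≡.trans (ℕ.+-assoc l i (k ∸ i)) (≡.trans (≡.cong (l ℕ.+_) (ℕ.m+[n∸m]≡n i≤k)) (ℕ.+-comm l k)))
        (pmf-pos 0<q 0<p (l ℕ.+ i) (k ∸ i))

      U₀≈V₀ : U 0 ≈ V 0
      U₀≈V₀ = ≡.subst₂ (λ a b → pmf p q m a ≈ pmf q p m b) (≡.sym (ℕ.+-identityʳ k)) (≡.sym (ℕ.+-identityʳ l)) (pmf-sym p q k l)

      -- Cross-multiplied growth factors of V and U: where both are meaningful, M i ≤ N i says that
      -- U / V does not decrease from i to i + 1.
      M N : ℕ → Carrier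
      M i = (κ - fromℕ i) * (κ + 1# + fromℕ i) * (q * q)
      N i = (ℓ - fromℕ i) * (ℓ + 1# + fromℕ i) * (p * p)

      U-recurrence : ∀ i → U (suc i) * (κ + 1# + fromℕ i) * q ≈ U i * (ℓ - fromℕ i) * p
      U-recurrence i = begin-equality
        U (suc i) * (κ + 1# + fromℕ i) * q
          ≈⟨ *-congʳ (*-cong (reflexive (≡.cong (pmf p q m) (ℕ.+-suc k i)))
               (trans (solve 2 (λ k i → k :+ con (+ 1) :+ i := con (+ 1) :+ (k :+ i)) refl κ (fromℕ i)) (+-congˡ (sym (fromℕ-+ k i))))) ⟩
        pmf p q m (suc (k ℕ.+ i)) * fromℕ (suc (k ℕ.+ i)) * q
          ≈⟨ pmf-recurrence p q m (k ℕ.+ i) ⟩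
        U i * (fromℕ m - fromℕ (k ℕ.+ i)) * p
          ≈⟨ *-congʳ (*-congˡ (trans (+-cong (fromℕ-+ k l) (-‿cong (fromℕ-+ k i)))
               (solve 3 (λ k l i → k :+ l :- (k :+ i) := l :- i) refl κ ℓ (fromℕ i)))) ⟩
        U i * (ℓ - fromℕ i) * p ∎

      V-recurrence : ∀ i → V (suc i) * (ℓ + 1# + fromℕ i) * p ≈ V i * (κ - fromℕ i) * q
      V-recurrence i = begin-equality
        V (suc i) * (ℓ + 1# + fromℕ i) * p
          ≈⟨ *-congʳ (*-cong (reflexive (≡.cong (pmf q p m) (ℕ.+-suc l i)))
               (trans (solve 2 (λ k i → k :+ con (+ 1) :+ i := con (+ 1) :+ (k :+ i)) refl ℓ (fromℕ i)) (+-congˡ (sym (fromℕ-+ l i))))) ⟩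
        pmf q p m (suc (l ℕ.+ i)) * fromℕ (suc (l ℕ.+ i)) * p
          ≈⟨ pmf-recurrence q p m (l ℕ.+ i) ⟩
        V i * (fromℕ m - fromℕ (l ℕ.+ i)) * q
          ≈⟨ *-congʳ (*-congˡ (trans (+-cong (fromℕ-+ k l) (-‿cong (fromℕ-+ l i)))
               (solve 3 (λ k l i → k :+ l :- (l :+ i) := k :- i) refl κ ℓ (fromℕ i)))) ⟩
        V i * (κ - fromℕ i) * q ∎

      UV-recurrence : ∀ i → V i * M i * U (suc i) ≈ U i * V (suc i) * N i
      UV-recurrence i = begin-equality
        V i * ((κ - fromℕ i) * (κ + 1# + fromℕ i) * (q * q)) * U (suc i)
          ≈⟨ solve 5 (λ v a b q u → v :* (a :* b :* (q :* q)) :* u := (v :* a :* q) :* (u :* b :* q)) refl (V i) (κ - fromℕ i) (κ + 1# + fromℕ i) q (U (suc i)) ⟩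
        (V i * (κ - fromℕ i) * q) * (U (suc i) * (κ + 1# + fromℕ i) * q)
          ≈⟨ *-cong (sym (V-recurrence i)) (U-recurrence i) ⟩
        (V (suc i) * (ℓ + 1# + fromℕ i) * p) * (U i * (ℓ - fromℕ i) * p)
          ≈⟨ solve 5 (λ v a b p u → (v :* b :* p) :* (u :* a :* p) := u :* v :* (a :* b :* (p :* p))) refl (V (suc i)) (ℓ - fromℕ i) (ℓ + 1# + fromℕ i) p (U i) ⟩
        U i * V (suc i) * ((ℓ - fromℕ i) * (ℓ + 1# + fromℕ i) * (p * p)) ∎

      κ+1+i-pos : ∀ i → 0# < κ + 1# + fromℕ i
      κ+1+i-pos i = begin-strict
        0#                  <⟨ fromℕ-pos (suc (k ℕ.+ i)) ⟩
        1# + fromℕ (k ℕ.+ i) ≈⟨ +-congˡ (fromℕ-+ k i) ⟩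
        1# + (κ + fromℕ i)  ≈⟨ solve 2 (λ k i → con (+ 1) :+ (k :+ i) := k :+ con (+ 1) :+ i) refl κ (fromℕ i) ⟩
        κ + 1# + fromℕ i    ∎

      κ-i-pos : ∀ {i} → i ℕ.< k → 0# < κ - fromℕ i
      κ-i-pos {i} i<k = begin-strict
        0#              <⟨ fromℕ-pos (k ∸ i) {{ℕ.>-nonZero (ℕ.m<n⇒0<n∸m i<k)}} ⟩
        fromℕ (k ∸ i)   ≈⟨ fromℕ-∸ (ℕ.<⇒≤ i<k) ⟩
        κ - fromℕ i     ∎

      M-pos : ∀ {i} → i ℕ.< k → 0# < M i
      M-pos {i} i<k = *-pos (*-pos (κ-i-pos i<k) (κ+1+i-pos i)) (*-pos 0<q 0<q)

      ratio-step-≥ : ∀ i → i ℕ.< k → M i ≤ N i → V i ≤ U i → V (suc i) ≤ U (suc i)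
      ratio-step-≥ i i<k M≤N V≤U = *-cancelˡ-≤ (*-pos (V-pos (ℕ.<⇒≤ i<k)) (M-pos i<k)) (begin
        V i * M i * V (suc i)   ≈⟨ solve 3 (λ x y z → x :* y :* z := x :* z :* y) refl (V i) (M i) (V (suc i)) ⟩
        V i * V (suc i) * M i   ≤⟨ *-mono-≤ (*-nonNeg (V-nonNeg i) (V-nonNeg (suc i))) (≤.trans (<⇒≤ (M-pos i<k)) M≤N)
                                     (*-monoˡ-≤ (V-nonNeg (suc i)) V≤U) M≤N ⟩
        U i * V (suc i) * N i   ≈⟨ UV-recurrence i ⟨
        V i * M i * U (suc i)   ∎)

      ratio-step-≤ : ∀ i → i ℕ.< k → N i ≤ M i → U i ≤ V i → U (suc i) ≤ V (suc i)
      ratio-step-≤ i i<k N≤M U≤V = *-cancelˡ-≤ (*-pos (V-pos (ℕ.<⇒≤ i<k)) (M-pos i<k)) (begin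
        V i * M i * U (suc i)   ≈⟨ UV-recurrence i ⟩
        U i * V (suc i) * N i   ≤⟨ *-monoʳ-≤ (*-nonNeg (U-nonNeg i) (V-nonNeg (suc i))) N≤M ⟩
        U i * V (suc i) * M i   ≤⟨ *-monoˡ-≤ (<⇒≤ (M-pos i<k)) (*-monoˡ-≤ (V-nonNeg (suc i)) U≤V) ⟩
        V i * V (suc i) * M i   ≈⟨ solve 3 (λ x y z → x :* y :* z := x :* z :* y) refl (V i) (M i) (V (suc i)) ⟨
        V i * M i * V (suc i)   ∎)

      -- The hypothesis on the mean gives κq ≤ ℓp and (κ+1)q ≤ (ℓ+1)p, which settles i = 0. The
      -- remaining terms -i(i+1)q² and -i(i+1)p² favour N when p ≤ q.
      p≤q⇒M≤N : p ≤ q → ∀ i → M i ≤ N i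
      p≤q⇒M≤N p≤q i = ≤-by ((ℓ * p * ((ℓ + 1#) * p) - κ * q * ((κ + 1#) * q)) + (q * q - p * p) * (fromℕ i * (1# + fromℕ i)))
        (+-nonNeg (≤⇒0≤- (*-mono-≤ (*-nonNeg (fromℕ-nonNeg k) (<⇒≤ 0<q)) (*-nonNeg (+-nonNeg (fromℕ-nonNeg l) 0≤1) (<⇒≤ 0<p)) κq≤ℓp κq≤ℓp+))
                  (*-nonNeg (≤⇒0≤- (square-mono-≤ (<⇒≤ 0<p) p≤q)) (*-nonNeg (fromℕ-nonNeg i) (fromℕ-nonNeg (suc i)))))
        (solve 5 (λ p q k l i → (l :- i) :* (l :+ con (+ 1) :+ i) :* (p :* p) :=
          (k :- i) :* (k :+ con (+ 1) :+ i) :* (q :* q) :+ (l :* p :* ((l :+ con (+ 1)) :* p) :- k :* q :* ((k :+ con (+ 1)) :* q) :+ (q :* q :- p :* p) :* (i :* (con (+ 1) :+ i))))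
          refl p q κ ℓ (fromℕ i))
        where
        κ+1≤ : 1# + κ * (p + q) ≤ (κ + ℓ) * p
        κ+1≤ = begin
          1# + κ * (p + q)  ≈⟨ +-congˡ (trans (*-congˡ p+q≈1) (*-identityʳ κ)) ⟩
          fromℕ (suc k)     ≤⟨ k+1≤mean ⟩
          fromℕ m * p       ≈⟨ *-congʳ (fromℕ-+ k l) ⟩
          (κ + ℓ) * p       ∎
        κq≤ℓp : κ * q ≤ ℓ * p
        κq≤ℓp = ≤-by (1# + ((κ + ℓ) * p - (1# + κ * (p + q)))) (+-nonNeg 0≤1 (≤⇒0≤- κ+1≤))
          (solve 4 (λ p q k l → l :* p := k :* q :+ (con (+ 1) :+ ((k :+ l) :* p :- (con (+ 1) :+ k :* (p :+ q))))) refl p q κ ℓ)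
        κq≤ℓp+ : (κ + 1#) * q ≤ (ℓ + 1#) * p
        κq≤ℓp+ = ≤-by (p + p + ((κ + ℓ) * p - (1# + κ * (p + q)))) (+-nonNeg (+-nonNeg (<⇒≤ 0<p) (<⇒≤ 0<p)) (≤⇒0≤- κ+1≤)) (begin-equality
          (ℓ + 1#) * p
            ≈⟨ solve 4 (λ p q k l → (l :+ con (+ 1)) :* p := (k :+ con (+ 1)) :* q :+ (p :+ (con (+ 1) :- q) :+ ((k :+ l) :* p :- (con (+ 1) :+ k :* (p :+ q))))) refl p q κ ℓ ⟩
          (κ + 1#) * q + (p + (1# - q) + ((κ + ℓ) * p - (1# + κ * (p + q))))
            ≈⟨ +-congˡ (+-congʳ (+-congˡ (trans (+-congʳ (sym p+q≈1)) (solve 2 (λ p q → p :+ q :- q := p) refl p q)))) ⟩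
          (κ + 1#) * q + (p + p + ((κ + ℓ) * p - (1# + κ * (p + q)))) ∎)

      -- Holds factor by factor. Its contrapositive yields l < k once U has dropped below V.
      k≤l⇒M≤N : q ≤ p → k ℕ.≤ l → ∀ i → i ℕ.< k → M i ≤ N i
      k≤l⇒M≤N q≤p k≤l i i<k = *-mono-≤ (<⇒≤ (*-pos (κ-i-pos i<k) (κ+1+i-pos i))) (square-nonNeg p)
        (*-mono-≤ (<⇒≤ (κ-i-pos i<k)) (≤.trans (<⇒≤ (κ+1+i-pos i)) κ+1+i≤) (+-monoˡ-≤ _ (fromℕ-mono-≤ k≤l)) κ+1+i≤)
        (square-mono-≤ (<⇒≤ 0<q) q≤p)
        where
        κ+1+i≤ : κ + 1# + fromℕ i ≤ ℓ + 1# + fromℕ i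
        κ+1+i≤ = +-monoˡ-≤ _ (+-monoˡ-≤ 1# (fromℕ-mono-≤ k≤l))

      -- For q ≤ p the difference M i - N i is a constant plus (p² - q²) i(i+1), so it does not
      -- decrease in i.
      N≤M-later : q ≤ p → ∀ {i j} → i ℕ.≤ j → N i ≤ M i → N j ≤ M j
      N≤M-later q≤p {i} {j} i≤j N≤M = ≤-by ((M i - N i) + (p * p - q * q) * (fromℕ j * (1# + fromℕ j) - fromℕ i * (1# + fromℕ i)))
        (+-nonNeg (≤⇒0≤- N≤M) (*-nonNeg (≤⇒0≤- (square-mono-≤ (<⇒≤ 0<q) q≤p))
          (≤⇒0≤- (*-mono-≤ (fromℕ-nonNeg i) (fromℕ-nonNeg (suc j)) (fromℕ-mono-≤ i≤j) (fromℕ-mono-≤ {suc i} {suc j} (s≤s i≤j))))))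
        (solve 6 (λ p q k l i j → (k :- j) :* (k :+ con (+ 1) :+ j) :* (q :* q) :=
          (l :- j) :* (l :+ con (+ 1) :+ j) :* (p :* p) :+
          (((k :- i) :* (k :+ con (+ 1) :+ i) :* (q :* q) :- (l :- i) :* (l :+ con (+ 1) :+ i) :* (p :* p))
            :+ (p :* p :- q :* q) :* (j :* (con (+ 1) :+ j) :- i :* (con (+ 1) :+ i))))
          refl p q κ ℓ (fromℕ i) (fromℕ j))

      -- A drop of U below V forces M c > N c, hence q ≤ p and l < k. From then on U / V keeps
      -- falling while V is positive, and beyond that U is zero.
      after-crossing : ∀ c → V c ≤ U c → ¬ V (suc c) ≤ U (suc c) → ∀ i → U (suc c ℕ.+ i) ≤ V (suc c ℕ.+ i)
      after-crossing c V≤U V≰U = go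
        where
        c<k : c ℕ.< k
        c<k with c ℕ.<? k
        ... | yes c<k = c<k
        ... | no  c≮k = contradiction (≤.trans (≤.reflexive (V-vanish (s≤s (ℕ.≮⇒≥ c≮k)))) (U-nonNeg (suc c))) V≰U
        M≰N : ¬ M c ≤ N c
        M≰N M≤N = V≰U (ratio-step-≥ c c<k M≤N V≤U)
        q≤p : q ≤ p
        q≤p = ≰⇒≥ (λ p≤q → M≰N (p≤q⇒M≤N p≤q c))
        l<k : l ℕ.< k
        l<k = ℕ.≰⇒> (λ k≤l → M≰N (k≤l⇒M≤N q≤p k≤l c c<k))
        go : ∀ i → U (suc c ℕ.+ i) ≤ V (suc c ℕ.+ i)
        go zero rewrite ℕ.+-identityʳ c = ≰⇒≥ V≰U
        go (suc i) rewrite ℕ.+-suc c i with suc c ℕ.+ i ℕ.<? k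
        ... | yes j<k = ratio-step-≤ (suc c ℕ.+ i) j<k (N≤M-later q≤p (ℕ.m≤n⇒m≤1+n (ℕ.m≤m+n c i)) (≰⇒≥ M≰N)) (go i)
        ... | no  j≮k = ≤.trans (≤.reflexive (U-vanish (ℕ.<-trans l<k (s≤s (ℕ.≮⇒≥ j≮k))))) (V-nonNeg (2 ℕ.+ (c ℕ.+ i)))

      -- The lower part is reflected, so that both tails are indexed by the distance from k.
      split : ∀ g → expectation p q m g ≈
              Σ< k (λ i → V (suc i) * g (k ∸ suc i)) + (U 0 * g k + Σ< l (λ i → U (suc i) * g (k ℕ.+ suc i)))
      split g = begin-equality
        Σ< (suc m) F                                        ≡⟨ ≡.cong (λ n → Σ< n F) (ℕ.+-suc k l) ⟨
        Σ< (k ℕ.+ suc l) F                                  ≈⟨ Σ<-split k (suc l) F ⟩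
        Σ< k F + Σ< (suc l) (λ i → F (k ℕ.+ i))             ≈⟨ +-cong (trans (Σ<-reverse k F) (Σ<-cong k below)) (trans (reflexive (Σ<-first l _)) (+-congʳ (*-congˡ (reflexive (≡.cong g (ℕ.+-identityʳ k)))))) ⟩
        Σ< k (λ i → V (suc i) * g (k ∸ suc i)) + (U 0 * g k + Σ< l (λ i → U (suc i) * g (k ℕ.+ suc i))) ∎
        where
        F : ℕ → Carrier
        F j = pmf p q m j * g j
        below : ∀ i → i ℕ.< k → F (k ∸ suc i) ≈ V (suc i) * g (k ∸ suc i)
        below i i<k = *-congʳ (≡.subst (λ n → pmf p q n (k ∸ suc i) ≈ pmf q p n (l ℕ.+ suc i))
          (≡.trans (≡.cong (k ∸ suc i ℕ.+_) (ℕ.+-comm l (suc i)))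
            (≡.trans (≡.sym (ℕ.+-assoc (k ∸ suc i) (suc i) l)) (≡.cong (ℕ._+ l) (ℕ.m∸n+n≡m i<k))))
          (pmf-sym p q (k ∸ suc i) (l ℕ.+ suc i)))

      upper lower : Carrier
      upper = Σ< l (λ i → U (suc i))
      lower = Σ< k (λ i → V (suc i))

      total : lower + (U 0 + upper) ≈ 1#
      total = begin-equality
        lower + (U 0 + upper)
          ≈⟨ +-cong (Σ<-cong k (λ i _ → sym (*-identityʳ _))) (+-cong (sym (*-identityʳ _)) (Σ<-cong l (λ i _ → sym (*-identityʳ _)))) ⟩
        Σ< k (λ i → V (suc i) * 1#) + (U 0 * 1# + Σ< l (λ i → U (suc i) * 1#)) ≈⟨ split (λ _ → 1#) ⟨
        expectation p q m (λ _ → 1#)   ≈⟨ expectation-const p+q≈1 m 1# ⟩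
        1#                             ∎

      extendU : ∀ {f} → (∀ i → l ℕ.≤ i → f i ≈ 0#) → Σ< m f ≈ Σ< l f
      extendU {f} f≈0 = trans (reflexive (≡.cong (λ n → Σ< n f) (ℕ.+-comm k l))) (Σ<-extend l k f≈0)

      -- The sum is the first moment about k, that is, the mean minus k, which is at least 1. Both
      -- tails are padded with zeros to the common length m.
      moment : 0# ≤ Σ< m (λ i → fromℕ (suc i) * (U (suc i) - V (suc i)))
      moment = begin
        0#                                  ≤⟨ +-nonNeg 0≤1 (≤⇒0≤- k+1≤mean) ⟩
        1# + (fromℕ m * p - (1# + κ))       ≈⟨ solve 2 (λ x k → con (+ 1) :+ (x :- (con (+ 1) :+ k)) := x :+ (:- k)) refl (fromℕ m * p) κ ⟩
        fromℕ m * p + - κ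
          ≈⟨ +-cong (expectation-mean p+q≈1 m) (expectation-const p+q≈1 m (- κ)) ⟨
        expectation p q m fromℕ + expectation p q m (λ _ → - κ)
          ≈⟨ expectation-+ p q m fromℕ (λ _ → - κ) ⟨
        expectation p q m (λ j → fromℕ j - κ)
          ≈⟨ split (λ j → fromℕ j - κ) ⟩
        Σ< k (λ i → V (suc i) * (fromℕ (k ∸ suc i) - κ)) + (U 0 * (κ - κ) + Σ< l (λ i → U (suc i) * (fromℕ (k ℕ.+ suc i) - κ)))
          ≈⟨ +-cong
               (trans (Σ<-cong k (λ i i<k → trans (*-congˡ (+-congʳ (fromℕ-∸ i<k))) (solve 3 (λ v k i → v :* (k :- i :- k) := :- (i :* v)) refl (V (suc i)) κ (fromℕ (suc i)))))
                      (sym (Σ<-extend k l (λ i k≤i → trans (-‿cong (trans (*-congˡ (V-vanish (s≤s k≤i))) (zeroʳ _))) (solve 0 (:- con (+ 0) := con (+ 0)) refl)))))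
               (trans (+-cong (solve 2 (λ u k → u :* (k :- k) := con (+ 0)) refl (U 0) κ)
                              (trans (Σ<-cong l (λ i _ → trans (*-congˡ (+-congʳ (fromℕ-+ k (suc i)))) (solve 3 (λ u k i → u :* (k :+ i :- k) := i :* u) refl (U (suc i)) κ (fromℕ (suc i)))))
                                     (sym (extendU (λ i l≤i → trans (*-congˡ (U-vanish (s≤s l≤i))) (zeroʳ _))))))
                      (+-identityˡ _)) ⟩
        Σ< m (λ i → - (fromℕ (suc i) * V (suc i))) + Σ< m (λ i → fromℕ (suc i) * U (suc i))
          ≈⟨ Σ<-∙ m _ _ ⟨
        Σ< m (λ i → - (fromℕ (suc i) * V (suc i)) + fromℕ (suc i) * U (suc i))
          ≈⟨ Σ<-cong m (λ i _ → solve 3 (λ n v u → :- (n :* v) :+ n :* u := n :* (u :- v)) refl (fromℕ (suc i)) (V (suc i)) (U (suc i))) ⟩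
        Σ< m (λ i → fromℕ (suc i) * (U (suc i) - V (suc i))) ∎

      V≤U? : ∀ i → V i ≤ U i ⊎ ¬ V i ≤ U i
      V≤U? i with V i ≤? U i
      ... | yes h = inj₁ h
      ... | no  h = inj₂ h

      difference : 0# ≤ Σ< m (λ i → U (suc i) - V (suc i))
      difference with first-failure V≤U? (suc m)
      ... | inj₁ V≤U = Σ<-nonNeg m (λ i i<m → ≤⇒0≤- (V≤U (suc i) (s≤s i<m)))
      -- U and V agree at 0, so the first failure is some c + 1, which belongs to the summand with
      -- index c.
      ... | inj₂ (zero  , _ , _ , V≰U) = contradiction (≤.reflexive (sym U₀≈V₀)) V≰U
      ... | inj₂ (suc c , _ , V≤U , V≰U) = single-crossing m c _
        (λ i _ i<c → ≤⇒0≤- (V≤U (suc i) (s≤s i<c)))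
        (λ i _ c<i → ≤-by (V (suc i) - U (suc i))
          (≤⇒0≤- (≡.subst (λ j → U (suc j) ≤ V (suc j)) (ℕ.m+[n∸m]≡n (ℕ.<⇒≤ c<i)) (after-crossing c (V≤U c (ℕ.n<1+n c)) V≰U (i ∸ c))))
          (solve 2 (λ u v → con (+ 0) := u :- v :+ (v :- u)) refl (U (suc i)) (V (suc i))))
        moment

      lower≤upper : lower ≤ upper
      lower≤upper = ≤-by _ difference (begin-equality
        upper                                                 ≈⟨ extendU (λ i l≤i → U-vanish (s≤s l≤i)) ⟨
        Σ< m (λ i → U (suc i))
          ≈⟨ Σ<-cong m (λ i _ → solve 2 (λ u v → u := v :+ (u :- v)) refl (U (suc i)) (V (suc i))) ⟩
        Σ< m (λ i → V (suc i) + (U (suc i) - V (suc i)))      ≈⟨ Σ<-∙ m _ _ ⟩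
        Σ< m (λ i → V (suc i)) + Σ< m (λ i → U (suc i) - V (suc i))
          ≈⟨ +-congʳ (Σ<-extend k l (λ i k≤i → V-vanish (s≤s k≤i))) ⟩
        lower + Σ< m (λ i → U (suc i) - V (suc i))            ∎)

    upper-tail : 1# ≤ Σ< l (λ i → pmf p q (k ℕ.+ l) (k ℕ.+ suc i)) * fromℕ 2 + pmf p q (k ℕ.+ l) k
    upper-tail = begin
      1#                        ≈⟨ total ⟨
      lower + (U 0 + upper)     ≤⟨ +-monoˡ-≤ _ lower≤upper ⟩
      upper + (U 0 + upper)     ≈⟨ solve 2 (λ u x → u :+ (x :+ u) := u :* con (+ 2) :+ x) refl upper (U 0) ⟩
      upper * fromℕ 2 + U 0     ≈⟨ +-congˡ (reflexive (≡.cong (pmf p q m) (ℕ.+-identityʳ k))) ⟩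
      upper * fromℕ 2 + pmf p q m k ∎

-- Maximum of the binomial density over the success probability.

module Density (ℝ : CompleteOrderedField) where
  open CompleteOrderedField ℝ
  open Reals ℝ using (π)
  open Field ℝ
  open Pi ℝ
  open Binomial ℝ using (pmf)
  open Stirling using (likelihood; odd-power)
  open import Data.Integer.Base using (+_)
  open import Data.Nat.Base as ℕ using (ℕ; zero; suc; NonZero)
  import Data.Nat.Properties as ℕ
  open import Data.Nat.Combinatorics using (_C_)
  import Relation.Binary.PropositionalEquality as ≡

  -- The inequality of means for n powers of a and one of t, free of roots. The slack for n + 1 is t
  -- times the slack for n plus (n+1) aⁿ (t - a)².
  bernoulli : ∀ n {t a} → 0# ≤ t → 0# ≤ a → fromℕ (suc n) * (t * a ^ n) ≤ t ^ suc n + fromℕ n * a ^ suc n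
  bernoulli zero {t} {a} 0≤t 0≤a = ≤.reflexive
    (solve 2 (λ t a → (con (+ 1) :+ con (+ 0)) :* (t :* con (+ 1)) := t :* con (+ 1) :+ con (+ 0) :* (a :* con (+ 1))) refl t a)
  bernoulli (suc n) {t} {a} 0≤t 0≤a = ≤-by
    (t * (t ^ suc n + fromℕ n * a ^ suc n - fromℕ (suc n) * (t * a ^ n)) + fromℕ (suc n) * a ^ n * ((t - a) * (t - a)))
    (+-nonNeg (*-nonNeg 0≤t (≤⇒0≤- (bernoulli n 0≤t 0≤a)))
              (*-nonNeg (*-nonNeg (fromℕ-nonNeg (suc n)) (^-nonNeg n 0≤a)) (square-nonNeg (t - a))))
    (solve 5 (λ t a n x y →
       t :* (t :* x) :+ (con (+ 1) :+ n) :* (a :* (a :* y)) :=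
       (con (+ 1) :+ (con (+ 1) :+ n)) :* (t :* (a :* y)) :+
       (t :* (t :* x :+ n :* (a :* y) :- (con (+ 1) :+ n) :* (t :* y)) :+ (con (+ 1) :+ n) :* y :* ((t :- a) :* (t :- a))))
     refl t a (fromℕ n) (t ^ n) (a ^ n))

  -- `bernoulli` at a = s/n, the mean of n numbers with sum s, and t = (s+y)/(n+1), the mean after y
  -- has joined them.
  AM-GM-step : ∀ n .{{_ : NonZero n}} {s y} → 0# ≤ s → 0# ≤ y →
               fromℕ (suc n) ^ suc n * (s ^ n * y) ≤ (s + y) ^ suc n * fromℕ n ^ n
  AM-GM-step n {s} {y} 0≤s 0≤y = begin
    N⁺ ^ suc n * (s ^ n * y)
      ≈⟨ *-congˡ (*-cong (trans (^-congˡ n (sym aN≈s)) (^-distrib-* a N n)) (begin-equality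
           y               ≈⟨ solve 2 (λ s y → y := s :+ y :- s) refl s y ⟩
           (s + y) - s     ≈⟨ +-cong tN⁺≈s+y (-‿cong aN≈s) ⟨
           t * N⁺ - a * N  ∎)) ⟩
    N⁺ ^ suc n * (a ^ n * N ^ n * (t * N⁺ - a * N))
      ≈⟨ solve 7 (λ x a t z y N N⁺ → x :* (y :* z :* (t :* N⁺ :- a :* N)) := (N⁺ :* (t :* y) :- N :* (a :* y)) :* (x :* z)) refl
           (N⁺ ^ suc n) a t (N ^ n) (a ^ n) N N⁺ ⟩
    (N⁺ * (t * a ^ n) - N * a ^ suc n) * (N⁺ ^ suc n * N ^ n)
      ≤⟨ *-monoˡ-≤ (*-nonNeg (^-nonNeg (suc n) (fromℕ-nonNeg (suc n))) (^-nonNeg n (fromℕ-nonNeg n)))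
           (≤.trans (+-monoˡ-≤ _ (bernoulli n 0≤t 0≤a)) (≤.reflexive (solve 2 (λ x y → x :+ y :- y := x) refl (t ^ suc n) (N * a ^ suc n)))) ⟩
    t ^ suc n * (N⁺ ^ suc n * N ^ n)
      ≈⟨ *-assoc _ _ _ ⟨
    t ^ suc n * N⁺ ^ suc n * N ^ n
      ≈⟨ *-congʳ (trans (sym (^-distrib-* t N⁺ (suc n))) (^-congˡ (suc n) tN⁺≈s+y)) ⟩
    (s + y) ^ suc n * N ^ n ∎
    where
    N  = fromℕ n
    N⁺ = fromℕ (suc n)
    a = s / N
    t = (s + y) / N⁺
    aN≈s : a * N ≈ s
    aN≈s = /-*-cancel (fromℕ-pos n)
    tN⁺≈s+y : t * N⁺ ≈ s + y
    tN⁺≈s+y = /-*-cancel (fromℕ-pos (suc n))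
    0≤a : 0# ≤ a
    0≤a = /-nonNeg 0≤s (fromℕ-pos n)
    0≤t : 0# ≤ t
    0≤t = /-nonNeg (+-nonNeg 0≤s 0≤y) (fromℕ-pos (suc n))

  AM-GM : ∀ a b .{{_ : NonZero a}} {x y} → 0# ≤ x → 0# ≤ y →
          fromℕ (a ℕ.+ b) ^ (a ℕ.+ b) * (x ^ a * y ^ b) ≤ (fromℕ a * x + fromℕ b * y) ^ (a ℕ.+ b)
  AM-GM a zero {x} {y} 0≤x 0≤y rewrite ℕ.+-identityʳ a = ≤.reflexive (begin-equality
    fromℕ a ^ a * (x ^ a * 1#)      ≈⟨ *-congˡ (*-identityʳ _) ⟩
    fromℕ a ^ a * x ^ a             ≈⟨ ^-distrib-* (fromℕ a) x a ⟨
    (fromℕ a * x) ^ a               ≈⟨ ^-congˡ a (solve 2 (λ z y → z := z :+ con (+ 0) :* y) refl (fromℕ a * x) y) ⟩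
    (fromℕ a * x + 0# * y) ^ a      ∎)
  AM-GM a@(suc _) (suc b) {x} {y} 0≤x 0≤y = ≡.subst
    (λ m → fromℕ m ^ m * (x ^ a * y ^ suc b) ≤ (fromℕ a * x + fromℕ (suc b) * y) ^ m) (≡.sym (ℕ.+-suc a b)) (*-cancelʳ-≤ (^-pos n (fromℕ-pos n)) (begin
    fromℕ (suc n) ^ suc n * (x ^ a * (y * y ^ b)) * fromℕ n ^ n
      ≈⟨ solve 5 (λ c x y z d → c :* (x :* (y :* z)) :* d := c :* (d :* (x :* z) :* y)) refl (fromℕ (suc n) ^ suc n) (x ^ a) y (y ^ b) (fromℕ n ^ n) ⟩
    fromℕ (suc n) ^ suc n * (fromℕ n ^ n * (x ^ a * y ^ b) * y)
      ≤⟨ *-monoʳ-≤ (^-nonNeg (suc n) (fromℕ-nonNeg (suc n))) (*-monoˡ-≤ 0≤y (AM-GM a b 0≤x 0≤y)) ⟩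
    fromℕ (suc n) ^ suc n * (s ^ n * y)
      ≤⟨ AM-GM-step n (+-nonNeg (*-nonNeg (fromℕ-nonNeg a) 0≤x) (*-nonNeg (fromℕ-nonNeg b) 0≤y)) 0≤y ⟩
    (s + y) ^ suc n * fromℕ n ^ n
      ≈⟨ *-congʳ (^-congˡ (suc n) (solve 3 (λ z b y → z :+ b :* y :+ y := z :+ (con (+ 1) :+ b) :* y) refl (fromℕ a * x) (fromℕ b) y)) ⟩
    (fromℕ a * x + fromℕ (suc b) * y) ^ suc n * fromℕ n ^ n ∎))
    where
    n = a ℕ.+ b
    s = fromℕ a * x + fromℕ b * y

  module _ {p q} (0≤p : 0# ≤ p) (0≤q : 0# ≤ q) (p+q≈1 : p + q ≈ 1#) where

    -- The inequality of means for a copies of bp and b copies of aq, whose sum is ab(p + q) = ab.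
    max-likelihood : ∀ a b .{{_ : NonZero a}} .{{_ : NonZero b}} →
      fromℕ (a ℕ.+ b) ^ (a ℕ.+ b) * (p ^ a * q ^ b) ≤ fromℕ a ^ a * fromℕ b ^ b
    max-likelihood a b = *-cancelʳ-≤ (*-pos (^-pos b (fromℕ-pos a)) (^-pos a (fromℕ-pos b))) (begin
      fromℕ n ^ n * (p ^ a * q ^ b) * (A ^ b * B ^ a)
        ≈⟨ solve 5 (λ c x y z w → c :* (x :* y) :* (z :* w) := c :* (w :* x :* (z :* y))) refl (fromℕ n ^ n) (p ^ a) (q ^ b) (A ^ b) (B ^ a) ⟩
      fromℕ n ^ n * (B ^ a * p ^ a * (A ^ b * q ^ b))
        ≈⟨ *-congˡ (*-cong (^-distrib-* B p a) (^-distrib-* A q b)) ⟨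
      fromℕ n ^ n * ((B * p) ^ a * (A * q) ^ b)
        ≤⟨ AM-GM a b (*-nonNeg (fromℕ-nonNeg b) 0≤p) (*-nonNeg (fromℕ-nonNeg a) 0≤q) ⟩
      (A * (B * p) + B * (A * q)) ^ n
        ≈⟨ ^-congˡ n (trans (solve 4 (λ a b p q → a :* (b :* p) :+ b :* (a :* q) := a :* b :* (p :+ q)) refl A B p q) (trans (*-congˡ p+q≈1) (*-identityʳ _))) ⟩
      (A * B) ^ n
        ≈⟨ ^-distrib-* A B n ⟩
      A ^ n * B ^ n
        ≈⟨ *-cong (^-homo-* A a b) (^-homo-* B a b) ⟩
      A ^ a * A ^ b * (B ^ a * B ^ b)
        ≈⟨ solve 4 (λ x y z w → x :* y :* (z :* w) := x :* w :* (y :* z)) refl (A ^ a) (A ^ b) (B ^ a) (B ^ b) ⟩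
      A ^ a * B ^ b * (A ^ b * B ^ a) ∎)
      where
      n = a ℕ.+ b
      A = fromℕ a
      B = fromℕ b

    -- The product p^a q^b is largest at p = a/(a+b), where `π-likelihood` applies; for a = 0 or b =
    -- 0 the left side is zero.
    density-bound : ∀ a b → π * (fromℕ 2 * (pmf p q (a ℕ.+ b) a * pmf p q (a ℕ.+ b) a) * (fromℕ a * fromℕ b)) ≤ fromℕ (a ℕ.+ b)
    density-bound zero b = ≤.trans (≤.reflexive (solve 3 (λ π x b → π :* (x :* (con (+ 0) :* b)) := con (+ 0)) refl π _ (fromℕ b))) (fromℕ-nonNeg b)
    density-bound a@(suc _) zero = ≤.trans (≤.reflexive (solve 3 (λ π x b → π :* (x :* (b :* con (+ 0))) := con (+ 0)) refl π _ (fromℕ a))) (fromℕ-nonNeg (a ℕ.+ 0))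
    density-bound a@(suc _) b@(suc _) = *-cancelʳ-≤ (*-pos n^n-pos n^n-pos) (begin
      π * (fromℕ 2 * (pmf p q n a * pmf p q n a) * (A * B)) * (nⁿ * nⁿ)
        ≈⟨ *-congʳ (*-congˡ (*-congʳ (*-congˡ (*-cong pmf≈ pmf≈)))) ⟩
      π * (fromℕ 2 * (c * g * (c * g)) * (A * B)) * (nⁿ * nⁿ)
        ≈⟨ solve 6 (λ π c g a b n → π :* (con (+ 2) :* (c :* g :* (c :* g)) :* (a :* b)) :* (n :* n) :=
             π :* (con (+ 2) :* (c :* c) :* (a :* b)) :* (n :* g :* (n :* g))) refl π c g A B nⁿ ⟩
      π * (fromℕ 2 * (c * c) * (A * B)) * (nⁿ * g * (nⁿ * g))
        ≤⟨ *-monoʳ-≤ (*-nonNeg (≤.trans 0≤1 1≤π) (*-nonNeg (*-nonNeg (fromℕ-nonNeg 2) (square-nonNeg c)) (*-nonNeg (fromℕ-nonNeg a) (fromℕ-nonNeg b))))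
             (square-mono-≤ (*-nonNeg (<⇒≤ n^n-pos) (*-nonNeg (^-nonNeg a 0≤p) (^-nonNeg b 0≤q))) (max-likelihood a b)) ⟩
      π * (fromℕ 2 * (c * c) * (A * B)) * (A ^ a * B ^ b * (A ^ a * B ^ b))
        ≈⟨ solve 6 (λ π c a b x y → π :* (con (+ 2) :* (c :* c) :* (a :* b)) :* (x :* y :* (x :* y)) :=
             π :* (con (+ 2) :* (c :* c :* (a :* (x :* x) :* (b :* (y :* y)))))) refl π c A B (A ^ a) (B ^ b) ⟩
      π * (fromℕ 2 * (c * c * (A * (A ^ a * A ^ a) * (B * (B ^ b * B ^ b)))))
        ≈⟨ *-congˡ (trans (fromℕ-* 2 (likelihood a b)) (*-congˡ (trans (fromℕ-* (k ℕ.* k) (odd-power a a ℕ.* odd-power b b))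
             (*-cong (fromℕ-* k k) (trans (fromℕ-* (odd-power a a) (odd-power b b)) (*-cong (fromℕ-odd-power a) (fromℕ-odd-power b))))))) ⟨
      π * fromℕ (2 ℕ.* likelihood a b)
        ≤⟨ π-likelihood a b ⟩
      fromℕ (odd-power n n)
        ≈⟨ fromℕ-odd-power n ⟩
      fromℕ n * (nⁿ * nⁿ) ∎)
      where
      n = a ℕ.+ b
      A = fromℕ a
      B = fromℕ b
      nⁿ = fromℕ n ^ n
      k = n C a
      c = fromℕ k
      g = p ^ a * q ^ b
      n^n-pos : 0# < nⁿ
      n^n-pos = ^-pos n (fromℕ-pos n)
      pmf≈ : pmf p q n a ≈ c * g
      pmf≈ = trans (*-assoc _ _ _) (*-congˡ (*-congˡ (reflexive (≡.cong (q ^_) (ℕ.m+n∸m≡n a b)))))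
      fromℕ-odd-power : ∀ m → fromℕ (odd-power m m) ≈ fromℕ m * (fromℕ m ^ m * fromℕ m ^ m)
      fromℕ-odd-power m = trans (fromℕ-* m (m ℕ.^ m ℕ.* m ℕ.^ m)) (*-congˡ (trans (fromℕ-* (m ℕ.^ m) (m ℕ.^ m)) (*-cong (fromℕ-^ m m) (fromℕ-^ m m))))

-- The lower bound for the binomial tail.

module Tail (ℝ : CompleteOrderedField) where
  open CompleteOrderedField ℝ
  open Reals ℝ
  open Field ℝ
  open Pi ℝ
  open RangeSum +-commutativeMonoid
  open Binomial ℝ
  open Median ℝ
  open Density ℝ
  open import Data.Bool.Base using (if_then_else_)
  open import Data.Integer.Base using (+_)
  open import Data.Nat.Base as ℕ using (ℕ; zero; suc; z≤n; s≤s; _∸_)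
  import Data.Nat.Properties as ℕ
  open import Data.Product.Base using (∃; _×_; _,_)
  open import Relation.Nullary using (¬_; Dec; does; yes; no; contradiction)
  import Relation.Binary.PropositionalEquality as ≡

  tail-probability : Carrier → Carrier → ℕ → Carrier → Carrier
  tail-probability p q m t = Σ< (suc m) (λ j → if does (t ≤? fromℕ j) then pmf p q m j else 0#)

  if-nonNeg : {P : Set} (P? : Dec P) → ∀ {x} → 0# ≤ x → 0# ≤ (if does P? then x else 0#)
  if-nonNeg (yes _) 0≤x = 0≤x
  if-nonNeg (no  _) _   = ≤.refl

  -- A term below the threshold is missing from the tail sum and is paid for with b.
  split-if : {P : Set} (P? : Dec P) → ∀ {x b} → (¬ P → x ≤ b) → x ≤ (if does P? then x else 0#) + b * (if does P? then 0# else 1#)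
  split-if (yes _) {x} {b} _   = ≤.reflexive (solve 2 (λ x b → x := x :+ b :* con (+ 0)) refl x b)
  split-if (no ¬P) {x} {b} x≤b = ≤.trans (x≤b ¬P) (≤.reflexive (solve 1 (λ b → b := con (+ 0) :+ b :* con (+ 1)) refl b))

  if-yes : {P : Set} (P? : Dec P) → P → (if does P? then 0# else 1#) ≈ 0#
  if-yes (yes _) _ = refl
  if-yes (no ¬p) p = contradiction p ¬p

  if-no : {P : Set} (P? : Dec P) → ¬ P → (if does P? then 0# else 1#) ≈ 1#
  if-no (yes p) ¬p = contradiction p ¬p
  if-no (no _) _ = refl

  -- Each counted integer k + i + 1 lies below t and owns the unit interval to its left, which is
  -- contained in [k, t].
  count-below : ∀ n k t → fromℕ k ≤ t → Σ< n (λ i → if does (t ≤? fromℕ (k ℕ.+ suc i)) then 0# else 1#) ≤ t - fromℕ k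
  count-below zero    k t k≤t = ≤.trans (≤.reflexive (Σ<-zero 0 (λ _ ()))) (≤⇒0≤- k≤t)
  count-below (suc n) k t k≤t with t ≤? fromℕ (suc k)
  ... | yes t≤k+1 = ≤.trans (≤.reflexive (Σ<-zero (suc n) (λ i _ → if-yes (t ≤? fromℕ (k ℕ.+ suc i))
          (≤.trans t≤k+1 (fromℕ-mono-≤ {suc k} (≡.subst (suc k ℕ.≤_) (≡.sym (ℕ.+-suc k i)) (s≤s (ℕ.m≤m+n k i)))))))) (≤⇒0≤- k≤t)
  ... | no  t≰k+1 = begin
    Σ< (suc n) (λ i → if does (t ≤? fromℕ (k ℕ.+ suc i)) then 0# else 1#)
      ≈⟨ reflexive (Σ<-first n _) ⟩
    (if does (t ≤? fromℕ (k ℕ.+ 1)) then 0# else 1#) + Σ< n (λ i → if does (t ≤? fromℕ (k ℕ.+ suc (suc i))) then 0# else 1#)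
      ≈⟨ +-cong (if-no (t ≤? fromℕ (k ℕ.+ 1)) (λ t≤ → t≰k+1 (≤.trans t≤ (≤.reflexive (fromℕ-cong (ℕ.+-comm k 1))))))
                (Σ<-cong n (λ i _ → reflexive (≡.cong (λ j → if does (t ≤? fromℕ j) then 0# else 1#) (ℕ.+-suc k (suc i))))) ⟩
    1# + Σ< n (λ i → if does (t ≤? fromℕ (suc k ℕ.+ suc i)) then 0# else 1#)
      ≤⟨ +-monoʳ-≤ 1# (count-below n (suc k) t (≰⇒≥ t≰k+1)) ⟩
    1# + (t - (1# + fromℕ k))
      ≈⟨ solve 2 (λ t k → con (+ 1) :+ (t :- (con (+ 1) :+ k)) := t :- k) refl t (fromℕ k) ⟩
    t - fromℕ k ∎

  -- A downward search from n. The offset by one puts k a full unit below x, as the comparison of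
  -- the tails requires.
  floor : ∀ n {x} → fromℕ 1 ≤ x → x ≤ fromℕ (suc n) → ∃ λ k → k ℕ.≤ n × fromℕ (suc k) ≤ x × x ≤ fromℕ (2 ℕ.+ k)
  floor zero    1≤x x≤ = 0 , z≤n , 1≤x , ≤.trans x≤ (fromℕ-mono-≤ {1} {2} (s≤s z≤n))
  floor (suc n) {x} 1≤x x≤ with fromℕ (suc n) ≤? x
  ... | yes n≤x = n , ℕ.n≤1+n n , n≤x , x≤
  ... | no  n≰x with floor n 1≤x (≰⇒≥ n≰x)
  ...   | k , k≤n , h = k , ℕ.m≤n⇒m≤1+n k≤n , h

  module _ {p q} (0<p : 0# < p) (0<q : 0# < q) (p+q≈1 : p + q ≈ 1#) where

    module NearMean (a b : ℕ) {σ s : Carrier} (5≤σ : fromℕ 5 ≤ σ) (0≤s : 0# ≤ s)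
                    (σ² : σ * σ ≈ fromℕ (a ℕ.+ b) * p * q) (s² : s * s ≈ fromℕ 2 * π * fromℕ (a ℕ.+ b) * p * q)
                    (below : fromℕ (a ℕ.+ b) * p ≤ fromℕ a + fromℕ 2 * σ)
                    (above : fromℕ a ≤ fromℕ (a ℕ.+ b) * p + fromℕ 2 * σ) where
      private
        A = fromℕ a
        B = fromℕ b
        M = fromℕ (a ℕ.+ b)
        u = σ - fromℕ 5
        0≤u : 0# ≤ u
        0≤u = ≤⇒0≤- 5≤σ
        0≤σ : 0# ≤ σ
        0≤σ = ≤.trans (fromℕ-nonNeg 5) 5≤σ
        D = σ * σ - fromℕ 2 * σ - 1#
        f = pmf p q (a ℕ.+ b) a
        0≤f : 0# ≤ f
        0≤f = pmf-nonNeg (<⇒≤ 0<p) (<⇒≤ 0<q) (a ℕ.+ b) a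
        w = f * s

        0<D : 0# < D
        0<D = begin-strict
          0#                                      <⟨ fromℕ-pos 14 ⟩
          fromℕ 14                                ≤⟨ ≤-by (fromℕ 8 * u + u * u) (+-nonNeg (*-nonNeg (fromℕ-nonNeg 8) 0≤u) (square-nonNeg u)) refl ⟩
          fromℕ 14 + (fromℕ 8 * u + u * u)        ≈⟨ solve 1 (λ σ → con (+ 14) :+ (con (+ 8) :* (σ :- con (+ 5)) :+ (σ :- con (+ 5)) :* (σ :- con (+ 5))) := σ :* σ :- con (+ 2) :* σ :- con (+ 1)) refl σ ⟩
          D                                       ∎

        lo hi : Carrier
        lo = A + fromℕ 2 * σ - M * p
        hi = M * p + fromℕ 2 * σ - A

        -- With δ = a - mp the product ab is mσ² + mδ(q - p) - δ². Since |δ| ≤ 2σ, the middle term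
        -- costs at most 2σm and the last one at most 4σ² ≤ m.
        MD≤AB : M * D ≤ A * B
        MD≤AB = ≤-by (M * (p * hi + q * lo) + lo * hi + M * ((p - q) * (p - q)))
          (+-nonNeg (+-nonNeg (*-nonNeg (fromℕ-nonNeg (a ℕ.+ b)) (+-nonNeg (*-nonNeg (<⇒≤ 0<p) (≤⇒0≤- above)) (*-nonNeg (<⇒≤ 0<q) (≤⇒0≤- below))))
            (*-nonNeg (≤⇒0≤- below) (≤⇒0≤- above))) (*-nonNeg (fromℕ-nonNeg (a ℕ.+ b)) (square-nonNeg (p - q))))
          (begin-equality
            A * B
              ≈⟨ *-congˡ (trans (solve 2 (λ a b → b := a :+ b :- a) refl A B) (+-congʳ (sym (fromℕ-+ a b)))) ⟩
            A * (M - A)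
              ≈⟨ solve 4 (λ a m p s → a :* (m :- a) :=
                   m :* (s :* s :- con (+ 2) :* s :- con (+ 1)) :+ (m :* (p :* (m :* p :+ con (+ 2) :* s :- a) :+ (con (+ 1) :- p) :* (a :+ con (+ 2) :* s :- m :* p))
                     :+ (a :+ con (+ 2) :* s :- m :* p) :* (m :* p :+ con (+ 2) :* s :- a)
                     :+ m :* ((p :- (con (+ 1) :- p)) :* (p :- (con (+ 1) :- p))))
                     -- Collects the two places where σ² is replaced by mpq: once multiplied by m
                     -- and once by 4.
                     :+ (m :+ con (+ 4)) :* (m :* p :* (con (+ 1) :- p) :- s :* s)) refl A M p σ ⟩
            M * D + (M * (p * hi + (1# - p) * lo) + lo * hi + M * ((p - (1# - p)) * (p - (1# - p)))) + (M + fromℕ 4) * (M * p * (1# - p) - σ * σ)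
              ≈⟨ +-cong (+-congˡ (+-cong (+-congʳ (*-congˡ (+-congˡ (*-congʳ q≈)))) (*-congˡ (*-cong (+-congˡ (-‿cong q≈)) (+-congˡ (-‿cong q≈))))))
                        (trans (*-congˡ (trans (+-congʳ (trans (*-congˡ q≈) (sym σ²))) (-‿inverseʳ _))) (zeroʳ _)) ⟩
            M * D + (M * (p * hi + q * lo) + lo * hi + M * ((p - q) * (p - q))) + 0#
              ≈⟨ +-identityʳ _ ⟩
            M * D + (M * (p * hi + q * lo) + lo * hi + M * ((p - q) * (p - q))) ∎)
          where
          q≈ : 1# - p ≈ q
          q≈ = trans (+-congʳ (sym p+q≈1)) (solve 2 (λ p q → p :+ q :- p := q) refl p q)

        0<M : 0# < M
        0<M = fromℕ-nonNeg (a ℕ.+ b) , λ 0≈M → <⇒≱ (*-pos (<-≤ 0<5 5≤σ) (<-≤ 0<5 5≤σ))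
          (≤.reflexive (trans σ² (trans (*-congʳ (*-congʳ (sym 0≈M))) (solve 2 (λ p q → con (+ 0) :* p :* q := con (+ 0)) refl p q))))
          where
          0<5 : 0# < fromℕ 5
          0<5 = fromℕ-pos 5
          <-≤ : ∀ {x y z} → x < y → y ≤ z → x < z
          <-≤ {x} {y} {z} x<y y≤z = begin-strict x <⟨ x<y ⟩ y ≤⟨ y≤z ⟩ z ∎

        w²D≤σ² : w * w * D ≤ σ * σ
        w²D≤σ² = *-cancelˡ-≤ 0<M (begin
          M * (f * s * (f * s) * D)
            ≈⟨ solve 4 (λ m f s d → m :* (f :* s :* (f :* s) :* d) := s :* s :* (f :* f) :* (m :* d)) refl M f s D ⟩
          s * s * (f * f) * (M * D)
            ≤⟨ *-monoʳ-≤ (*-nonNeg (square-nonNeg s) (square-nonNeg f)) MD≤AB ⟩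
          s * s * (f * f) * (A * B)
            ≈⟨ *-congʳ (*-congʳ s²) ⟩
          fromℕ 2 * π * M * p * q * (f * f) * (A * B)
            ≈⟨ solve 7 (λ π m p q f a b → con (+ 2) :* π :* m :* p :* q :* (f :* f) :* (a :* b) := m :* p :* q :* (π :* (con (+ 2) :* (f :* f) :* (a :* b)))) refl π M p q f A B ⟩
          M * p * q * (π * (fromℕ 2 * (f * f) * (A * B)))
            ≤⟨ *-monoʳ-≤ (*-nonNeg (*-nonNeg (fromℕ-nonNeg (a ℕ.+ b)) (<⇒≤ 0<p)) (<⇒≤ 0<q)) (density-bound (<⇒≤ 0<p) (<⇒≤ 0<q) p+q≈1 a b) ⟩
          M * p * q * M
            ≈⟨ trans (*-congʳ (sym σ²)) (*-comm _ _) ⟩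
          M * (σ * σ) ∎)

      -- As w²D ≤ σ², it is enough that σ⁴ ≤ (σ+2)² D. The difference 2σ³ - 5σ² - 12σ - 4 is
      -- expanded at σ = 5 + u, where all coefficients are positive.
      pmf-near-mean : f * (s * σ) ≤ σ + fromℕ 2
      pmf-near-mean = square-cancel-≤ (+-nonNeg 0≤σ (fromℕ-nonNeg 2)) (*-cancelʳ-≤ 0<D (begin
        f * (s * σ) * (f * (s * σ)) * D
          ≈⟨ solve 4 (λ f s σ d → f :* (s :* σ) :* (f :* (s :* σ)) :* d := σ :* σ :* (f :* s :* (f :* s) :* d)) refl f s σ D ⟩
        σ * σ * (w * w * D)
          ≤⟨ *-monoʳ-≤ (square-nonNeg σ) w²D≤σ² ⟩
        σ * σ * (σ * σ)
          ≤⟨ ≤-by (fromℕ 61 + (fromℕ 88 * u + fromℕ 25 * (u * u) + fromℕ 2 * (u * (u * u))))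
               (+-nonNeg (fromℕ-nonNeg 61) (+-nonNeg (+-nonNeg (*-nonNeg (fromℕ-nonNeg 88) 0≤u) (*-nonNeg (fromℕ-nonNeg 25) (square-nonNeg u))) (*-nonNeg (fromℕ-nonNeg 2) (*-nonNeg 0≤u (square-nonNeg u)))))
               (solve 1 (λ σ → (σ :+ con (+ 2)) :* (σ :+ con (+ 2)) :* (σ :* σ :- con (+ 2) :* σ :- con (+ 1)) :=
                 σ :* σ :* (σ :* σ) :+ (con (+ 61) :+ (con (+ 88) :* (σ :- con (+ 5)) :+ con (+ 25) :* ((σ :- con (+ 5)) :* (σ :- con (+ 5))) :+ con (+ 2) :* ((σ :- con (+ 5)) :* ((σ :- con (+ 5)) :* (σ :- con (+ 5))))))) refl σ) ⟩
        (σ + fromℕ 2) * (σ + fromℕ 2) * D ∎))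

    module _ (k l : ℕ) {σ s t Δ : Carrier} (10≤σ : fromℕ 10 ≤ σ) (0≤s : 0# ≤ s) (0<sσ : 0# < s * σ)
             (σ² : σ * σ ≈ fromℕ (k ℕ.+ l) * p * q) (s² : s * s ≈ fromℕ 2 * π * fromℕ (k ℕ.+ l) * p * q)
             (k+1≤mean : fromℕ (suc k) ≤ fromℕ (k ℕ.+ l) * p) (mean≤k+2 : fromℕ (k ℕ.+ l) * p ≤ fromℕ (2 ℕ.+ k))
             (t≈ : t ≈ fromℕ (k ℕ.+ l) * p + Δ) (0≤Δ : 0# ≤ Δ) (Δ≤2σ : Δ ≤ fromℕ 2 * σ) where
      private
        m = k ℕ.+ l
        κ = fromℕ k
        mean = fromℕ m * p
        B = (σ + fromℕ 2) / (s * σ)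
        0≤σ : 0# ≤ σ
        0≤σ = ≤.trans (fromℕ-nonNeg 10) 10≤σ
        0≤B : 0# ≤ B
        0≤B = /-nonNeg (+-nonNeg 0≤σ (fromℕ-nonNeg 2)) 0<sσ

        -- From k on, a is at most 2 ≤ 2σ below the mean, and above the mean it deviates by at most
        -- Δ ≤ 2σ.
        pmf≤B : ∀ {a} → k ℕ.≤ a → a ℕ.≤ m → fromℕ a ≤ mean + Δ → pmf p q m a ≤ B
        pmf≤B {a} k≤a a≤m a≤ = /-lower 0<sσ (≡.subst (λ n → pmf p q n a * (s * σ) ≤ σ + fromℕ 2) a+b≡m
          (NearMean.pmf-near-mean a (m ∸ a) (≤.trans (fromℕ-mono-≤ {5} {10} (ℕ.m≤m+n 5 5)) 10≤σ) 0≤s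
            (≡.subst (λ n → σ * σ ≈ fromℕ n * p * q) (≡.sym a+b≡m) σ²)
            (≡.subst (λ n → s * s ≈ fromℕ 2 * π * fromℕ n * p * q) (≡.sym a+b≡m) s²)
            (≡.subst (λ n → fromℕ n * p ≤ fromℕ a + fromℕ 2 * σ) (≡.sym a+b≡m) (begin
              mean                    ≤⟨ mean≤k+2 ⟩
              1# + (1# + κ)           ≈⟨ solve 1 (λ k → con (+ 1) :+ (con (+ 1) :+ k) := k :+ con (+ 2)) refl κ ⟩
              κ + fromℕ 2             ≤⟨ +-mono-≤ (fromℕ-mono-≤ k≤a) (≤-by (fromℕ 2 * (σ - fromℕ 10) + fromℕ 18)
                                           (+-nonNeg (*-nonNeg (fromℕ-nonNeg 2) (≤⇒0≤- 10≤σ)) (fromℕ-nonNeg 18))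
                                           (solve 1 (λ σ → con (+ 2) :* σ := con (+ 2) :+ (con (+ 2) :* (σ :- con (+ 10)) :+ con (+ 18))) refl σ)) ⟩
              fromℕ a + fromℕ 2 * σ   ∎))
            (≡.subst (λ n → fromℕ a ≤ fromℕ n * p + fromℕ 2 * σ) (≡.sym a+b≡m) (≤.trans a≤ (+-monoʳ-≤ mean Δ≤2σ)))))
          where
          a+b≡m : a ℕ.+ (m ∸ a) ≡.≡ m
          a+b≡m = ℕ.m+[n∸m]≡n a≤m

        upper≤ : Σ< l (λ i → pmf p q m (k ℕ.+ suc i)) ≤ tail-probability p q m t + B * (t - κ)
        upper≤ = begin
          Σ< l (λ i → pmf p q m (k ℕ.+ suc i))
            ≤⟨ Σ<-mono-≤ l (λ i i<l → split-if (t ≤? fromℕ (k ℕ.+ suc i)) (λ t≰ →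
                 pmf≤B (ℕ.m≤m+n k (suc i)) (ℕ.+-monoʳ-≤ k i<l) (≤.trans (≰⇒≥ t≰) (≤.reflexive t≈)))) ⟩
          Σ< l (λ i → (if does (t ≤? fromℕ (k ℕ.+ suc i)) then pmf p q m (k ℕ.+ suc i) else 0#)
                    + B * (if does (t ≤? fromℕ (k ℕ.+ suc i)) then 0# else 1#))
            ≈⟨ trans (Σ<-∙ l _ _) (+-cong (Σ<-cong l (λ i _ → reflexive (≡.cong F (ℕ.+-suc k i)))) (sym (*-Σ< l B _))) ⟩
          Σ< l (λ i → F (suc k ℕ.+ i)) + B * Σ< l (λ i → if does (t ≤? fromℕ (k ℕ.+ suc i)) then 0# else 1#)
            ≤⟨ +-mono-≤ (≤-by _ (Σ<-nonNeg (suc k) (λ j _ → if-nonNeg (t ≤? fromℕ j) (pmf-nonNeg (<⇒≤ 0<p) (<⇒≤ 0<q) m j)))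
                           (trans (Σ<-split (suc k) l F) (+-comm _ _)))
                 (*-monoʳ-≤ 0≤B (count-below l k t κ≤t)) ⟩
          tail-probability p q m t + B * (t - κ) ∎
          where
          F : ℕ → Carrier
          F j = if does (t ≤? fromℕ j) then pmf p q m j else 0#
          κ≤t : κ ≤ t
          κ≤t = begin
            κ               ≤⟨ fromℕ-mono-≤ (ℕ.n≤1+n k) ⟩
            fromℕ (suc k)   ≤⟨ k+1≤mean ⟩
            mean            ≤⟨ ≤-by Δ 0≤Δ refl ⟩
            mean + Δ        ≈⟨ t≈ ⟨
            t               ∎

      -- The upper tail enters twice and loses at most t - k ≤ Δ + 2 times B; the density at k costs
      -- one more B. In total 2(Δ+2) + 1.
      tail-core : 1# ≤ tail-probability p q m t * fromℕ 2 + (fromℕ 2 * Δ + fromℕ 5) * ((σ + fromℕ 2) / (s * σ))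
      tail-core = begin
        1#
          ≤⟨ upper-tail 0<p 0<q p+q≈1 k l k+1≤mean ⟩
        Σ< l (λ i → pmf p q m (k ℕ.+ suc i)) * fromℕ 2 + pmf p q m k
          ≤⟨ +-mono-≤ (*-monoˡ-≤ (fromℕ-nonNeg 2) upper≤) (pmf≤B ℕ.≤-refl (ℕ.m≤m+n k l)
               (≤-by (1# + (mean - fromℕ (suc k)) + Δ) (+-nonNeg (+-nonNeg 0≤1 (≤⇒0≤- k+1≤mean)) 0≤Δ)
                 (solve 3 (λ k m d → m :+ d := k :+ (con (+ 1) :+ (m :- (con (+ 1) :+ k)) :+ d)) refl κ mean Δ))) ⟩
        (tail-probability p q m t + B * (t - κ)) * fromℕ 2 + B
          ≤⟨ ≤-by (fromℕ 2 * (B * (fromℕ (2 ℕ.+ k) - mean))) (*-nonNeg (fromℕ-nonNeg 2) (*-nonNeg 0≤B (≤⇒0≤- mean≤k+2))) (begin-equality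
               T * fromℕ 2 + (fromℕ 2 * Δ + fromℕ 5) * B
                 ≈⟨ solve 5 (λ T d b k m → T :* con (+ 2) :+ (con (+ 2) :* d :+ con (+ 5)) :* b :=
                      (T :+ b :* (m :+ d :- k)) :* con (+ 2) :+ b :+ con (+ 2) :* (b :* ((con (+ 1) :+ (con (+ 1) :+ k)) :- m))) refl T Δ B κ mean ⟩
               (T + B * (mean + Δ - κ)) * fromℕ 2 + B + fromℕ 2 * (B * (fromℕ (2 ℕ.+ k) - mean))
                 ≈⟨ +-congʳ (+-congʳ (*-congʳ (+-congˡ (*-congˡ (+-congʳ (sym t≈)))))) ⟩
               (T + B * (t - κ)) * fromℕ 2 + B + fromℕ 2 * (B * (fromℕ (2 ℕ.+ k) - mean)) ∎) ⟩
        T * fromℕ 2 + (fromℕ 2 * Δ + fromℕ 5) * B ∎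
        where T = tail-probability p q m t

    tail-lower-bound : ∀ n d → d ℕ.< n → let m = n ∸ d in
      1# / fromℕ 2 - (fromℕ d * p) / √ (fromℕ 2 * π * fromℕ m * p * q)
                   - (fromℕ 10 * (1# - fromℕ 2 * p * q)) / √ (fromℕ m * p * q)
      ≤ tail-probability p q m (fromℕ n * p)
    tail-lower-bound n d d<n with 1# / fromℕ 2 - (fromℕ d * p) / √ (fromℕ 2 * π * fromℕ (n ∸ d) * p * q)
                   - (fromℕ 10 * (1# - fromℕ 2 * p * q)) / √ (fromℕ (n ∸ d) * p * q) ≤? 0#
    ... | yes x≤0 = ≤.trans x≤0 (Σ<-nonNeg (suc (n ∸ d)) (λ j _ →
            if-nonNeg (fromℕ n * p ≤? fromℕ j) (pmf-nonNeg (<⇒≤ 0<p) (<⇒≤ 0<q) (n ∸ d) j)))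
    ... | no  x≰0 = *-cancelʳ-≤ (*-pos 0<2 0<sσ) (begin
      (h - α - β) * (fromℕ 2 * (s * σ))
        ≈⟨ solve 4 (λ h a b x → (h :- a :- b) :* (con (+ 2) :* x) := h :* con (+ 2) :* x :- con (+ 2) :* (a :+ b) :* x) refl h α β (s * σ) ⟩
      h * fromℕ 2 * (s * σ) - fromℕ 2 * (α + β) * (s * σ)
        ≈⟨ +-congʳ (*-congʳ h2≈1) ⟩
      1# * (s * σ) - fromℕ 2 * (α + β) * (s * σ)
        ≤⟨ +-monoˡ-≤ _ (*-monoˡ-≤ (<⇒≤ 0<sσ) core) ⟩
      (T * fromℕ 2 + (fromℕ 2 * Δ + fromℕ 5) * B) * (s * σ) - fromℕ 2 * (α + β) * (s * σ)
        ≈⟨ solve 6 (λ T d b x a c → (T :* con (+ 2) :+ (con (+ 2) :* d :+ con (+ 5)) :* b) :* x :- con (+ 2) :* (a :+ c) :* x :=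
             T :* (con (+ 2) :* x) :+ (con (+ 2) :* d :+ con (+ 5)) :* (b :* x) :- con (+ 2) :* (a :+ c) :* x) refl T Δ B (s * σ) α β ⟩
      T * (fromℕ 2 * (s * σ)) + (fromℕ 2 * Δ + fromℕ 5) * (B * (s * σ)) - fromℕ 2 * (α + β) * (s * σ)
        ≈⟨ +-congʳ (+-congˡ (*-cong (+-congʳ (*-congˡ (sym αs≈Δ))) (/-*-cancel 0<sσ))) ⟩
      T * (fromℕ 2 * (s * σ)) + (fromℕ 2 * (α * s) + fromℕ 5) * (σ + fromℕ 2) - fromℕ 2 * (α + β) * (s * σ)
        -- After cancelling 2αsσ the cost is 4αs + 5σ + 10 ≤ 2s + 5s + s, while 2βsσ ≥ 10s is
        -- available. This is where c = 10 suffices.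
        ≤⟨ ≤-by (fromℕ 2 * s * (β * σ - fromℕ 5) + fromℕ 2 * s * (1# - fromℕ 2 * α) + fromℕ 5 * (s - σ) + (s - fromℕ 10) + fromℕ 2 * s)
             (+-nonNeg (+-nonNeg (+-nonNeg (+-nonNeg (*-nonNeg 0≤2s (≤⇒0≤- βσ≥5)) (*-nonNeg 0≤2s (≤⇒0≤- 2α≤1)))
               (*-nonNeg (fromℕ-nonNeg 5) (≤⇒0≤- σ≤s))) (≤⇒0≤- (≤.trans 10≤σ σ≤s))) 0≤2s)
             (solve 5 (λ T a b s x → T :* (con (+ 2) :* (s :* x)) :=
               T :* (con (+ 2) :* (s :* x)) :+ (con (+ 2) :* (a :* s) :+ con (+ 5)) :* (x :+ con (+ 2)) :- con (+ 2) :* (a :+ b) :* (s :* x)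
               :+ (con (+ 2) :* s :* (b :* x :- con (+ 5)) :+ con (+ 2) :* s :* (con (+ 1) :- con (+ 2) :* a) :+ con (+ 5) :* (s :- x) :+ (s :- con (+ 10)) :+ con (+ 2) :* s))
               refl T α β s σ) ⟩
      T * (fromℕ 2 * (s * σ)) ∎)
      where
      m = n ∸ d
      M = fromℕ m
      Y = M * p * q
      X = fromℕ 2 * π * M * p * q
      σ = √ Y
      s = √ X
      t = fromℕ n * p
      Δ = fromℕ d * p
      h = 1# / fromℕ 2
      α = Δ / s
      γ = fromℕ 10 * (1# - fromℕ 2 * p * q)
      β = γ / σ
      B = (σ + fromℕ 2) / (s * σ)
      T = tail-probability p q m t
      0<2 : 0# < fromℕ 2
      0<2 = fromℕ-pos 2
      0<M : 0# < M
      0<M = fromℕ-pos m {{ℕ.>-nonZero (ℕ.m<n⇒0<n∸m d<n)}}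
      0<Y : 0# < Y
      0<Y = *-pos (*-pos 0<M 0<p) 0<q
      0<π : 0# < π
      0<π = begin-strict 0# <⟨ 0<1 ⟩ 1# ≤⟨ 1≤π ⟩ π ∎
      X≈ : X ≈ fromℕ 2 * π * Y
      X≈ = solve 4 (λ π m p q → con (+ 2) :* π :* m :* p :* q := con (+ 2) :* π :* (m :* p :* q)) refl π M p q
      0<X : 0# < X
      0<X = *-pos (*-pos (*-pos (*-pos 0<2 0<π) 0<M) 0<p) 0<q
      0<σ : 0# < σ
      0<σ = √-pos 0<Y
      0<s : 0# < s
      0<s = √-pos 0<X
      0<sσ : 0# < s * σ
      0<sσ = *-pos 0<s 0<σ
      σ² : σ * σ ≈ Y
      σ² = √-square (<⇒≤ 0<Y)
      s² : s * s ≈ X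
      s² = √-square (<⇒≤ 0<X)
      h2≈1 : h * fromℕ 2 ≈ 1#
      h2≈1 = /-*-cancel 0<2
      αs≈Δ : α * s ≈ Δ
      αs≈Δ = /-*-cancel 0<s
      0≤Δ : 0# ≤ Δ
      0≤Δ = *-nonNeg (fromℕ-nonNeg d) (<⇒≤ 0<p)
      0≤α : 0# ≤ α
      0≤α = /-nonNeg 0≤Δ 0<s
      -- For p + q = 1 the factor 1 - 2pq equals (1 + (p - q)²)/2.
      5≤γ : fromℕ 5 ≤ γ
      5≤γ = ≤-by (fromℕ 5 * ((p - q) * (p - q))) (*-nonNeg (fromℕ-nonNeg 5) (square-nonNeg (p - q))) (begin-equality
        fromℕ 10 * (1# - fromℕ 2 * p * q)
          ≈⟨ solve 2 (λ p q → con (+ 10) :* (con (+ 1) :- con (+ 2) :* p :* q) :=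
               con (+ 5) :+ con (+ 5) :* ((p :- q) :* (p :- q)) :+ con (+ 5) :* (con (+ 1) :- (p :+ q) :* (p :+ q))) refl p q ⟩
        fromℕ 5 + fromℕ 5 * ((p - q) * (p - q)) + fromℕ 5 * (1# - (p + q) * (p + q))
          ≈⟨ +-congˡ (*-congˡ (+-congˡ (-‿cong (*-cong p+q≈1 p+q≈1)))) ⟩
        fromℕ 5 + fromℕ 5 * ((p - q) * (p - q)) + fromℕ 5 * (1# - 1# * 1#)
          ≈⟨ solve 1 (λ x → x :+ con (+ 5) :* (con (+ 1) :- con (+ 1) :* con (+ 1)) := x) refl _ ⟩
        fromℕ 5 + fromℕ 5 * ((p - q) * (p - q)) ∎)
      0≤β : 0# ≤ β
      0≤β = /-nonNeg (≤.trans (fromℕ-nonNeg 5) 5≤γ) 0<σ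
      βσ≥5 : fromℕ 5 ≤ β * σ
      βσ≥5 = ≤.trans 5≤γ (≤.reflexive (sym (/-*-cancel 0<σ)))
      2[α+β]≤1 : fromℕ 2 * (α + β) ≤ 1#
      2[α+β]≤1 = begin
        fromℕ 2 * (α + β)
          ≤⟨ ≤-by (fromℕ 2 * (h - α - β)) (*-nonNeg (<⇒≤ 0<2) (≰⇒≥ x≰0))
               (solve 3 (λ h a b → h :* con (+ 2) := con (+ 2) :* (a :+ b) :+ con (+ 2) :* (h :- a :- b)) refl h α β) ⟩
        h * fromℕ 2         ≈⟨ h2≈1 ⟩
        1#                  ∎
      2α≤1 : fromℕ 2 * α ≤ 1#
      2α≤1 = ≤.trans (*-monoʳ-≤ (<⇒≤ 0<2) (≤-by β 0≤β refl)) 2[α+β]≤1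
      2β≤1 : fromℕ 2 * β ≤ 1#
      2β≤1 = ≤.trans (*-monoʳ-≤ (<⇒≤ 0<2) (≤-by α 0≤α (+-comm α β))) 2[α+β]≤1
      0≤2s : 0# ≤ fromℕ 2 * s
      0≤2s = *-nonNeg (<⇒≤ 0<2) (<⇒≤ 0<s)
      10≤σ : fromℕ 10 ≤ σ
      10≤σ = begin
        fromℕ 10            ≈⟨ fromℕ-* 2 5 ⟩
        fromℕ 2 * fromℕ 5   ≤⟨ *-monoʳ-≤ (<⇒≤ 0<2) βσ≥5 ⟩
        fromℕ 2 * (β * σ)   ≈⟨ *-assoc _ _ _ ⟨
        fromℕ 2 * β * σ     ≤⟨ *-monoˡ-≤ (<⇒≤ 0<σ) 2β≤1 ⟩
        1# * σ              ≈⟨ *-identityˡ σ ⟩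
        σ                   ∎
      σ≤s : σ ≤ s
      σ≤s = square-cancel-≤ (<⇒≤ 0<s) (begin
        σ * σ           ≈⟨ σ² ⟩
        Y               ≤⟨ ≤-by ((π - 1# + π) * Y) (*-nonNeg (+-nonNeg (≤⇒0≤- 1≤π) (<⇒≤ 0<π)) (<⇒≤ 0<Y))
                             (solve 2 (λ π y → con (+ 2) :* π :* y := y :+ (π :- con (+ 1) :+ π) :* y) refl π Y) ⟩
        fromℕ 2 * π * Y ≈⟨ trans s² X≈ ⟨
        s * s           ∎)
      -- From 2π ≤ 8 ≤ 9.
      s≤3σ : s ≤ fromℕ 3 * σ
      s≤3σ = square-cancel-≤ (*-nonNeg (fromℕ-nonNeg 3) (<⇒≤ 0<σ)) (begin
        s * s                       ≈⟨ trans s² X≈ ⟩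
        fromℕ 2 * π * Y             ≤⟨ ≤-by ((fromℕ 2 * (fromℕ 4 - π) + 1#) * Y) (*-nonNeg (+-nonNeg (*-nonNeg (<⇒≤ 0<2) (≤⇒0≤- π≤4)) 0≤1) (<⇒≤ 0<Y))
                                         (solve 2 (λ π y → con (+ 9) :* y := con (+ 2) :* π :* y :+ (con (+ 2) :* (con (+ 4) :- π) :+ con (+ 1)) :* y) refl π Y) ⟩
        fromℕ 9 * Y                 ≈⟨ *-congˡ σ² ⟨
        fromℕ 9 * (σ * σ)           ≈⟨ solve 1 (λ σ → con (+ 9) :* (σ :* σ) := con (+ 3) :* σ :* (con (+ 3) :* σ)) refl σ ⟩
        fromℕ 3 * σ * (fromℕ 3 * σ) ∎)
      Δ≤2σ : Δ ≤ fromℕ 2 * σ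
      Δ≤2σ = *-cancelˡ-≤ 0<2 (begin
        fromℕ 2 * Δ               ≈⟨ *-congˡ αs≈Δ ⟨
        fromℕ 2 * (α * s)         ≈⟨ *-assoc _ _ _ ⟨
        fromℕ 2 * α * s           ≤⟨ *-monoˡ-≤ (<⇒≤ 0<s) 2α≤1 ⟩
        1# * s                    ≈⟨ *-identityˡ s ⟩
        s                         ≤⟨ s≤3σ ⟩
        fromℕ 3 * σ               ≤⟨ ≤-by σ (<⇒≤ 0<σ) (solve 1 (λ σ → con (+ 2) :* (con (+ 2) :* σ) := con (+ 3) :* σ :+ σ) refl σ) ⟩
        fromℕ 2 * (fromℕ 2 * σ)   ∎)
      t≈ : t ≈ M * p + Δ
      t≈ = begin-equality
        fromℕ n * p                 ≈⟨ *-congʳ (fromℕ-cong (ℕ.m∸n+n≡m (ℕ.<⇒≤ d<n))) ⟨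
        fromℕ (m ℕ.+ d) * p         ≈⟨ *-congʳ (fromℕ-+ m d) ⟩
        (M + fromℕ d) * p           ≈⟨ distribʳ p M (fromℕ d) ⟩
        M * p + Δ                   ∎
      x≤1 : ∀ {x y} → 0# ≤ y → x + y ≈ 1# → x ≤ 1#
      x≤1 {y = y} 0≤y x+y≈1 = ≤-by y 0≤y (sym x+y≈1)
      -- Ensures that ⌊mp⌋ - 1 is a natural number; mp is at least σ².
      1≤mean : fromℕ 1 ≤ M * p
      1≤mean = begin
        fromℕ 1               ≈⟨ fromℕ-* 1 1 ⟩
        fromℕ 1 * fromℕ 1     ≤⟨ square-mono-≤ (fromℕ-nonNeg 1) (≤.trans (fromℕ-mono-≤ {1} {10} (s≤s z≤n)) 10≤σ) ⟩
        σ * σ                 ≈⟨ σ² ⟩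
        M * p * q             ≤⟨ *-monoʳ-≤ (<⇒≤ (*-pos 0<M 0<p)) (x≤1 (<⇒≤ 0<p) (trans (+-comm q p) p+q≈1)) ⟩
        M * p * 1#            ≈⟨ *-identityʳ _ ⟩
        M * p                 ∎
      mean≤ : M * p ≤ fromℕ (suc m)
      mean≤ = begin
        M * p         ≤⟨ *-monoʳ-≤ (<⇒≤ 0<M) (x≤1 (<⇒≤ 0<q) p+q≈1) ⟩
        M * 1#        ≈⟨ *-identityʳ M ⟩
        M             ≤⟨ fromℕ-mono-≤ (ℕ.n≤1+n m) ⟩
        fromℕ (suc m) ∎
      core : 1# ≤ T * fromℕ 2 + (fromℕ 2 * Δ + fromℕ 5) * B
      core =
        let k , k≤m , k+1≤ , ≤k+2 = floor m 1≤mean mean≤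
            shift : (P : ℕ → Set) → P m → P (k ℕ.+ (m ∸ k))
            shift P = ≡.subst P (≡.sym (ℕ.m+[n∸m]≡n k≤m))
        in
        ≡.subst (λ j → 1# ≤ tail-probability p q j t * fromℕ 2 + (fromℕ 2 * Δ + fromℕ 5) * B) (ℕ.m+[n∸m]≡n k≤m)
          (tail-core k (m ∸ k) 10≤σ (<⇒≤ 0<s) 0<sσ
            (shift (λ j → σ * σ ≈ fromℕ j * p * q) σ²) (shift (λ j → s * s ≈ fromℕ 2 * π * fromℕ j * p * q) s²)
            (shift (λ j → fromℕ (suc k) ≤ fromℕ j * p) k+1≤) (shift (λ j → fromℕ j * p ≤ fromℕ (2 ℕ.+ k)) ≤k+2)
            (shift (λ j → t ≈ fromℕ j * p + Δ) t≈) 0≤Δ Δ≤2σ)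

-- The expected loss, idle supply nodes and convexity in the degree.

module LossBound (ℝ : CompleteOrderedField) where
  open CompleteOrderedField ℝ hiding (zero)
  open Loss ℝ
  open Field ℝ
  open RangeSum +-commutativeMonoid
  open Binomial ℝ
  open Tail ℝ using (tail-probability; if-nonNeg)
  open import Data.Bool.Base using (Bool; true; false; if_then_else_; _∧_)
  open import Data.Fin.Base using (Fin; zero; suc)
  open import Data.Integer.Base using (+_)
  open import Data.Nat.Base as ℕ using (ℕ; zero; suc; z≤n; s≤s; NonZero; _∸_)
  import Data.Nat.Properties as ℕ
  import Algebra.Properties.CommutativeMonoid.Sum ℕ.+-0-commutativeMonoid as ℕSum
  open import Data.Product.Base using (∃; _×_; _,_; proj₁; proj₂)
  open import Data.Sum.Base using (inj₁; inj₂)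
  open import Data.Vec.Base using (Vec; []; _∷_; lookup)
  open import Data.Vec.Functional using (Vector)
  open import Function.Base using (_∘_)
  open import Relation.Nullary using (Dec; does; yes; no)
  open import Relation.Binary.PropositionalEquality.Core as ≡ using (_≡_)
  open import Algebra.Properties.Semiring.Sum semiring
    using (sum-cong-≋; sum-replicate; ∑-distrib-+; ∑-comm; *-distribˡ-sum; *-distribʳ-sum)

  sum-mono-≤ : ∀ {n} {f g : Vector Carrier n} → (∀ i → f i ≤ g i) → sum f ≤ sum g
  sum-mono-≤ {zero}  f≤g = ≤.refl
  sum-mono-≤ {suc n} f≤g = +-mono-≤ (f≤g zero) (sum-mono-≤ (f≤g ∘ suc))

  sum-nonNeg : ∀ {n} {f : Vector Carrier n} → (∀ i → 0# ≤ f i) → 0# ≤ sum f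
  sum-nonNeg {zero}  0≤f = ≤.refl
  sum-nonNeg {suc n} 0≤f = +-nonNeg (0≤f zero) (sum-nonNeg (0≤f ∘ suc))

  term≤sum : ∀ {n} {f : Vector Carrier n} → (∀ i → 0# ≤ f i) → ∀ i → f i ≤ sum f
  term≤sum 0≤f zero    = ≤-by _ (sum-nonNeg (0≤f ∘ suc)) refl
  term≤sum 0≤f (suc i) = ≤.trans (term≤sum (0≤f ∘ suc) i) (≤-by _ (0≤f zero) (+-comm _ _))

  sum-const : ∀ n x → ∑[ i < n ] x ≈ fromℕ n * x
  sum-const zero    x = sym (zeroˡ x)
  sum-const (suc n) x = trans (+-cong (sym (*-identityˡ x)) (sum-const n x)) (sym (distribʳ x 1# (fromℕ n)))

  indicator : Bool → Carrier
  indicator b = if b then 1# else 0#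

  module LinearProgram {n} {D : Vector Carrier n} (0≤D : ∀ j → 0# ≤ D j) where

    onEdge-nonNeg : ∀ (G : BipartiteGraph n) {x} → (∀ i j → 0# ≤ x i j) → ∀ i j → 0# ≤ onEdge G x i j
    onEdge-nonNeg G 0≤x i j with G i j
    ... | true  = 0≤x i j
    ... | false = ≤.refl

    feasible-zero : (G : BipartiteGraph n) → Feasible G D (λ _ _ → 0#)
    feasible-zero G = record
      { nonNeg = λ _ _ → ≤.refl
      ; supply = λ i → ≤.trans (sum-zero (λ j → onEdge-zero i j)) 0≤1
      ; demand = λ j → ≤.trans (sum-zero (λ i → onEdge-zero i j)) (0≤D j)
      }
      where
      onEdge-zero : ∀ i j → onEdge G (λ _ _ → 0#) i j ≤ 0#
      onEdge-zero i j with G i j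
      ... | true  = ≤.refl
      ... | false = ≤.refl
      sum-zero : ∀ {m} {f : Vector Carrier m} → (∀ i → f i ≤ 0#) → sum f ≤ 0#
      sum-zero {zero}  f≤0 = ≤.refl
      sum-zero {suc m} f≤0 = ≤.trans (+-mono-≤ (f≤0 zero) (sum-zero (f≤0 ∘ suc))) (≤.reflexive (+-identityʳ 0#))

    z-lub : (G : BipartiteGraph n) → LeastUpperBound (λ v → ∃ λ x → Feasible G D x × v ≈ fulfilled G x) (z G D)
    z-lub G = sup-lub _ (_ , _ , feasible-zero G , refl)
      (∑[ i < n ] 1# , λ where v (x , feasible , v≈) → ≤.trans (≤.reflexive v≈) (sum-mono-≤ (Feasible.supply feasible)))

    z-upper : (G : BipartiteGraph n) (b : Vector Carrier n) →
              (∀ x → Feasible G D x → ∀ i → ∑[ j < n ] onEdge G x i j ≤ b i) → z G D ≤ sum b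
    z-upper G b row≤ = proj₂ (z-lub G) (sum b) λ where
      v (x , feasible , v≈) → ≤.trans (≤.reflexive v≈) (sum-mono-≤ (row≤ x feasible))

    z-lower : (G : BipartiteGraph n) → ∀ {x} → Feasible G D x → fulfilled G x ≤ z G D
    z-lower G {x} feasible = proj₁ (z-lub G) _ (x , feasible , refl)

    z-complete : (G : BipartiteGraph n) → z G D ≤ z (complete n) D
    z-complete G = proj₂ (z-lub G) _ λ where
      -- The flow is set to zero off the edges of G; its row and column sums in the complete graph
      -- are then those of G.
      v (x , feasible , v≈) → ≤.trans (≤.reflexive v≈) (z-lower (complete n) (record
        { nonNeg = onEdge-nonNeg G (Feasible.nonNeg feasible)
        ; supply = Feasible.supply feasible
        ; demand = Feasible.demand feasible
        }))

  count : ∀ {n} → Vec Bool n → ℕ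
  count []          = 0
  count (true ∷ ω)  = suc (count ω)
  count (false ∷ ω) = count ω

  -- Says that no neighbour in the row has positive demand. The recursion follows that of
  -- `∑Outcomes`, so that expectations unfold coordinate by coordinate.
  avoids : ∀ {n} → (Fin n → Bool) → Vec Bool n → Bool
  avoids row []      = true
  avoids row (b ∷ ω) = if b ∧ row zero then false else avoids (row ∘ suc) ω

  avoids⇒ : ∀ {n} (row : Fin n → Bool) ω → avoids row ω ≡ true → ∀ j → row j ≡ true → lookup ω j ≡ false
  avoids⇒ row (false ∷ ω) av zero    e = ≡.refl
  avoids⇒ row (true ∷ ω)  av zero    e with row zero
  avoids⇒ row (true ∷ ω)  () zero    e | true
  avoids⇒ row (true ∷ ω)  av zero    () | false
  avoids⇒ row (false ∷ ω) av (suc j) e = avoids⇒ (row ∘ suc) ω av j e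
  avoids⇒ row (true ∷ ω)  av (suc j) e with row zero
  avoids⇒ row (true ∷ ω)  () (suc j) e | true
  avoids⇒ row (true ∷ ω)  av (suc j) e | false = avoids⇒ (row ∘ suc) ω av j e

  sum-successes : ∀ {n} (ω : Vec Bool n) y → ∑[ j < n ] (if lookup ω j then y else 0#) ≈ fromℕ (count ω) * y
  sum-successes []          y = sym (zeroˡ y)
  sum-successes (true ∷ ω)  y = trans (+-cong (sym (*-identityˡ y)) (sum-successes ω y)) (sym (distribʳ y 1# (fromℕ (count ω))))
  sum-successes (false ∷ ω) y = trans (+-identityˡ _) (sum-successes ω y)

  module _ {p} (0<p : 0# < p) {n} .{{_ : NonZero n}} (G : BipartiteGraph n) (ω : Vec Bool n) where
    private
      D : Vector Carrier n
      D = bernoulliDemand p ω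

      1/p-nonNeg : 0# ≤ 1# / p
      1/p-nonNeg = /-nonNeg 0≤1 0<p

      0≤D : ∀ j → 0# ≤ D j
      0≤D j with lookup ω j
      ... | true  = 1/p-nonNeg
      ... | false = ≤.refl

      open LinearProgram 0≤D

    loss-nonNeg : 0# ≤ lossAt G D
    loss-nonNeg = ≤⇒0≤- (z-complete G)

    module _ (np≤count : fromℕ n * p ≤ fromℕ (count ω)) where
      private
        c = fromℕ (count ω)

        0<c : 0# < c
        0<c = begin-strict
          0#            <⟨ *-pos (fromℕ-pos n) 0<p ⟩
          fromℕ n * p   ≤⟨ np≤count ⟩
          c             ∎

        -- Every supply node spreads its unit evenly over the nodes with demand. Such a node
        -- receives n/c, and n/c ≤ 1/p is the hypothesis np ≤ c.
        even : Fin n → Fin n → Carrier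
        even i j = if lookup ω j then 1# / c else 0#

        row-sum : ∑[ j < n ] (if lookup ω j then 1# / c else 0#) ≈ 1#
        row-sum = trans (sum-successes ω (1# / c)) (trans (*-comm c (1# / c)) (/-*-cancel 0<c))

        feasible-even : Feasible (complete n) D even
        feasible-even = record { nonNeg = λ i j → nonNeg′ j ; supply = λ i → ≤.reflexive row-sum ; demand = demand′ }
          where
          nonNeg′ : ∀ j → 0# ≤ (if lookup ω j then 1# / c else 0#)
          nonNeg′ j with lookup ω j
          ... | true  = /-nonNeg 0≤1 0<c
          ... | false = ≤.refl
          demand′ : ∀ j → ∑[ i < n ] (if lookup ω j then 1# / c else 0#) ≤ (if lookup ω j then 1# / p else 0#)
          demand′ j with lookup ω j
          ... | false = ≤.reflexive (trans (sum-const n 0#) (zeroʳ _))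
          ... | true  = /-lower 0<p (begin
            (∑[ i < n ] (1# / c)) * p   ≈⟨ *-congʳ (sum-const n (1# / c)) ⟩
            fromℕ n * (1# / c) * p      ≈⟨ solve 3 (λ n y p → n :* y :* p := n :* p :* y) refl (fromℕ n) (1# / c) p ⟩
            fromℕ n * p * (1# / c)      ≤⟨ *-monoˡ-≤ (/-nonNeg 0≤1 0<c) np≤count ⟩
            c * (1# / c)                ≈⟨ trans (*-comm c (1# / c)) (/-*-cancel 0<c) ⟩
            1#                          ∎)

        χ : Fin n → Carrier
        χ i = indicator (avoids (G i) ω)

        -- An edge of such a row leads to a node without demand, where a nonnegative column has sum
        -- at most zero.
        avoiding-row≤0 : ∀ x → Feasible G D x → ∀ i → avoids (G i) ω ≡ true → ∀ j → onEdge G x i j ≤ 0#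
        avoiding-row≤0 x feasible i av j = case-edge (G i j) ≡.refl
          where
          D≈0 : G i j ≡ true → D j ≈ 0#
          D≈0 e = reflexive (≡.cong (λ b → if b then 1# / p else 0#) (avoids⇒ (G i) ω av j e))
          case-edge : ∀ b → G i j ≡ b → onEdge G x i j ≤ 0#
          case-edge true  e = ≤.trans (term≤sum (λ i → onEdge-nonNeg G (Feasible.nonNeg feasible) i j) i)
                                      (≤.trans (Feasible.demand feasible j) (≤.reflexive (D≈0 e)))
          case-edge false e = ≤.reflexive (reflexive (≡.cong (λ b → if b then x i j else 0#) e))

        row≤ : ∀ x → Feasible G D x → ∀ i → ∑[ j < n ] onEdge G x i j ≤ 1# - χ i
        row≤ x feasible i = case-avoids (avoids (G i) ω) ≡.refl
          where
          case-avoids : ∀ b → avoids (G i) ω ≡ b → ∑[ j < n ] onEdge G x i j ≤ 1# - indicator b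
          case-avoids true  e = ≤.trans (sum-mono-≤ {g = λ _ → 0#} (avoiding-row≤0 x feasible i e))
            (≤.reflexive (trans (sum-const n 0#) (trans (zeroʳ _) (sym (-‿inverseʳ 1#)))))
          case-avoids false _ = ≤.trans (Feasible.supply feasible i) (≤.reflexive (solve 0 (con (+ 1) := con (+ 1) :- con (+ 0)) refl))

      loss≥avoiding : ∑[ i < n ] indicator (avoids (G i) ω) ≤ lossAt G D
      loss≥avoiding = ≤-by ((z (complete n) D - sum even-rows) + (sum (λ i → 1# - χ i) - z G D))
        (+-nonNeg (≤⇒0≤- (z-lower (complete n) feasible-even)) (≤⇒0≤- (z-upper G (λ i → 1# - χ i) row≤)))
        (begin-equality
          z (complete n) D - z G D
            ≈⟨ solve 4 (λ a b c d → a :- b := (c :- d) :+ ((a :- c) :+ (d :- b))) refl (z (complete n) D) (z G D) (sum even-rows) (sum (λ i → 1# - χ i)) ⟩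
          (sum even-rows - sum (λ i → 1# - χ i)) + ((z (complete n) D - sum even-rows) + (sum (λ i → 1# - χ i) - z G D))
            ≈⟨ +-congʳ (begin-equality
                 sum even-rows - sum (λ i → 1# - χ i)
                   ≈⟨ +-congʳ (sum-cong-≋ {n} (λ i → trans row-sum (solve 1 (λ x → con (+ 1) := x :+ (con (+ 1) :- x)) refl (χ i)))) ⟩
                 sum (λ i → χ i + (1# - χ i)) - sum (λ i → 1# - χ i)
                   ≈⟨ +-congʳ (∑-distrib-+ χ (λ i → 1# - χ i)) ⟩
                 sum χ + sum (λ i → 1# - χ i) - sum (λ i → 1# - χ i)
                   ≈⟨ solve 2 (λ x y → x :+ y :- y := x) refl (sum χ) (sum (λ i → 1# - χ i)) ⟩
                 sum χ ∎) ⟩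
          sum χ + ((z (complete n) D - sum even-rows) + (sum (λ i → 1# - χ i) - z G D)) ∎)
        where
        even-rows : Fin n → Carrier
        even-rows i = ∑[ j < n ] onEdge (complete n) even i j

  ∑Outcomes-mono-≤ : ∀ n {f g} → (∀ ω → f ω ≤ g ω) → ∑Outcomes n f ≤ ∑Outcomes n g
  ∑Outcomes-mono-≤ zero    f≤g = f≤g []
  ∑Outcomes-mono-≤ (suc n) f≤g = +-mono-≤ (∑Outcomes-mono-≤ n (λ ω → f≤g (true ∷ ω))) (∑Outcomes-mono-≤ n (λ ω → f≤g (false ∷ ω)))

  ∑Outcomes-cong : ∀ n {f g} → (∀ ω → f ω ≈ g ω) → ∑Outcomes n f ≈ ∑Outcomes n g
  ∑Outcomes-cong zero    f≈g = f≈g []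
  ∑Outcomes-cong (suc n) f≈g = +-cong (∑Outcomes-cong n (λ ω → f≈g (true ∷ ω))) (∑Outcomes-cong n (λ ω → f≈g (false ∷ ω)))

  *-∑Outcomes : ∀ n x f → ∑Outcomes n (λ ω → x * f ω) ≈ x * ∑Outcomes n f
  *-∑Outcomes zero    x f = refl
  *-∑Outcomes (suc n) x f = trans (+-cong (*-∑Outcomes n x _) (*-∑Outcomes n x _)) (sym (distribˡ x _ _))

  ∑Outcomes-sum : ∀ n {m} (f : Fin m → Vec Bool n → Carrier) → ∑Outcomes n (λ ω → ∑[ i < m ] f i ω) ≈ ∑[ i < m ] ∑Outcomes n (f i)
  ∑Outcomes-sum zero    f = refl
  ∑Outcomes-sum (suc n) f = trans (+-cong (∑Outcomes-sum n fᵗ) (∑Outcomes-sum n fᶠ))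
    (sym (∑-distrib-+ (λ i → ∑Outcomes n (fᵗ i)) (λ i → ∑Outcomes n (fᶠ i))))
    where
    fᵗ = λ i ω → f i (true ∷ ω)
    fᶠ = λ i ω → f i (false ∷ ω)

  degree : ∀ {n} → (Fin n → Bool) → ℕ
  degree {n} row = ℕSum.sum {n} (λ j → if row j then 1 else 0)

  degree≤n : ∀ {n} (row : Fin n → Bool) → degree row ℕ.≤ n
  degree≤n {zero}  row = z≤n
  degree≤n {suc n} row with row zero
  ... | true  = s≤s (degree≤n (row ∘ suc))
  ... | false = ℕ.m≤n⇒m≤1+n (degree≤n (row ∘ suc))

  module _ (p : Carrier) where
    private
      q = 1# - p

      split-prob : ∀ x n (f g : Vec Bool n → Carrier) → (∀ ω → f ω ≈ x * g ω) → ∑Outcomes n f ≈ x * ∑Outcomes n g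
      split-prob x n f g f≈ = trans (∑Outcomes-cong n f≈) (*-∑Outcomes n x g)

    -- The neighbours all fail, and the count then comes from the other n - degree nodes alone. A
    -- general f allows the shift to `f ∘ suc` in the induction.
    𝔼-avoiding : ∀ {n} (row : Fin n → Bool) f →
      𝔼 p {n} (λ ω → indicator (avoids row ω) * f (count ω)) ≈ q ^ degree row * expectation p q (n ∸ degree row) f
    𝔼-avoiding {zero} row f = begin-equality
      1# * (1# * f 0)               ≈⟨ *-congˡ (*-congˡ (expectation-zero p q f)) ⟨
      1# * (1# * expectation p q 0 f) ≈⟨ *-identityˡ _ ⟩
      1# * expectation p q 0 f      ∎
    𝔼-avoiding {suc n} row f with row zero
    ... | true = begin-equality
      ∑Outcomes n (λ ω → p * prob p ω * (0# * f (suc (count ω)))) + ∑Outcomes n (λ ω → q * prob p ω * (indicator (avoids (row ∘ suc) ω) * f (count ω)))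
        ≈⟨ +-cong (split-prob 0# n _ (λ _ → 0#) (λ ω → solve 2 (λ x y → x :* (con (+ 0) :* y) := con (+ 0) :* con (+ 0)) refl (p * prob p ω) (f (suc (count ω)))))
                  (trans (split-prob q n _ _ (λ ω → *-assoc q (prob p ω) _)) (*-congˡ (𝔼-avoiding (row ∘ suc) f))) ⟩
      0# * ∑Outcomes n (λ _ → 0#) + q * (q ^ degree (row ∘ suc) * expectation p q (n ∸ degree (row ∘ suc)) f)
        ≈⟨ solve 4 (λ z q x e → con (+ 0) :* z :+ q :* (x :* e) := q :* x :* e) refl (∑Outcomes n (λ _ → 0#)) q (q ^ degree (row ∘ suc)) (expectation p q (n ∸ degree (row ∘ suc)) f) ⟩
      q * q ^ degree (row ∘ suc) * expectation p q (n ∸ degree (row ∘ suc)) f ∎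
    ... | false = begin-equality
      ∑Outcomes n (λ ω → p * prob p ω * (indicator (avoids (row ∘ suc) ω) * f (suc (count ω)))) + ∑Outcomes n (λ ω → q * prob p ω * (indicator (avoids (row ∘ suc) ω) * f (count ω)))
        ≈⟨ +-cong (trans (split-prob p n _ _ (λ ω → *-assoc p (prob p ω) _)) (*-congˡ (𝔼-avoiding (row ∘ suc) (f ∘ suc))))
                  (trans (split-prob q n _ _ (λ ω → *-assoc q (prob p ω) _)) (*-congˡ (𝔼-avoiding (row ∘ suc) f))) ⟩
      p * (q ^ k * expectation p q (n ∸ k) (f ∘ suc)) + q * (q ^ k * expectation p q (n ∸ k) f)
        ≈⟨ solve 5 (λ p q x a b → p :* (x :* a) :+ q :* (x :* b) := x :* (p :* a :+ q :* b)) refl p q (q ^ k) (expectation p q (n ∸ k) (f ∘ suc)) (expectation p q (n ∸ k) f) ⟩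
      q ^ k * (p * expectation p q (n ∸ k) (f ∘ suc) + q * expectation p q (n ∸ k) f)
        ≈⟨ *-congˡ (expectation-suc p q (n ∸ k) f) ⟨
      q ^ k * expectation p q (suc (n ∸ k)) f
        ≈⟨ *-congˡ (reflexive (≡.cong (λ m → expectation p q m f) (ℕ.+-∸-assoc 1 (degree≤n (row ∘ suc))))) ⟨
      q ^ k * expectation p q (suc n ∸ k) f ∎
      where k = degree (row ∘ suc)

  -- ψ is the decrement of φ, so φ is convex and lies above the line through (d, φ d) with slope -ψ
  -- d. Each side of d is reached by unit steps.
  convex-tangent : ∀ n (φ ψ : ℕ → Carrier) → (∀ x → x ℕ.< n → φ x ≈ φ (suc x) + ψ x) →
    (∀ {x y} → x ℕ.≤ y → y ℕ.< n → ψ y ≤ ψ x) →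
    ∀ d x → d ℕ.< n → x ℕ.≤ n → φ d ≤ φ x + (fromℕ x - fromℕ d) * ψ d
  convex-tangent n φ ψ φ≈ ψ-decreasing d x d<n x≤n with ℕ.≤-total d x
  ... | inj₁ d≤x = ≡.subst (λ x → φ d ≤ φ x + (fromℕ x - fromℕ d) * ψ d) (ℕ.m+[n∸m]≡n d≤x)
                     (right (x ∸ d) (≡.subst (ℕ._≤ n) (≡.sym (ℕ.m+[n∸m]≡n d≤x)) x≤n))
    where
    right : ∀ e → d ℕ.+ e ℕ.≤ n → φ d ≤ φ (d ℕ.+ e) + (fromℕ (d ℕ.+ e) - fromℕ d) * ψ d
    right zero _ rewrite ℕ.+-identityʳ d = ≤.reflexive (solve 3 (λ f k s → f := f :+ (k :- k) :* s) refl (φ d) (fromℕ d) (ψ d))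
    right (suc e) d+e<n rewrite ℕ.+-suc d e = begin
      φ d
        ≤⟨ right e (ℕ.<⇒≤ d+e<n) ⟩
      φ (d ℕ.+ e) + (fromℕ (d ℕ.+ e) - fromℕ d) * ψ d
        ≈⟨ +-congʳ (φ≈ (d ℕ.+ e) d+e<n) ⟩
      φ (suc (d ℕ.+ e)) + ψ (d ℕ.+ e) + (fromℕ (d ℕ.+ e) - fromℕ d) * ψ d
        ≤⟨ ≤-by (ψ d - ψ (d ℕ.+ e)) (≤⇒0≤- (ψ-decreasing (ℕ.m≤m+n d e) d+e<n))
             (solve 5 (λ f k l s r → f :+ (con (+ 1) :+ k :- l) :* s := f :+ r :+ (k :- l) :* s :+ (s :- r)) refl
               (φ (suc (d ℕ.+ e))) (fromℕ (d ℕ.+ e)) (fromℕ d) (ψ d) (ψ (d ℕ.+ e))) ⟩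
      φ (suc (d ℕ.+ e)) + (fromℕ (suc (d ℕ.+ e)) - fromℕ d) * ψ d ∎
  ... | inj₂ x≤d = ≡.subst (λ x → φ d ≤ φ x + (fromℕ x - fromℕ d) * ψ d) (ℕ.m∸[m∸n]≡n x≤d) (left (d ∸ x) (ℕ.m∸n≤m d x))
    where
    left : ∀ e → e ℕ.≤ d → φ d ≤ φ (d ∸ e) + (fromℕ (d ∸ e) - fromℕ d) * ψ d
    left zero    _   = ≤.reflexive (solve 3 (λ f k s → f := f :+ (k :- k) :* s) refl (φ d) (fromℕ d) (ψ d))
    left (suc e) e<d = begin
      φ d
        ≤⟨ left e (ℕ.<⇒≤ e<d) ⟩
      φ (d ∸ e) + (fromℕ (d ∸ e) - fromℕ d) * ψ d
        ≡⟨ ≡.cong (λ y → φ y + (fromℕ y - fromℕ d) * ψ d) d∸e≡ ⟩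
      φ (suc y) + (1# + fromℕ y - fromℕ d) * ψ d
        ≤⟨ ≤-by (ψ y - ψ d) (≤⇒0≤- (ψ-decreasing (ℕ.m∸n≤m d (suc e)) d<n))
             (solve 5 (λ f k l s r → f :+ r :+ (k :- l) :* s := f :+ (con (+ 1) :+ k :- l) :* s :+ (r :- s)) refl
               (φ (suc y)) (fromℕ y) (fromℕ d) (ψ d) (ψ y)) ⟩
      φ (suc y) + ψ y + (fromℕ y - fromℕ d) * ψ d
        ≈⟨ +-congʳ (φ≈ y (ℕ.≤-<-trans (ℕ.m∸n≤m d (suc e)) d<n)) ⟨
      φ y + (fromℕ y - fromℕ d) * ψ d ∎
      where
      y = d ∸ suc e
      d∸e≡ : d ∸ e ≡ suc y
      d∸e≡ = ℕ.+-∸-assoc 1 e<d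

  module _ {p} (0<p : 0# < p) (0≤q : 0# ≤ 1# - p) where
    private
      q = 1# - p

      0≤p : 0# ≤ p
      0≤p = <⇒≤ 0<p

    prob-nonNeg : ∀ {n} (ω : Vec Bool n) → 0# ≤ prob p ω
    prob-nonNeg []          = 0≤1
    prob-nonNeg (true ∷ ω)  = *-nonNeg 0≤p (prob-nonNeg ω)
    prob-nonNeg (false ∷ ω) = *-nonNeg 0≤q (prob-nonNeg ω)

    module _ (n : ℕ) (f : ℕ → Carrier) (0≤f : ∀ k → 0# ≤ f k) where
      private
        -- φ x is the expectation of f at the count restricted to outcomes in which x given nodes
        -- fail; ψ x is the part of it in which one further given node succeeds.
        φ ψ : ℕ → Carrier
        φ x = q ^ x * expectation p q (n ∸ x) f
        ψ x = q ^ x * (p * expectation p q (n ∸ suc x) (f ∘ suc))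

        φ-difference : ∀ x → x ℕ.< n → φ x ≈ φ (suc x) + ψ x
        φ-difference x x<n = begin-equality
          q ^ x * expectation p q (n ∸ x) f
            ≈⟨ *-congˡ (trans (reflexive (≡.cong (λ m → expectation p q m f) (ℕ.+-∸-assoc 1 x<n))) (expectation-suc p q (n ∸ suc x) f)) ⟩
          q ^ x * (p * expectation p q (n ∸ suc x) (f ∘ suc) + q * expectation p q (n ∸ suc x) f)
            ≈⟨ solve 5 (λ x p a q b → x :* (p :* a :+ q :* b) := q :* x :* b :+ x :* (p :* a)) refl (q ^ x) p (expectation p q (n ∸ suc x) (f ∘ suc)) q (expectation p q (n ∸ suc x) f) ⟩
          φ (suc x) + ψ x ∎

        -- The decrement of ψ is the part in which two further given nodes succeed, again an
        -- expectation of nonnegative values.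
        ψ-step : ∀ x → suc x ℕ.< n → ψ (suc x) ≤ ψ x
        ψ-step x 1+x<n = ≤-by (q ^ x * (p * (p * e₂))) (*-nonNeg (^-nonNeg x 0≤q) (*-nonNeg 0≤p (*-nonNeg 0≤p
            (expectation-nonNeg 0≤p 0≤q (n ∸ suc (suc x)) (λ k → 0≤f (suc (suc k))))))) (begin-equality
          q ^ x * (p * expectation p q (n ∸ suc x) (f ∘ suc))
            ≈⟨ *-congˡ (*-congˡ (trans (reflexive (≡.cong (λ m → expectation p q m (f ∘ suc)) (ℕ.+-∸-assoc 1 1+x<n))) (expectation-suc p q (n ∸ suc (suc x)) (f ∘ suc)))) ⟩
          q ^ x * (p * (p * e₂ + q * e₁))
            ≈⟨ solve 5 (λ x p a q b → x :* (p :* (p :* a :+ q :* b)) := q :* x :* (p :* b) :+ x :* (p :* (p :* a))) refl (q ^ x) p e₂ q e₁ ⟩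
          ψ (suc x) + q ^ x * (p * (p * e₂)) ∎)
          where
          e₁ = expectation p q (n ∸ suc (suc x)) (f ∘ suc)
          e₂ = expectation p q (n ∸ suc (suc x)) (λ k → f (suc (suc k)))

        ψ-decreasing : ∀ {x y} → x ℕ.≤ y → y ℕ.< n → ψ y ≤ ψ x
        ψ-decreasing {x} {zero}  z≤n _ = ≤.refl
        ψ-decreasing {x} {suc y} x≤y y<n with ℕ.m≤n⇒m<n∨m≡n x≤y
        ... | inj₁ x<y    = ≤.trans (ψ-step y y<n) (ψ-decreasing (ℕ.≤-pred x<y) (ℕ.<⇒≤ y<n))
        ... | inj₂ ≡.refl = ≤.refl

      -- Tangent bounds at d, summed over the nodes; the linear terms cancel because the degrees add
      -- up to dn.
      jensen : ∀ d → d ℕ.< n → (D : Fin n → ℕ) → (∀ i → D i ℕ.≤ n) → ℕSum.sum D ≡ d ℕ.* n →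
               fromℕ n * (q ^ d * expectation p q (n ∸ d) f) ≤ ∑[ i < n ] (q ^ D i * expectation p q (n ∸ D i) f)
      jensen d d<n D D≤n ΣD = begin
        fromℕ n * φ d
          ≈⟨ sum-const n (φ d) ⟨
        ∑[ i < n ] φ d
          ≤⟨ sum-mono-≤ (λ i → convex-tangent n φ ψ φ-difference ψ-decreasing d (D i) d<n (D≤n i)) ⟩
        ∑[ i < n ] (φ (D i) + (fromℕ (D i) - fromℕ d) * ψ d)
          ≈⟨ ∑-distrib-+ (φ ∘ D) (λ i → (fromℕ (D i) - fromℕ d) * ψ d) ⟩
        sum (φ ∘ D) + ∑[ i < n ] ((fromℕ (D i) - fromℕ d) * ψ d)
          ≈⟨ +-congˡ (begin-equality
               ∑[ i < n ] ((fromℕ (D i) - fromℕ d) * ψ d)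
                 ≈⟨ *-distribʳ-sum (ψ d) (λ i → fromℕ (D i) - fromℕ d) ⟨
               (∑[ i < n ] (fromℕ (D i) - fromℕ d)) * ψ d
                 ≈⟨ *-congʳ (trans (∑-distrib-+ (fromℕ ∘ D) (λ _ → - fromℕ d)) (+-cong (trans (sum-fromℕ D) (fromℕ-cong ΣD)) (sum-const n (- fromℕ d)))) ⟩
               (fromℕ (d ℕ.* n) + fromℕ n * - fromℕ d) * ψ d
                 ≈⟨ *-congʳ (+-congʳ (fromℕ-* d n)) ⟩
               (fromℕ d * fromℕ n + fromℕ n * - fromℕ d) * ψ d
                 ≈⟨ solve 3 (λ d n s → (d :* n :+ n :* (:- d)) :* s := con (+ 0)) refl (fromℕ d) (fromℕ n) (ψ d) ⟩
               0# ∎) ⟩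
        sum (φ ∘ D) + 0#
          ≈⟨ +-identityʳ _ ⟩
        sum (φ ∘ D) ∎
        where
        sum-fromℕ : ∀ {m} (D : Fin m → ℕ) → sum (fromℕ ∘ D) ≈ fromℕ (ℕSum.sum D)
        sum-fromℕ {zero}  D = refl
        sum-fromℕ {suc m} D = trans (+-congˡ (sum-fromℕ (D ∘ suc))) (sym (fromℕ-+ (D zero) (ℕSum.sum (D ∘ suc))))

    binomial-tail : ∀ m t → ℙ[Bin m , p ≥ t ] ≈ tail-probability p q m t
    binomial-tail m t = sym (reflexive (Σ<-sum (suc m) _))

    reaches : Carrier → ℕ → Carrier
    reaches t k = if does (t ≤? fromℕ k) then 1# else 0#

    -- As an expectation of an indicator of the count, the tail fits both `𝔼-avoiding` and `jensen`.
    tail≈expectation : ∀ m t → tail-probability p q m t ≈ expectation p q m (reaches t)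
    tail≈expectation m t = Σ<-cong (suc m) (λ k _ → factor (t ≤? fromℕ k) (pmf p q m k))
      where
      factor : {P : Set} (P? : Dec P) → ∀ x → (if does P? then x else 0#) ≈ x * (if does P? then 1# else 0#)
      factor (yes _) x = sym (*-identityʳ x)
      factor (no  _) x = sym (zeroʳ x)

    loss-lower-bound : ∀ n d → d ℕ.< n → (G : BipartiteGraph n) → edgeCount G ≡ d ℕ.* n →
      tail-probability p q (n ∸ d) (fromℕ n * p) * (fromℕ n * q ^ d) ≤ expectedLoss p G
    loss-lower-bound n@(suc _) d d<n G edges = begin
      tail-probability p q (n ∸ d) t * (fromℕ n * q ^ d)
        ≈⟨ *-congʳ (tail≈expectation (n ∸ d) t) ⟩
      expectation p q (n ∸ d) r * (fromℕ n * q ^ d)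
        ≈⟨ solve 3 (λ e n x → e :* (n :* x) := n :* (x :* e)) refl (expectation p q (n ∸ d) r) (fromℕ n) (q ^ d) ⟩
      fromℕ n * (q ^ d * expectation p q (n ∸ d) r)
        ≤⟨ jensen n r (λ k → if-nonNeg (t ≤? fromℕ k) 0≤1) d d<n (λ i → degree (G i)) (λ i → degree≤n (G i)) edges ⟩
      ∑[ i < n ] (q ^ degree (G i) * expectation p q (n ∸ degree (G i)) r)
        ≈⟨ sum-cong-≋ {n} (λ i → sym (𝔼-avoiding p (G i) r)) ⟩
      ∑[ i < n ] 𝔼 p (λ ω → indicator (avoids (G i) ω) * r (count ω))
        ≈⟨ ∑Outcomes-sum n (λ i ω → prob p ω * (indicator (avoids (G i) ω) * r (count ω))) ⟨
      ∑Outcomes n (λ ω → ∑[ i < n ] (prob p ω * (indicator (avoids (G i) ω) * r (count ω))))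
        ≈⟨ ∑Outcomes-cong n (λ ω → trans (sym (*-distribˡ-sum (prob p ω) (λ i → indicator (avoids (G i) ω) * r (count ω))))
             (*-congˡ (sym (*-distribʳ-sum (r (count ω)) (λ i → indicator (avoids (G i) ω)))))) ⟩
      ∑Outcomes n (λ ω → prob p ω * ((∑[ i < n ] indicator (avoids (G i) ω)) * r (count ω)))
        ≤⟨ ∑Outcomes-mono-≤ n (λ ω → *-monoʳ-≤ (prob-nonNeg ω) (pointwise ω (t ≤? fromℕ (count ω)))) ⟩
      expectedLoss p G ∎
      where
      t = fromℕ n * p
      r = reaches t
      pointwise : ∀ ω (P? : Dec (t ≤ fromℕ (count ω))) →
        (∑[ i < n ] indicator (avoids (G i) ω)) * (if does P? then 1# else 0#) ≤ lossAt G (bernoulliDemand p ω)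
      pointwise ω (yes t≤count) = ≤.trans (≤.reflexive (*-identityʳ _)) (loss≥avoiding 0<p G ω t≤count)
      -- Outcomes below the threshold contribute only the nonnegativity of their loss.
      pointwise ω (no  _)       = ≤.trans (≤.reflexive (zeroʳ _)) (loss-nonNeg 0<p G ω)

theorem3p1 :
  (ℝ : CompleteOrderedField) →
  let open CompleteOrderedField ℝ
      open Reals ℝ
      open Loss ℝ
  in
  ∃ λ (c : Carrier) → 0# < c ×
    (∀ (p : Carrier) → 0# < p → p < 1# →
     ∀ (n d : ℕ) → d ℕ.< n →
     ∀ (G : BipartiteGraph n) → edgeCount G ≡ d ℕ.* n →
     let q = 1# - p
         tail = ℙ[Bin n ∸ d , p ≥ fromℕ n * p ]
     in
     (tail * (fromℕ n * q ^ d) ≤ expectedLoss p G) ×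
     ((1# / fromℕ 2
         - (fromℕ d * p) / √ (fromℕ 2 * π * fromℕ (n ∸ d) * p * q)
         - (c * (1# - fromℕ 2 * p * q)) / √ (fromℕ (n ∸ d) * p * q))
       * (fromℕ n * q ^ d)
      ≤ tail * (fromℕ n * q ^ d)))
theorem3p1 ℝ = fromℕ 10 , fromℕ-pos 10 , λ p 0<p p<1 n d d<n G edges →
  let 0<q   = <⇒0<- p<1
      tail≈ = binomial-tail 0<p (<⇒≤ 0<q) (n ∸ d) (fromℕ n * p)
  in
  (begin
    ℙ[Bin n ∸ d , p ≥ fromℕ n * p ] * (fromℕ n * (1# - p) ^ d)
      ≈⟨ *-congʳ tail≈ ⟩
    tail-probability p (1# - p) (n ∸ d) (fromℕ n * p) * (fromℕ n * (1# - p) ^ d)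
      ≤⟨ loss-lower-bound 0<p (<⇒≤ 0<q) n d d<n G edges ⟩
    expectedLoss p G ∎) ,
  *-monoˡ-≤ (*-nonNeg (fromℕ-nonNeg n) (^-nonNeg d (<⇒≤ 0<q)))
    (≤.trans (tail-lower-bound 0<p 0<q (solve 1 (λ p → p :+ (con (+ 1) :- p) := con (+ 1)) refl p) n d d<n)
             (≤.reflexive (sym tail≈)))
  where
  open import Data.Integer.Base using (+_)
  open CompleteOrderedField ℝ
  open Loss ℝ
  open Field ℝ
  open Tail ℝ
  open LossBound ℝ
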